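{- For $n\ge1$, letting $W_n(t,q):=\sum_{\pi\in\mathfrak{S}_n(321)}t^{\mathsf{wex}\,\pi}q^{\mathsf{inv}\,\pi}$, we have $$W_n(t,q)=t^n\sum_{\pi\in\mathfrak{S}_n(\tau)}(q/t)^{\mathsf{des}\,\pi}q^{\mathsf{stat}\,\pi}$$ for each of the following pairs $(\tau,\mathsf{stat})$: $(231,31\text{ - }2)$, $(231,13\text{ - }2)$, $(231,\mathsf{adi}^*)$, $(312,2\text{ - }31)$, $(312,2\text{ - }13)$, $(312,\mathsf{adi})$, $(213,31\text{ - }2)$, $(213,13\text{ - }2)$, $(132,2\text{ - }31)$, $(132,2\text{ - }13)$.
   Context: $\mathfrak{S}_n(\tau)$: permutations of $[n]$ avoiding classical pattern $\tau$. $\mathsf{wex}\,\pi=\#\{i:\pi(i)\ge i\}$, $\mathsf{inv}\,\pi=\#\{i<j:\pi(i)>\pi(j)\}$, $\mathsf{des}\,\pi=\#\{i\in[n-1]:\pi(i)>\pi(i+1)\}$. Vincular counts: $(31\text{ - }2)\pi=\#\{(i,j):i+1<j\le n,\pi(i+1)<\pi(j)<\pi(i)\}$, $(2\text{ - }31)\pi=\#\{(i,j):j<i<n,\pi(i+1)<\pi(j)<\pi(i)\}$, $(2\text{ - }13)\pi=\#\{(i,j):j<i<n,\pi(i)<\pi(j)<\pi(i+1)\}$, $(13\text{ - }2)\pi=\#\{(i,j):i+1<j\le n,\pi(i)<\pi(j)<\pi(i+1)\}$. Admissible inversions: set $\pi(n+1)=0$; an inversion pair $(\pi(i),\pi(j))$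 ($i<j$, $\pi(i)>\pi(j)$) is admissible if $\pi(j)<\pi(j+1)$ or some $l$ with $i<l<j$ has $\pi(l)<\pi(j)$; $\mathsf{adi}\,\pi$ counts them. Star admissible: set $\pi(0)=n+1$; an inversion pair $(\pi(i),\pi(j))$, $i<j$, is star admissible if $\pi(i-1)<\pi(i)$ or some $l$ with $i<l<j$ has $\pi(l)>\pi(i)$; $\mathsf{adi}^*\,\pi$ counts them. -}

module Defs where

open import Algebra.Bundles using (CommutativeRing; Semiring)
open import Data.Fin using (Fin; toℕ; fromℕ<)
import Data.Fin as Fin
import Data.Fin.Properties as Fin
open import Data.List using (List; []; _∷_; allFin; cartesianProduct; cartesianProductWith; filter; foldr; length; map; upTo)
open import Data.Nat using (ℕ; zero; suc; _+_; _∸_; _<_; _≤?_; _<?_)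
open import Data.Nat.Properties using (anyUpTo?)
open import Data.Product using (∃; _×_; _,_; uncurry)
open import Data.Vec using (Vec; []; _∷_; lookup)
import Data.Vec as Vec
import Data.Vec.Relation.Unary.AllPairs as AllPairs
open import Data.Vec.Relation.Unary.Unique.Propositional using (Unique)
open import Relation.Binary.Definitions using () renaming (Decidable to Decidable₂)
open import Relation.Nullary using (Dec; yes; no; ¬_)
open import Relation.Nullary.Decidable using (¬?; _×-dec_; _⊎-dec_; _→-dec_)
open import Relation.Unary using (Decidable)

-- A permutation of [n] is a word of length n over Fin n without repeated
-- letters: an injective self-map of a finite set is bijective.  Fin n is
-- 0-based; `_at_` below gives the 1-based one-line notation.
Word : ℕ → Set
Word n = Vec (Fin n) n

words : ∀ m k → List (Vec (Fin m) k)
words m zero    = [] ∷ []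
words m (suc k) = cartesianProductWith _∷_ (allFin m) (words m k)

unique? : ∀ {m k} → Decidable (Unique {A = Fin m} {n = k})
unique? = AllPairs.allPairs? (λ x y → ¬? (x Fin.≟ y))

permutations : ∀ n → List (Word n)
permutations n = filter unique? (words n n)

Pattern : Set
Pattern = Vec ℕ 3

p132 p213 p231 p312 p321 : Pattern
p132 = 1 ∷ 3 ∷ 2 ∷ []
p213 = 2 ∷ 1 ∷ 3 ∷ []
p231 = 2 ∷ 3 ∷ 1 ∷ []
p312 = 3 ∷ 1 ∷ 2 ∷ []
p321 = 3 ∷ 2 ∷ 1 ∷ []

OrderIsomorphic : ∀ {k} → Vec ℕ k → Vec ℕ k → Set
OrderIsomorphic u v = ∀ a b →
  (lookup u a < lookup u b → lookup v a < lookup v b) ×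
  (lookup v a < lookup v b → lookup u a < lookup u b)

orderIsomorphic? : ∀ {k} → Decidable₂ (OrderIsomorphic {k})
orderIsomorphic? u v = Fin.all? λ a → Fin.all? λ b →
  ((lookup u a <? lookup u b) →-dec (lookup v a <? lookup v b)) ×-dec
  ((lookup v a <? lookup v b) →-dec (lookup u a <? lookup u b))

subword : ∀ {n} → Word n → Fin n → Fin n → Fin n → Vec ℕ 3
subword π i j k = Vec.map (λ x → toℕ (lookup π x)) (i ∷ j ∷ k ∷ [])

Contains : ∀ {n} → Pattern → Word n → Set
Contains τ π = ∃ λ i → ∃ λ j → ∃ λ k →
  i Fin.< j × j Fin.< k × OrderIsomorphic τ (subword π i j k)

contains? : ∀ {n} τ → Decidable (Contains {n} τ)
contains? τ π = Fin.any? λ i → Fin.any? λ j → Fin.any? λ k →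
  (i Fin.<? j) ×-dec (j Fin.<? k) ×-dec orderIsomorphic? τ (subword π i j k)

Avoids : ∀ {n} → Pattern → Word n → Set
Avoids τ π = ¬ Contains τ π

avoids? : ∀ {n} τ → Decidable (Avoids {n} τ)
avoids? τ π = ¬? (contains? τ π)

𝔖 : ∀ n → Pattern → List (Word n)
𝔖 n τ = filter (avoids? τ) (permutations n)

-- π at i is π(i) for 1 ≤ i ≤ n, with values in {1,…,n}, extended by
-- π(0) = n + 1 (used only by adi*) and π(n + 1) = 0 (used only by adi).
infix 8 _at_
_at_ : ∀ {n} → Word n → ℕ → ℕ
_at_ {n} π zero    = suc n
_at_ {n} π (suc i) with i <? n
... | yes i<n = suc (toℕ (lookup π (fromℕ< i<n)))
... | no  _   = 0

[1⋯_] : ℕ → List ℕ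
[1⋯ n ] = map suc (upTo n)

count : ∀ n {P : ℕ → Set} → Decidable P → ℕ
count n P? = length (filter P? [1⋯ n ])

count₂ : ∀ n {P : ℕ → ℕ → Set} → (∀ i j → Dec (P i j)) → ℕ
count₂ n P? = length (filter (uncurry P?) (cartesianProduct [1⋯ n ] [1⋯ n ]))

Statistic : ℕ → Set
Statistic n = Word n → ℕ

module _ {n : ℕ} where

  wex : Statistic n
  wex π = count n λ i → i ≤? π at i

  des : Statistic n
  des π = count n λ i → (i <? n) ×-dec (π at (i + 1) <? π at i)

  inv : Statistic n
  inv π = count₂ n λ i j → (i <? j) ×-dec (π at j <? π at i)

  31-2 : Statistic n
  31-2 π = count₂ n λ i j →
    (i + 1 <? j) ×-dec (π at (i + 1) <? π at j) ×-dec (π at j <? π at i)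

  2-31 : Statistic n
  2-31 π = count₂ n λ i j →
    (j <? i) ×-dec (i <? n) ×-dec (π at (i + 1) <? π at j) ×-dec (π at j <? π at i)

  2-13 : Statistic n
  2-13 π = count₂ n λ i j →
    (j <? i) ×-dec (i <? n) ×-dec (π at i <? π at j) ×-dec (π at j <? π at (i + 1))

  13-2 : Statistic n
  13-2 π = count₂ n λ i j →
    (i + 1 <? j) ×-dec (π at i <? π at j) ×-dec (π at j <? π at (i + 1))

  adi : Statistic n
  adi π = count₂ n λ i j →
    (i <? j) ×-dec (π at j <? π at i) ×-dec
    ((π at j <? π at (j + 1)) ⊎-dec
     anyUpTo? (λ l → (i <? l) ×-dec (π at l <? π at j)) j)

  adi* : Statistic n
  adi* π = count₂ n λ i j →
    (i <? j) ×-dec (π at j <? π at i) ×-dec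
    ((π at (i ∸ 1) <? π at i) ⊎-dec
     anyUpTo? (λ l → (i <? l) ×-dec (π at i <? π at l)) j)

module Sums {c ℓ} (R : CommutativeRing c ℓ) where
  open CommutativeRing R using (Carrier; 0#; _*_; semiring) renaming (_+_ to _⊕_)
  open import Algebra.Definitions.RawSemiring (Semiring.rawSemiring semiring) using (_^_) public

  ∑ : ∀ {a} {A : Set a} → List A → (A → Carrier) → Carrier
  ∑ xs f = foldr _⊕_ 0# (map f xs)

  W : ℕ → Carrier → Carrier → Carrier
  W n t q = ∑ (𝔖 n p321) λ π → t ^ wex π * q ^ inv π

{-# OPTIONS --safe #-}

-- Both sides are evaluated through one formal power series.  A permutation avoiding 231 or 213
-- is its first letter k, followed by its letters smaller and its letters larger than k in blocks;
-- this turns it into a binary tree along which des, 31-2 and 13-2 are computed recursively.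
-- With N the generating function of the nonempty trees and N′(z) = N(qz), either statistic yields
--   N = z (t + t N + q N + q N′ N),
-- which determines N, and comparing the solutions at t and at tq gives
--   N_t = z (t + N_{tq}) (1 + N_t).
-- For a 321-avoiding permutation, inv is the sum of the entries of the Lehmer code, and wex counts
-- the left-to-right maxima.  Reading it from left to right is a walk on the number h of skipped
-- letters in which a new maximum has weight t q^h; the walks starting at height h are counted
-- by the product of 1 + N_{tq^i} over i ≤ h, by the second equation.
-- Finally adi* agrees with 13-2 on 231-avoiding permutations, and reversal-complementation carries
-- 231, 213, 31-2, 13-2, adi* to 312, 132, 2-31, 2-13, adi and preserves des.

module Submission where

open import Defs
open import Algebra.Bundles using (CommutativeSemiring; CommutativeRing)
open import Data.Fin using (Fin; zero; suc; toℕ; fromℕ<; opposite)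
import Data.Fin as Fin
import Data.Fin.Properties as Fin
open import Data.List
  using (List; []; _∷_; _++_; map; cartesianProductWith; length; applyUpTo; filter; cartesianProduct)
open import Data.List.Membership.Propositional using (_∈_)
open import Data.List.Membership.Propositional.Properties
  using (∈-++⁺ˡ; ∈-++⁺ʳ; ∈-++⁻; ∈-cartesianProductWith⁺; ∈-cartesianProductWith⁻; ∈-map⁺; ∈-map⁻;
    ∈-filter⁺; ∈-filter⁻; ∈-allFin; ∈-applyUpTo⁺; ∈-applyUpTo⁻; ∈-cartesianProduct⁺; ∈-cartesianProduct⁻)
open import Data.List.Membership.Propositional.Properties.WithK using (unique∧set⇒bag)
import Data.List.Properties as List
open import Data.List.Relation.Binary.BagAndSetEquality using (∼bag⇒↭)
open import Data.List.Relation.Binary.Permutation.Propositional using (_↭_)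
import Data.List.Relation.Binary.Permutation.Propositional as ↭
open import Data.List.Relation.Binary.Permutation.Propositional.Properties using (↭-length)
open import Data.List.Relation.Unary.All using (All; []; _∷_)
import Data.List.Relation.Unary.All as All
import Data.List.Relation.Unary.All.Properties as All
open import Data.List.Relation.Unary.AllPairs using ([]; _∷_; AllPairs)
import Data.List.Relation.Unary.AllPairs as AllPairs
import Data.List.Relation.Unary.AllPairs.Properties as AllPairs
open import Data.List.Relation.Unary.Any using (here; there)
open import Data.List.Relation.Unary.Unique.Propositional using (Unique)
import Data.List.Relation.Unary.Unique.Propositional.Properties as Unique
open import Data.Nat using (ℕ; zero; suc; _≤_; z≤n; s≤s; _+_; _∸_; _<_; _≤?_; _<?_; _>_; _>?_; _≥_)
open import Data.Nat.Properties
  using (≤-refl; ≤-trans; m≤n⇒m≤1+n; suc-injective; <-trans; <-irrefl; <-asym; anyUpTo?)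
import Data.Nat.Properties as ℕ
open import Data.Product using (_×_; _,_; ∃; proj₁; proj₂; uncurry; map₁)
open import Data.Sum using (inj₁; inj₂; _⊎_; [_,_]′)
open import Data.Unit using (⊤; tt)
open import Data.Vec using (Vec; []; _∷_; lookup; toList; tabulate)
import Data.Vec as Vec
import Data.Vec.Properties as Vec
import Data.Vec.Relation.Unary.All as VecAll
import Data.Vec.Relation.Unary.AllPairs as VecAllPairs
import Data.Vec.Relation.Unary.Unique.Propositional as Vec
import Data.Vec.Relation.Unary.Unique.Propositional.Properties as VecUnique
open import Function using (_∘_; _⇔_; Equivalence; mk⇔; id; flip)
open import Relation.Binary.Definitions
  using (tri<; tri≈; tri>; Asymmetric; Transitive) renaming (Decidable to Decidable₂)
open import Relation.Binary.PropositionalEquality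
  using (_≡_; refl; sym; trans; cong; cong₂; subst; _≢_; module ≡-Reasoning; subst₂)
open import Relation.Nullary using (¬_; contradiction; Dec; yes; no)
open import Relation.Nullary.Decidable using (_×-dec_; _⊎-dec_)
open import Relation.Unary using (Decidable)

-- Power series

-- The statistics are not additive over the two blocks behind the first letter: a block also
-- interacts with the letter just before it. Only whether that letter lies below or above the whole
-- block matters, hence the two tree statistics `low` and `top` and, for 31-2, the system N = z (t +
-- q M) (1 + N), M = z (t + q M) (1 + N′). For 13-2 the order on letters is reversed, which
-- exchanges the subtrees in these statistics but not in `descents`; the system becomes N = z (t + q
-- N) H, H = 1 + z (t + q N′) H. No bijection relates the two: eliminating M or H leaves the same
-- equation. The eliminations are carried out in commutative semirings, by crosswise multiplication
-- and substitution instead of division. M also provides the comparison of parameters: q M satisfies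
-- the equation of N with t q for t, so q M_t = N_{tq}, and the first line of the system turns into
-- the equation linking N_t and N_{tq}. The factors t and q come from clearing denominators in t^n
-- (q/t)^des: a node weighs q if its left subtree is nonempty and t otherwise.

module PowerSeries {c ℓ} (S : CommutativeSemiring c ℓ) where
  open CommutativeSemiring S hiding (refl; sym; trans; zero) renaming (_+_ to _⊕_)
  private module C = CommutativeSemiring S
  open import Algebra.Definitions.RawSemiring (CommutativeSemiring.rawSemiring S) using (_^_)
  open import Algebra.Solver.Ring.NaturalCoefficients.Default S
    using (solve; _:+_; _:*_; _:=_; con)
  open import Relation.Binary.Reasoning.Setoid setoid

  Series : Set c
  Series = ℕ → Carrier

  infix 4 _≋_
  _≋_ : Series → Series → Set ℓ
  f ≋ g = ∀ n → f n ≈ g n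

  tail : Series → Series
  tail f n = f (suc n)

  infixl 6 _+ˢ_
  _+ˢ_ : Series → Series → Series
  (f +ˢ g) n = f n ⊕ g n

  infixl 7 _*ˢ_
  _*ˢ_ : Series → Series → Series
  (f *ˢ g) zero    = f 0 * g 0
  (f *ˢ g) (suc n) = f 0 * g (suc n) ⊕ (tail f *ˢ g) n

  const : Carrier → Series
  const a zero    = a
  const a (suc n) = 0#

  z·_ : Series → Series
  (z· f) zero    = 0#
  (z· f) (suc n) = f n

  -- A coefficient of a product involves only coefficients of the factors up to the same index. This
  -- is what lets a functional equation with an outer factor z determine its solution coefficient by
  -- coefficient.
  *ˢ-cong-≤ : ∀ {f f′ g g′} n → (∀ i → i ≤ n → f i ≈ f′ i) → (∀ i → i ≤ n → g i ≈ g′ i) →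
              (f *ˢ g) n ≈ (f′ *ˢ g′) n
  *ˢ-cong-≤ zero    p r = *-cong (p 0 z≤n) (r 0 z≤n)
  *ˢ-cong-≤ (suc n) p r = +-cong (*-cong (p 0 z≤n) (r (suc n) ≤-refl))
    (*ˢ-cong-≤ n (λ i i≤n → p (suc i) (s≤s i≤n)) (λ i i≤n → r i (m≤n⇒m≤1+n i≤n)))

  *ˢ-cong : ∀ {f f′ g g′} → f ≋ f′ → g ≋ g′ → f *ˢ g ≋ f′ *ˢ g′
  *ˢ-cong p r n = *ˢ-cong-≤ n (λ i _ → p i) (λ i _ → r i)

  private
    0ˢ*-vanish : ∀ {f} → (∀ n → f n ≈ 0#) → ∀ g n → (f *ˢ g) n ≈ 0#
    0ˢ*-vanish p g zero    = C.trans (*-congʳ (p 0)) (zeroˡ _)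
    0ˢ*-vanish p g (suc n) =
      C.trans (+-cong (C.trans (*-congʳ (p 0)) (zeroˡ _)) (0ˢ*-vanish (λ i → p (suc i)) g n)) (+-identityˡ 0#)

  const-*ˢ : ∀ a g n → (const a *ˢ g) n ≈ a * g n
  const-*ˢ a g zero    = C.refl
  const-*ˢ a g (suc n) = C.trans (+-congˡ (0ˢ*-vanish (λ _ → C.refl) g n)) (+-identityʳ _)

  private
    zeroˢ : ∀ g → const 0# *ˢ g ≋ const 0#
    zeroˢ g zero    = zeroˡ _
    zeroˢ g (suc n) = C.trans (const-*ˢ 0# g (suc n)) (zeroˡ _)

    -- The recursion defining `*ˢ` splits off the first coefficient of the left factor;
    -- commutativity needs the same for the right factor.
    snoc : ∀ f g n → (f *ˢ g) (suc n) ≈ (f *ˢ tail g) n ⊕ f (suc n) * g 0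
    snoc f g zero    = C.refl
    snoc f g (suc n) = C.trans (+-congˡ (snoc (tail f) g n)) (C.sym (+-assoc _ _ _))

  *ˢ-comm : ∀ f g → f *ˢ g ≋ g *ˢ f
  *ˢ-comm f g zero    = *-comm _ _
  *ˢ-comm f g (suc n) = begin
    f 0 * g (suc n) ⊕ (tail f *ˢ g) n  ≈⟨ +-cong (*-comm _ _) (*ˢ-comm (tail f) g n) ⟩
    g (suc n) * f 0 ⊕ (g *ˢ tail f) n  ≈⟨ +-comm _ _ ⟩
    (g *ˢ tail f) n ⊕ g (suc n) * f 0  ≈⟨ snoc g f n ⟨
    (g *ˢ f) (suc n)                   ∎

  *ˢ-distribʳ : ∀ h f g → (f +ˢ g) *ˢ h ≋ f *ˢ h +ˢ g *ˢ h
  *ˢ-distribʳ h f g zero    = distribʳ _ _ _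
  *ˢ-distribʳ h f g (suc n) = C.trans (+-congˡ (*ˢ-distribʳ h (tail f) (tail g) n))
    (solve 5 (λ a b c x y → (a :+ b) :* c :+ (x :+ y) := (a :* c :+ x) :+ (b :* c :+ y)) C.refl _ _ _ _ _)

  private
    scalar-*ˢ : ∀ a f g n → ((λ i → a * f i) *ˢ g) n ≈ a * (f *ˢ g) n
    scalar-*ˢ a f g zero    = *-assoc _ _ _
    scalar-*ˢ a f g (suc n) = C.trans (+-cong (*-assoc _ _ _) (scalar-*ˢ a (tail f) g n)) (C.sym (distribˡ _ _ _))

  *ˢ-assoc : ∀ f g h → (f *ˢ g) *ˢ h ≋ f *ˢ (g *ˢ h)
  *ˢ-assoc f g h zero    = *-assoc _ _ _
  *ˢ-assoc f g h (suc n) = begin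
    f 0 * g 0 * h (suc n) ⊕ (((λ i → f 0 * g (suc i)) +ˢ (tail f *ˢ g)) *ˢ h) n
      ≈⟨ +-congˡ (*ˢ-distribʳ h _ _ n) ⟩
    f 0 * g 0 * h (suc n) ⊕ (((λ i → f 0 * g (suc i)) *ˢ h) n ⊕ ((tail f *ˢ g) *ˢ h) n)
      ≈⟨ +-congˡ (+-cong (scalar-*ˢ (f 0) (tail g) h n) (*ˢ-assoc (tail f) g h n)) ⟩
    f 0 * g 0 * h (suc n) ⊕ (f 0 * (tail g *ˢ h) n ⊕ (tail f *ˢ (g *ˢ h)) n)
      ≈⟨ solve 5 (λ a b c x y → a :* b :* c :+ (a :* x :+ y) := a :* (b :* c :+ x) :+ y) C.refl _ _ _ _ _ ⟩
    f 0 * (g *ˢ h) (suc n) ⊕ (tail f *ˢ (g *ˢ h)) n ∎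

  *ˢ-identityˡ : ∀ f → const 1# *ˢ f ≋ f
  *ˢ-identityˡ f n = C.trans (const-*ˢ 1# f n) (*-identityˡ _)

  seriesSemiring : CommutativeSemiring c ℓ
  seriesSemiring = record
    { Carrier = Series ; _≈_ = _≋_ ; _+_ = _+ˢ_ ; _*_ = _*ˢ_ ; 0# = const 0# ; 1# = const 1#
    ; isCommutativeSemiring = record
      { isSemiring = record
        { isSemiringWithoutAnnihilatingZero = record
          { +-isCommutativeMonoid = record
            { isMonoid = record
              { isSemigroup = record
                { isMagma = record
                  { isEquivalence = record
                    { refl = λ _ → C.refl ; sym = λ p n → C.sym (p n) ; trans = λ p r n → C.trans (p n) (r n) }
                  ; ∙-cong = λ p r n → +-cong (p n) (r n) }
                ; assoc = λ f g h n → +-assoc _ _ _ }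
              ; identity = (λ f → λ { zero → +-identityˡ _ ; (suc n) → +-identityˡ _ })
                         , (λ f → λ { zero → +-identityʳ _ ; (suc n) → +-identityʳ _ }) }
            ; comm = λ f g n → +-comm _ _ }
          ; *-cong = *ˢ-cong
          ; *-assoc = *ˢ-assoc
          ; *-identity = *ˢ-identityˡ , λ f n → C.trans (*ˢ-comm f _ n) (*ˢ-identityˡ f n)
          ; distrib = (λ h f g n → C.trans (*ˢ-comm h _ n) (C.trans (*ˢ-distribʳ h f g n)
                                      (+-cong (*ˢ-comm f h n) (*ˢ-comm g h n))))
                    , *ˢ-distribʳ }
        ; zero = zeroˢ , λ f n → C.trans (*ˢ-comm f _ n) (zeroˢ f n) }
      ; *-comm = *ˢ-comm } }

  z·-cong : ∀ {f g} → f ≋ g → z· f ≋ z· g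
  z·-cong p zero    = C.refl
  z·-cong p (suc n) = p n

  z·-*ˢ : ∀ f g → z· (f *ˢ g) ≋ (z· f) *ˢ g
  z·-*ˢ f g zero    = C.sym (zeroˡ _)
  z·-*ˢ f g (suc n) = C.sym (C.trans (+-congʳ (zeroˡ _)) (+-identityˡ _))

  module Dilation (q : Carrier) where

    -- The substitution of q z for z. On generating functions it adds the size to the statistic
    -- counted by q.
    dilate : Series → Series
    dilate f n = q ^ n * f n

    dilate-cong : ∀ {f g} → f ≋ g → dilate f ≋ dilate g
    dilate-cong p n = *-congˡ (p n)

    dilate-+ : ∀ f g → dilate (f +ˢ g) ≋ dilate f +ˢ dilate g
    dilate-+ f g n = distribˡ _ _ _

    dilate-const : ∀ a → dilate (const a) ≋ const a
    dilate-const a zero    = *-identityˡ _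
    dilate-const a (suc n) = zeroʳ _

    dilate-* : ∀ f g → dilate (f *ˢ g) ≋ dilate f *ˢ dilate g
    dilate-* f g zero    =
      solve 2 (λ a b → con 1 :* (a :* b) := (con 1 :* a) :* (con 1 :* b)) C.refl _ _
    dilate-* f g (suc n) = begin
      q ^ suc n * (f 0 * g (suc n) ⊕ (tail f *ˢ g) n)
        ≈⟨ solve 5 (λ w v a b d → (w :* v) :* (a :* b :+ d)
                 := (con 1 :* a) :* ((w :* v) :* b) :+ w :* (v :* d)) C.refl _ _ _ _ _ ⟩
      1# * f 0 * (q ^ suc n * g (suc n)) ⊕ q * (q ^ n * (tail f *ˢ g) n)
        ≈⟨ +-congˡ (*-congˡ (dilate-* (tail f) g n)) ⟩
      1# * f 0 * (q ^ suc n * g (suc n)) ⊕ q * (dilate (tail f) *ˢ dilate g) n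
        ≈⟨ +-congˡ (scalar-*ˢ q (dilate (tail f)) (dilate g) n) ⟨
      1# * f 0 * (q ^ suc n * g (suc n)) ⊕ ((λ i → q * dilate (tail f) i) *ˢ dilate g) n
        ≈⟨ +-congˡ (*ˢ-cong (λ i → C.sym (*-assoc _ _ _)) (λ _ → C.refl) n) ⟩
      (dilate f *ˢ dilate g) (suc n) ∎

    dilate-z· : ∀ f → dilate (z· f) ≋ z· (const q *ˢ dilate f)
    dilate-z· f zero    = zeroʳ _
    dilate-z· f (suc n) = C.trans (*-assoc _ _ _) (C.sym (const-*ˢ q (dilate f) n))

  const-cong : ∀ {a b} → a ≈ b → const a ≋ const b
  const-cong p zero    = p
  const-cong p (suc n) = C.refl

  const-* : ∀ a b → const (a * b) ≋ const a *ˢ const b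
  const-* a b zero    = C.refl
  const-* a b (suc n) = C.sym (C.trans (const-*ˢ a (const b) (suc n)) (zeroʳ a))

-- Elimination of the auxiliary series

module FunctionalEquations {c ℓ} (S : CommutativeSemiring c ℓ) where
  open CommutativeSemiring S hiding (refl; sym; trans; zero) renaming (_+_ to _⊕_)
  private module C = CommutativeSemiring S
  open import Algebra.Solver.Ring.NaturalCoefficients.Default S
    using (solve; _:+_; _:*_; _:=_; con)
  open import Relation.Binary.Reasoning.Setoid setoid

  -- The two equations share the factor z (t + q M). Multiplying each by the remaining factor of the
  -- other gives M (1 + N) = N (1 + N′), which removes M without a division.
  eliminate-I : ∀ z t q N N′ M →
    N ≈ z * ((t ⊕ q * M) * (1# ⊕ N)) → M ≈ z * ((t ⊕ q * M) * (1# ⊕ N′)) →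
    N ≈ z * (t ⊕ t * N ⊕ q * N ⊕ q * (N′ * N))
  eliminate-I z t q N N′ M eN eM = begin
    N ≈⟨ eN ⟩
    z * ((t ⊕ q * M) * (1# ⊕ N))
      ≈⟨ solve 5 (λ z t q M N → z :* ((t :+ q :* M) :* (con 1 :+ N))
               := z :* (t :+ t :* N :+ q :* (M :* (con 1 :+ N)))) C.refl z t q M N ⟩
    z * (t ⊕ t * N ⊕ q * (M * (1# ⊕ N)))
      ≈⟨ *-congˡ (+-congˡ (*-congˡ cross)) ⟩
    z * (t ⊕ t * N ⊕ q * (N * (1# ⊕ N′)))
      ≈⟨ solve 5 (λ z t q N N′ → z :* (t :+ t :* N :+ q :* (N :* (con 1 :+ N′)))
               := z :* (t :+ t :* N :+ q :* N :+ q :* (N′ :* N))) C.refl z t q N N′ ⟩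
    z * (t ⊕ t * N ⊕ q * N ⊕ q * (N′ * N)) ∎
    where
    cross : M * (1# ⊕ N) ≈ N * (1# ⊕ N′)
    cross = begin
      M * (1# ⊕ N)                                ≈⟨ *-congʳ eM ⟩
      z * ((t ⊕ q * M) * (1# ⊕ N′)) * (1# ⊕ N)
        ≈⟨ solve 4 (λ z c a b → z :* (c :* a) :* b := z :* (c :* b) :* a) C.refl z _ _ _ ⟩
      z * ((t ⊕ q * M) * (1# ⊕ N)) * (1# ⊕ N′)    ≈⟨ *-congʳ eN ⟨
      N * (1# ⊕ N′)                               ∎

  -- After one substitution of H into the equation of N, the remaining H occurs only in the product
  -- z (t + q N) H, which is N again.
  eliminate-II : ∀ z t q N N′ H →
    N ≈ z * ((t ⊕ q * N) * H) → H ≈ 1# ⊕ z * ((t ⊕ q * N′) * H) →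
    N ≈ z * (t ⊕ t * N ⊕ q * N ⊕ q * (N′ * N))
  eliminate-II z t q N N′ H eN eH = begin
    N                                                    ≈⟨ eN ⟩
    z * ((t ⊕ q * N) * H)                                ≈⟨ *-congˡ (*-congˡ eH) ⟩
    z * ((t ⊕ q * N) * (1# ⊕ z * ((t ⊕ q * N′) * H)))
      ≈⟨ solve 4 (λ z c d H → z :* (c :* (con 1 :+ z :* (d :* H)))
               := z :* (c :+ d :* (z :* (c :* H)))) C.refl z _ _ H ⟩
    z * ((t ⊕ q * N) ⊕ (t ⊕ q * N′) * (z * ((t ⊕ q * N) * H)))
      ≈⟨ *-congˡ (+-congˡ (*-congˡ eN)) ⟨
    z * ((t ⊕ q * N) ⊕ (t ⊕ q * N′) * N)
      ≈⟨ solve 5 (λ z t q N N′ → z :* ((t :+ q :* N) :+ (t :+ q :* N′) :* N)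
               := z :* (t :+ t :* N :+ q :* N :+ q :* (N′ :* N))) C.refl z t q N N′ ⟩
    z * (t ⊕ t * N ⊕ q * N ⊕ q * (N′ * N)) ∎

  -- The second hypothesis is the equation of N read at q z. Multiplying crosswise gives N′ (t + q
  -- M) = q (t + q M′) M, and the outcome is the conclusion of `eliminate-I` for the series q M with
  -- parameter t q.
  rescale : ∀ z t q M N′ M′ →
    M ≈ z * ((t ⊕ q * M) * (1# ⊕ N′)) → N′ ≈ q * z * ((t ⊕ q * M′) * (1# ⊕ N′)) →
    q * M ≈ z * (t * q ⊕ t * q * (q * M) ⊕ q * (q * M) ⊕ q * (q * M′ * (q * M)))
  rescale z t q M N′ M′ eM eN′ = begin
    q * M                                             ≈⟨ *-congˡ eM ⟩
    q * (z * ((t ⊕ q * M) * (1# ⊕ N′)))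
      ≈⟨ solve 4 (λ z q c N′ → q :* (z :* (c :* (con 1 :+ N′)))
               := q :* (z :* (c :+ N′ :* c))) C.refl z q _ N′ ⟩
    q * (z * ((t ⊕ q * M) ⊕ N′ * (t ⊕ q * M)))        ≈⟨ *-congˡ (*-congˡ (+-congˡ cross)) ⟩
    q * (z * ((t ⊕ q * M) ⊕ q * ((t ⊕ q * M′) * M)))
      ≈⟨ solve 5 (λ z t q M M′ →
           q :* (z :* ((t :+ q :* M) :+ q :* ((t :+ q :* M′) :* M)))
             := z :* (t :* q :+ t :* q :* (q :* M) :+ q :* (q :* M) :+ q :* (q :* M′ :* (q :* M))))
           C.refl z t q M M′ ⟩
    z * (t * q ⊕ t * q * (q * M) ⊕ q * (q * M) ⊕ q * (q * M′ * (q * M))) ∎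
    where
    cross : N′ * (t ⊕ q * M) ≈ q * ((t ⊕ q * M′) * M)
    cross = begin
      N′ * (t ⊕ q * M)                                          ≈⟨ *-congʳ eN′ ⟩
      q * z * ((t ⊕ q * M′) * (1# ⊕ N′)) * (t ⊕ q * M)
        ≈⟨ solve 5 (λ z q c d a → q :* z :* (d :* a) :* c := q :* (d :* (z :* (c :* a)))) C.refl z q _ _ _ ⟩
      q * ((t ⊕ q * M′) * (z * ((t ⊕ q * M) * (1# ⊕ N′))))      ≈⟨ *-congˡ (*-congˡ eM) ⟨
      q * ((t ⊕ q * M′) * M)                                    ∎

-- Uniqueness of the solution

module Uniqueness {c ℓ} (S : CommutativeSemiring c ℓ) (q : CommutativeSemiring.Carrier S) where
  open PowerSeries S
  open Dilation q
  private
    module C = CommutativeSemiring S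
    module P = CommutativeSemiring seriesSemiring
    module E = FunctionalEquations seriesSemiring
  open C using (Carrier; _≈_; _*_; 0#; 1#)

  Φ : Carrier → Series → Series
  Φ t f = const t +ˢ const t *ˢ f +ˢ const q *ˢ f +ˢ const q *ˢ (dilate f *ˢ f)

  Solution : Carrier → Series → Set ℓ
  Solution t f = f ≋ z· Φ t f

  -- The outer factor z expresses coefficient i + 1 through coefficients up to i. The bound in
  -- `below` makes all of these available at once.
  solution-unique : ∀ {t f g} → Solution t f → Solution t g → f ≋ g
  solution-unique {t} {f} {g} sf sg n = below n n ≤-refl
    where
    below : ∀ n i → i ≤ n → f i ≈ g i
    below n       zero    i≤n       = C.trans (sf 0) (C.sym (sg 0))
    below (suc n) (suc i) (s≤s i≤n) = C.trans (sf (suc i)) (C.trans step (C.sym (sg (suc i))))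
      where
      agree : ∀ j → j ≤ i → f j ≈ g j
      agree j j≤i = below n j (≤-trans j≤i i≤n)
      step : Φ t f i ≈ Φ t g i
      step = C.+-cong (C.+-cong (C.+-congˡ
        (*ˢ-cong-≤ i (λ _ _ → C.refl) agree)) (*ˢ-cong-≤ i (λ _ _ → C.refl) agree))
        (*ˢ-cong-≤ i (λ _ _ → C.refl) (λ j j≤i →
          *ˢ-cong-≤ j (λ k k≤j → C.*-congˡ (agree k (≤-trans k≤j j≤i))) (λ k k≤j → agree k (≤-trans k≤j j≤i))))

  -- The shift `z·_` as multiplication by an element, so that identities of an abstract semiring
  -- apply to series.
  Z : Series
  Z = z· const 1#

  z·≋Z* : ∀ f → z· f ≋ Z *ˢ f
  z·≋Z* f = P.trans (z·-cong (P.sym (P.*-identityˡ f))) (z·-*ˢ (const 1#) f)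

  private
    dilate-1+ : ∀ f → dilate (const 1# +ˢ f) ≋ const 1# +ˢ dilate f
    dilate-1+ f = P.trans (dilate-+ (const 1#) f) (P.+-congʳ (dilate-const 1#))

    dilate-affine : ∀ t f → dilate (const t +ˢ const q *ˢ f) ≋ const t +ˢ const q *ˢ dilate f
    dilate-affine t f = P.trans (dilate-+ _ _) (P.+-cong (dilate-const t)
      (P.trans (dilate-* _ _) (P.*-congʳ (dilate-const q))))

  solution-I : ∀ {t N M} →
    N ≋ z· ((const t +ˢ const q *ˢ M) *ˢ (const 1# +ˢ N)) →
    M ≋ z· ((const t +ˢ const q *ˢ M) *ˢ dilate (const 1# +ˢ N)) →
    Solution t N
  solution-I {t} {N} {M} eN eM =
    P.trans (E.eliminate-I Z (const t) (const q) N (dilate N) M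
              (P.trans eN (z·≋Z* _)) (P.trans eM (P.trans (z·≋Z* _) (P.*-congˡ (P.*-congˡ (dilate-1+ N))))))
            (P.sym (z·≋Z* _))

  solution-II : ∀ {t N H} →
    N ≋ z· ((const t +ˢ const q *ˢ N) *ˢ H) →
    H ≋ const 1# +ˢ z· (dilate (const t +ˢ const q *ˢ N) *ˢ H) →
    Solution t N
  solution-II {t} {N} {H} eN eH =
    P.trans (E.eliminate-II Z (const t) (const q) N (dilate N) H
              (P.trans eN (z·≋Z* _))
              (P.trans eH (P.+-congˡ (P.trans (z·≋Z* _) (P.*-congˡ (P.*-congʳ (dilate-affine t N)))))))
            (P.sym (z·≋Z* _))

  solution-rescaled : ∀ {t N M} →
    N ≋ z· ((const t +ˢ const q *ˢ M) *ˢ (const 1# +ˢ N)) →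
    M ≋ z· ((const t +ˢ const q *ˢ M) *ˢ dilate (const 1# +ˢ N)) →
    Solution (t * q) (const q *ˢ M)
  solution-rescaled {t} {N} {M} eN eM =
    P.trans (E.rescale Z (const t) (const q) M (dilate N) (dilate M)
              (P.trans eM (P.trans (z·≋Z* _) (P.*-congˡ (P.*-congˡ (dilate-1+ N)))))
              -- Dilating the equation of N gives that of N′; the factor z itself is dilated to q z.
              (P.trans (dilate-cong eN) (P.trans (dilate-z· _) (P.trans (z·≋Z* _)
                (P.trans (P.sym (P.*-assoc Z (const q) _)) (P.*-cong (P.*-comm Z (const q))
                  (P.trans (dilate-* _ _) (P.*-cong (dilate-affine t M) (dilate-1+ N)))))))))
     (P.trans (P.sym (z·≋Z* _)) (z·-cong
       (P.sym (P.+-cong (P.+-congʳ (P.+-cong (const-* t q) (P.*-congʳ (const-* t q))))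
         (P.*-congˡ (P.*-congʳ (P.trans (dilate-* _ _) (P.*-congʳ (dilate-const q)))))))))

-- Binary trees

-- The recursion copies that of `*ˢ`, so that a weight multiplicative along `k` turns `join` into a
-- product of series; see `∑-join`.
join : ∀ {a} {A B C : Set a} → (A → B → C) → (ℕ → List A) → (ℕ → List B) → ℕ → List C
join k f g zero    = cartesianProductWith k (f 0) (g 0)
join k f g (suc n) = cartesianProductWith k (f 0) (g (suc n)) ++ join k (f ∘ suc) g n

module _ {a} {A B C : Set a} (k : A → B → C) where

  join-cong-≤ : ∀ {f f′ g g′} n → (∀ i → i ≤ n → f i ≡ f′ i) → (∀ i → i ≤ n → g i ≡ g′ i) →
                join k f g n ≡ join k f′ g′ n
  join-cong-≤ zero    p r = cong₂ (cartesianProductWith k) (p 0 z≤n) (r 0 z≤n)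
  join-cong-≤ (suc n) p r = cong₂ _++_
    (cong₂ (cartesianProductWith k) (p 0 z≤n) (r (suc n) ≤-refl))
    (join-cong-≤ n (λ i i≤n → p (suc i) (s≤s i≤n)) (λ i i≤n → r i (m≤n⇒m≤1+n i≤n)))

  ∈-join⁺ : ∀ {f g x y} i j → x ∈ f i → y ∈ g j → k x y ∈ join k f g (i + j)
  ∈-join⁺ zero    zero    x∈ y∈ = ∈-cartesianProductWith⁺ k x∈ y∈
  ∈-join⁺ zero    (suc j) x∈ y∈ = ∈-++⁺ˡ (∈-cartesianProductWith⁺ k x∈ y∈)
  ∈-join⁺ (suc i) j       x∈ y∈ = ∈-++⁺ʳ _ (∈-join⁺ i j x∈ y∈)

  ∈-join⁻ : ∀ f g n {z} → z ∈ join k f g n →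
            ∃ λ i → ∃ λ j → ∃ λ x → ∃ λ y → i + j ≡ n × x ∈ f i × y ∈ g j × z ≡ k x y
  ∈-join⁻ f g zero z∈ with ∈-cartesianProductWith⁻ k (f 0) (g 0) z∈
  ... | x , y , x∈ , y∈ , eq = 0 , 0 , x , y , refl , x∈ , y∈ , eq
  ∈-join⁻ f g (suc n) z∈ with ∈-++⁻ (cartesianProductWith k (f 0) (g (suc n))) z∈
  ... | inj₁ z∈ˡ with x , y , x∈ , y∈ , eq ← ∈-cartesianProductWith⁻ k (f 0) (g (suc n)) z∈ˡ =
    0 , suc n , x , y , refl , x∈ , y∈ , eq
  ... | inj₂ z∈ʳ with i , j , x , y , i+j≡n , x∈ , y∈ , eq ← ∈-join⁻ (f ∘ suc) g n z∈ʳ =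
    suc i , j , x , y , cong suc i+j≡n , x∈ , y∈ , eq

  -- Different splittings of n give different objects because the left component determines its own
  -- index.
  join-unique : (∀ {w x y z} → k w y ≡ k x z → w ≡ x × y ≡ z) → ∀ {f g} →
                (∀ i → Unique (f i)) → (∀ j → Unique (g j)) →
                (∀ {i j x} → x ∈ f i → x ∈ f j → i ≡ j) → ∀ n → Unique (join k f g n)
  join-unique k-inj f! g! disj zero    = Unique.cartesianProductWith⁺ k k-inj (f! 0) (g! 0)
  join-unique k-inj {f} {g} f! g! disj (suc n) = Unique.++⁺
    (Unique.cartesianProductWith⁺ k k-inj (f! 0) (g! (suc n)))
    (join-unique k-inj (f! ∘ suc) g! (λ x∈ y∈ → suc-injective (disj x∈ y∈)) n)
    λ (z∈₁ , z∈₂) → clash z∈₁ z∈₂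
    where
    clash : ∀ {z} → z ∈ cartesianProductWith k (f 0) (g (suc n)) → ¬ z ∈ join k (f ∘ suc) g n
    clash z∈₁ z∈₂ with ∈-cartesianProductWith⁻ k (f 0) (g (suc n)) z∈₁ | ∈-join⁻ (f ∘ suc) g n z∈₂
    ... | x , y , x∈ , y∈ , eq | i , j , x′ , y′ , _ , x′∈ , y′∈ , eq′
      with refl ← proj₁ (k-inj (trans (sym eq) eq′)) with () ← disj x∈ x′∈

data Tree : Set where
  leaf : Tree
  node : Tree → Tree → Tree

size : Tree → ℕ
size leaf       = 0
size (node a b) = suc (size a + size b)

-- The first argument bounds the recursion depth; `trees f n` enumerates all trees of size n
-- as soon as n ≤ f.
treesUpTo : ℕ → ℕ → List Tree
treesUpTo f       zero    = leaf ∷ []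
treesUpTo zero    (suc n) = []
treesUpTo (suc f) (suc n) = join node (treesUpTo f) (treesUpTo f) n

trees : ℕ → List Tree
trees n = treesUpTo n n

treesUpTo-stable : ∀ f g n → n ≤ f → n ≤ g → treesUpTo f n ≡ treesUpTo g n
treesUpTo-stable f       g       zero    _         _         = refl
treesUpTo-stable (suc f) (suc g) (suc n) (s≤s n≤f) (s≤s n≤g) = join-cong-≤ node n stable stable
  where
  stable : ∀ i → i ≤ n → treesUpTo f i ≡ treesUpTo g i
  stable i i≤n = treesUpTo-stable f g i (≤-trans i≤n n≤f) (≤-trans i≤n n≤g)

trees-suc : ∀ n → trees (suc n) ≡ join node trees trees n
trees-suc n = join-cong-≤ node n (λ i i≤n → treesUpTo-stable n i i i≤n ≤-refl)
                                 (λ i i≤n → treesUpTo-stable n i i i≤n ≤-refl)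

∈-treesUpTo⁻ : ∀ f n {x} → x ∈ treesUpTo f n → size x ≡ n
∈-treesUpTo⁻ f       zero    (here refl) = refl
∈-treesUpTo⁻ (suc f) (suc n) x∈ with ∈-join⁻ node (treesUpTo f) (treesUpTo f) n x∈
... | i , j , a , b , refl , a∈ , b∈ , refl =
  cong suc (cong₂ _+_ (∈-treesUpTo⁻ f i a∈) (∈-treesUpTo⁻ f j b∈))

∈-trees⁺ : ∀ x → x ∈ trees (size x)
∈-trees⁺ leaf       = here refl
∈-trees⁺ (node a b) = subst (node a b ∈_) (sym (trees-suc (size a + size b)))
  (∈-join⁺ node (size a) (size b) (∈-trees⁺ a) (∈-trees⁺ b))

treesUpTo-unique : ∀ f n → Unique (treesUpTo f n)
treesUpTo-unique f       zero    = [] ∷ []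
treesUpTo-unique zero    (suc n) = []
treesUpTo-unique (suc f) (suc n) = join-unique node (λ { refl → refl , refl })
  (treesUpTo-unique f) (treesUpTo-unique f)
  (λ {i} {j} x∈ x∈′ → trans (sym (∈-treesUpTo⁻ f i x∈)) (∈-treesUpTo⁻ f j x∈′)) n

-- Sums over lists

module SumProperties {c ℓ} (R : CommutativeRing c ℓ) where
  open CommutativeRing R hiding (refl; sym; trans; zero) renaming (_+_ to _⊕_)
  private module C = CommutativeRing R
  open Sums R
  open PowerSeries commutativeSemiring using (_*ˢ_)

  ∑-cong : ∀ {a} {A : Set a} (xs : List A) {f g : A → Carrier} →
           (∀ x → x ∈ xs → f x ≈ g x) → ∑ xs f ≈ ∑ xs g
  ∑-cong []       p = C.refl
  ∑-cong (x ∷ xs) p = +-cong (p x (here refl)) (∑-cong xs (λ y y∈ → p y (there y∈)))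

  ∑-++ : ∀ {a} {A : Set a} (xs ys : List A) f → ∑ (xs ++ ys) f ≈ ∑ xs f ⊕ ∑ ys f
  ∑-++ []       ys f = C.sym (+-identityˡ _)
  ∑-++ (x ∷ xs) ys f = C.trans (+-congˡ (∑-++ xs ys f)) (C.sym (+-assoc _ _ _))

  ∑-map : ∀ {a b} {A : Set a} {B : Set b} (g : A → B) xs f → ∑ (map g xs) f ≈ ∑ xs (f ∘ g)
  ∑-map g []       f = C.refl
  ∑-map g (x ∷ xs) f = +-congˡ (∑-map g xs f)

  ∑-*ˡ : ∀ {a} {A : Set a} x (ys : List A) f → ∑ ys (λ y → x * f y) ≈ x * ∑ ys f
  ∑-*ˡ x []       f = C.sym (zeroʳ x)
  ∑-*ˡ x (y ∷ ys) f = C.trans (+-congˡ (∑-*ˡ x ys f)) (C.sym (distribˡ _ _ _))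

  ∑-↭ : ∀ {a} {A : Set a} {xs ys : List A} f → xs ↭ ys → ∑ xs f ≈ ∑ ys f
  ∑-↭ f ↭.refl         = C.refl
  ∑-↭ f (↭.prep x p)   = +-congˡ (∑-↭ f p)
  ∑-↭ f (↭.swap x y p) = C.trans (C.sym (+-assoc _ _ _)) (C.trans
    (+-cong (+-comm _ _) (∑-↭ f p)) (+-assoc _ _ _))
  ∑-↭ f (↭.trans p r)  = C.trans (∑-↭ f p) (∑-↭ f r)

  module _ {A B D : Set} (k : A → B → D) (w : D → Carrier) (u : A → Carrier) (v : B → Carrier)
           (w-k : ∀ x y → w (k x y) ≈ u x * v y) where

    ∑-cartesianProductWith : ∀ xs ys → ∑ (cartesianProductWith k xs ys) w ≈ ∑ xs u * ∑ ys v
    ∑-cartesianProductWith []       ys = C.sym (zeroˡ _)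
    ∑-cartesianProductWith (x ∷ xs) ys =
      C.trans (∑-++ (map (k x) ys) _ w) (C.trans (+-cong
        (C.trans (∑-map (k x) ys w) (C.trans (∑-cong ys (λ y _ → w-k x y)) (∑-*ˡ (u x) ys v)))
        (∑-cartesianProductWith xs ys)) (C.sym (distribʳ _ _ _)))

    ∑-join : ∀ f g n → ∑ (join k f g n) w ≈ ((λ i → ∑ (f i) u) *ˢ (λ j → ∑ (g j) v)) n
    ∑-join f g zero    = ∑-cartesianProductWith (f 0) (g 0)
    ∑-join f g (suc n) = C.trans (∑-++ (cartesianProductWith k (f 0) (g (suc n))) _ w)
      (+-cong (∑-cartesianProductWith (f 0) (g (suc n))) (∑-join (f ∘ suc) g n))


-- Tree statistics and their generating series

mirror : Tree → Tree
mirror leaf       = leaf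
mirror (node a b) = node (mirror b) (mirror a)

size-mirror : ∀ x → size (mirror x) ≡ size x
size-mirror leaf       = refl
size-mirror (node a b) = cong suc (trans (cong₂ _+_ (size-mirror b) (size-mirror a)) (ℕ.+-comm (size b) (size a)))

nonEmpty : Tree → ℕ
nonEmpty leaf       = 0
nonEmpty (node _ _) = 1

-- The block of letters smaller than the root, if nonempty, is entered by exactly one descent,
-- coming from the root or from the last larger letter; the block of larger letters is entered by an
-- ascent.
descents : Tree → ℕ
descents leaf       = 0
descents (node a b) = nonEmpty a + (descents a + descents b)

-- The number of 31-2 in the word of a tree preceded by a letter below all its letters (`low`) or
-- above all of them (`top`). The root precedes its smaller letters from above and its larger
-- letters from below, whence `top a + low b`. A preceding letter above everything forms a descent
-- with the root, and exactly the `size b` larger letters lie between the two.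
mutual
  low : Tree → ℕ
  low leaf       = 0
  low (node a b) = top a + low b

  top : Tree → ℕ
  top leaf       = 0
  top (node a b) = size b + (top a + low b)

module TreeSeries {c ℓ} (R : CommutativeRing c ℓ) (q : CommutativeRing.Carrier R) where
  open CommutativeRing R hiding (refl; sym; trans; zero) renaming (_+_ to _⊕_)
  private module C = CommutativeRing R
  open Sums R
  open SumProperties R
  open PowerSeries commutativeSemiring
  open Dilation q
  open Uniqueness commutativeSemiring q
  open import Algebra.Properties.Semiring.Exp semiring using (^-homo-*; ^-congʳ)
  open import Algebra.Solver.Ring.NaturalCoefficients.Default commutativeSemiring
    using (solve; _:+_; _:*_; _:=_; con)

  nonEmptyTrees : (Tree → Carrier) → Series
  nonEmptyTrees w = z· λ n → ∑ (trees (suc n)) w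

  ∑-trees : ∀ w → (λ n → ∑ (trees n) w) ≋ const (w leaf) +ˢ nonEmptyTrees w
  ∑-trees w zero    = C.refl
  ∑-trees w (suc n) = C.sym (+-identityˡ _)

  nonEmptyTrees-node : ∀ w u v → (∀ a b → w (node a b) ≈ u a * v b) →
    nonEmptyTrees w ≋ z· ((λ n → ∑ (trees n) u) *ˢ (λ n → ∑ (trees n) v))
  nonEmptyTrees-node w u v w-node zero    = C.refl
  nonEmptyTrees-node w u v w-node (suc n) =
    C.trans (C.reflexive (cong (λ xs → ∑ xs w) (trees-suc n))) (∑-join node w u v w-node trees trees n)

  ∑-trees-dilate : ∀ w → (λ n → ∑ (trees n) (λ x → q ^ size x * w x)) ≋ dilate (λ n → ∑ (trees n) w)
  ∑-trees-dilate w n = C.trans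
    (∑-cong (trees n) λ x x∈ → *-congʳ (^-congʳ q (∈-treesUpTo⁻ n n x∈)))
    (∑-*ˡ (q ^ n) (trees n) w)

  module _ (t : Carrier) where

    -- Each node brings a factor t, and a descent multiplies it by q/t; so a node with nonempty left
    -- subtree weighs q, and no inverse of t occurs.
    leftWeight : Tree → Carrier
    leftWeight leaf       = t
    leftWeight (node _ _) = q

    descentWeight : Tree → Carrier
    descentWeight leaf       = 1#
    descentWeight (node a b) = leftWeight a * (descentWeight a * descentWeight b)

    weighted : (Tree → ℕ) → Tree → Carrier
    weighted s x = descentWeight x * q ^ s x

    ∑-leftWeight : ∀ s → s leaf ≡ 0 → (λ n → ∑ (trees n) (λ x → leftWeight x * weighted s x)) ≋
                   const t +ˢ const q *ˢ nonEmptyTrees (weighted s)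
    ∑-leftWeight s s0 zero    = C.trans
      (+-congʳ (*-congˡ (*-congˡ (^-congʳ q s0))))
      (solve 2 (λ t q → t :* (con 1 :* con 1) :+ con 0 := t :+ q :* con 0) C.refl t q)
    ∑-leftWeight s s0 (suc n) = C.trans
      (∑-cong (trees (suc n)) λ { leaf x∈ → contradiction (∈-treesUpTo⁻ (suc n) (suc n) x∈) λ ()
                                ; (node _ _) _ → C.refl })
      (C.trans (∑-*ˡ q (trees (suc n)) (weighted s))
      (C.trans (C.sym (const-*ˢ q (nonEmptyTrees (weighted s)) (suc n))) (C.sym (+-identityˡ _))))

    private
      ∑-weighted : ∀ s → s leaf ≡ 0 → (λ n → ∑ (trees n) (weighted s)) ≋
                   const 1# +ˢ nonEmptyTrees (weighted s)
      ∑-weighted s s0 n = C.trans (∑-trees (weighted s) n)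
        (+-congʳ (const-cong (C.trans (*-congˡ (^-congʳ q s0)) (*-identityˡ _)) n))

      pow-+ : ∀ {i} j k → i ≡ j + k → q ^ i ≈ q ^ j * q ^ k
      pow-+ j k eq = C.trans (^-congʳ q eq) (^-homo-* q j k)

      lowᵐ topᵐ : Tree → ℕ
      lowᵐ = low ∘ mirror
      topᵐ = top ∘ mirror

    -- In `Nᵐ` the vincular statistic is mirrored while `descentWeight` is not, so mirroring the
    -- trees does not identify `Nᵐ` with `N`.
    N M Nᵐ : Series
    N  = nonEmptyTrees (weighted low)
    M  = nonEmptyTrees (weighted top)
    Nᵐ = nonEmptyTrees (weighted (low ∘ mirror))

    N-eq : N ≋ z· ((const t +ˢ const q *ˢ M) *ˢ (const 1# +ˢ N))
    N-eq n = C.trans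
      (nonEmptyTrees-node (weighted low) (λ a → leftWeight a * weighted top a) (weighted low)
        (λ a b → C.trans (*-congˡ (pow-+ (top a) (low b) refl))
          (solve 5 (λ c d e x y → (c :* (d :* e)) :* (x :* y) := (c :* (d :* x)) :* (e :* y)) C.refl _ _ _ _ _)) n)
      (z·-cong (*ˢ-cong (∑-leftWeight top refl) (∑-weighted low refl)) n)

    -- The summand `size b` of `top` is what dilates the factor of the right subtree.
    M-eq : M ≋ z· ((const t +ˢ const q *ˢ M) *ˢ dilate (const 1# +ˢ N))
    M-eq n = C.trans
      (nonEmptyTrees-node (weighted top) (λ a → leftWeight a * weighted top a) (λ b → q ^ size b * weighted low b)
        (λ a b → C.trans (*-congˡ (C.trans (pow-+ (size b) (top a + low b) refl)
                                           (*-congˡ (pow-+ (top a) (low b) refl))))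
          (solve 6 (λ c d e s x y → (c :* (d :* e)) :* (s :* (x :* y)) := (c :* (d :* x)) :* (s :* (e :* y)))
            C.refl _ _ _ _ _ _)) n)
      (z·-cong (*ˢ-cong (∑-leftWeight top refl)
        (λ n → C.trans (∑-trees-dilate (weighted low) n) (dilate-cong (∑-weighted low refl) n))) n)

    Nᵐ-eq : Nᵐ ≋ z· ((const t +ˢ const q *ˢ Nᵐ) *ˢ (λ n → ∑ (trees n) (weighted topᵐ)))
    Nᵐ-eq n = C.trans
      (nonEmptyTrees-node (weighted lowᵐ) (λ a → leftWeight a * weighted lowᵐ a) (weighted topᵐ)
        (λ a b → C.trans (*-congˡ (pow-+ (topᵐ b) (lowᵐ a) refl))
          (solve 5 (λ c d e x y → (c :* (d :* e)) :* (y :* x) := (c :* (d :* x)) :* (e :* y)) C.refl _ _ _ _ _)) n)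
      (z·-cong (*ˢ-cong (∑-leftWeight lowᵐ refl) (λ _ → C.refl)) n)

    -- Mirroring moves the summand `size` to the left subtree, so the dilated factor is now the one
    -- carrying `leftWeight`.
    Hᵐ-eq : (λ n → ∑ (trees n) (weighted topᵐ)) ≋
            const 1# +ˢ z· (dilate (const t +ˢ const q *ˢ Nᵐ) *ˢ (λ n → ∑ (trees n) (weighted topᵐ)))
    Hᵐ-eq n = C.trans (∑-weighted topᵐ refl n) (+-congˡ (C.trans
      (nonEmptyTrees-node (weighted topᵐ)
        (λ a → q ^ size a * (leftWeight a * weighted lowᵐ a)) (weighted topᵐ)
        (λ a b → C.trans (*-congˡ (C.trans (pow-+ (size a) (topᵐ b + lowᵐ a) (cong (_+ (topᵐ b + lowᵐ a)) (size-mirror a)))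
                                           (*-congˡ (pow-+ (topᵐ b) (lowᵐ a) refl))))
          (solve 6 (λ c d e s x y → (c :* (d :* e)) :* (s :* (y :* x)) := (s :* (c :* (d :* x))) :* (e :* y))
            C.refl _ _ _ _ _ _)) n)
      (z·-cong (*ˢ-cong (λ n → C.trans (∑-trees-dilate (λ a → leftWeight a * weighted lowᵐ a) n)
                                       (dilate-cong (∑-leftWeight lowᵐ refl) n))
                        (λ _ → C.refl)) n)))

    N-solution : Solution t N
    N-solution = solution-I N-eq M-eq

    Nᵐ≋N : Nᵐ ≋ N
    Nᵐ≋N = solution-unique (solution-II Nᵐ-eq Hᵐ-eq) N-solution

    ∑-trees-low : ∀ n → ∑ (trees n) (weighted low) ≈ (const 1# +ˢ N) n
    ∑-trees-low = ∑-weighted low refl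

    ∑-trees-low-mirror : ∀ n → ∑ (trees n) (weighted (low ∘ mirror)) ≈ (const 1# +ˢ N) n
    ∑-trees-low-mirror n = C.trans (∑-weighted lowᵐ refl n) (+-congˡ (Nᵐ≋N n))

  -- This is `N-eq` with q M replaced by the series N of parameter t q: both solve the equation with
  -- that parameter.
  N-step : ∀ t → N t ≋ z· ((const t +ˢ N (t * q)) *ˢ (const 1# +ˢ N t))
  N-step t n = C.trans (N-eq t n) (z·-cong (*ˢ-cong
    (λ i → +-congˡ (C.sym (solution-unique (N-solution (t * q)) (solution-rescaled (N-eq t) (M-eq t)) i)))
    (λ _ → C.refl)) n)

  descentWeight-monomial : ∀ t t⁻¹ → t * t⁻¹ ≈ 1# → ∀ x →
    t ^ size x * (q * t⁻¹) ^ descents x ≈ descentWeight t x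
  descentWeight-monomial t t⁻¹ tt⁻¹ leaf       = *-identityˡ _
  descentWeight-monomial t t⁻¹ tt⁻¹ (node a b) = C.trans
    (*-cong (*-congˡ (^-homo-* t (size a) (size b)))
      (C.trans (^-homo-* r (nonEmpty a) _) (*-congˡ (^-homo-* r (descents a) (descents b)))))
    (C.trans (solve 6 (λ t e a b x y → (t :* (a :* b)) :* (e :* (x :* y)) := (t :* e) :* ((a :* x) :* (b :* y)))
                C.refl t (r ^ nonEmpty a) _ _ _ _)
    (*-cong (left a) (*-cong (descentWeight-monomial t t⁻¹ tt⁻¹ a) (descentWeight-monomial t t⁻¹ tt⁻¹ b))))
    where
    r = q * t⁻¹
    left : ∀ a → t * r ^ nonEmpty a ≈ leftWeight t a
    left leaf       = *-identityʳ t
    left (node _ _) = C.trans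
      (solve 3 (λ t q s → t :* ((q :* s) :* con 1) := q :* (t :* s)) C.refl t q t⁻¹)
      (C.trans (*-congˡ tt⁻¹) (*-identityʳ q))

-- Walks on the number of skipped letters

module PathSums {c ℓ} (R : CommutativeRing c ℓ) (t q : CommutativeRing.Carrier R) where
  open CommutativeRing R hiding (refl; sym; trans; zero) renaming (_+_ to _⊕_)
  private module C = CommutativeRing R
  open Sums R
  open PowerSeries commutativeSemiring
  open Uniqueness commutativeSemiring q using (Z; z·≋Z*)
  open TreeSeries R q using (N; N-step)
  private module P = CommutativeSemiring seriesSemiring
  open import Algebra.Solver.Ring.NaturalCoefficients.Default seriesSemiring
    using (solve; _:+_; _:*_; _:=_; con)

  -- Multiplication on the right makes the parameter at height h + 1 literally the one produced by
  -- `N-step` from that at height h.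
  t·q^ : ℕ → Carrier
  t·q^ zero    = t
  t·q^ (suc h) = t·q^ h * q

  t·q^≈ : ∀ h → t·q^ h ≈ t * q ^ h
  t·q^≈ zero    = C.sym (*-identityʳ t)
  t·q^≈ (suc h) = C.trans (*-congʳ (t·q^≈ h)) (C.trans (*-assoc _ _ _) (*-congˡ (*-comm _ _)))

  -- Here h letters are skipped and r letters lie above the maximum. In `paths` the next letter is
  -- the least skipped one, with weight 1, or a new maximum; in `climbs` it is a new maximum, and
  -- the least of the r letters either becomes that maximum or is skipped as well.
  mutual
    paths : ℕ → ℕ → Carrier
    paths zero    zero    = 1#
    paths zero    (suc r) = climbs zero (suc r)
    paths (suc h) r       = paths h r ⊕ climbs (suc h) r

    climbs : ℕ → ℕ → Carrier
    climbs h zero    = 0#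
    climbs h (suc r) = t·q^ h * paths h r ⊕ climbs (suc h) r

  -- A walk goes down by single steps, so a walk from height h to 0 can be cut at its first arrivals
  -- at h - 1, ..., 0. The piece staying at height i or above is a walk from 0 to 0 with t replaced
  -- by t q^i, counted by 1 + N at that parameter.
  B : ℕ → Series
  B zero    = const 1#
  B (suc h) = B h *ˢ (const 1# +ˢ N (t·q^ h))

  private
    BN : ℕ → Series
    BN h = B h *ˢ N (t·q^ h)

    -- `N-step` multiplied by `B h`: its factor 1 + N completes `B (suc h)`, and the result is the
    -- recursion of `climbs`.
    BN-step : ∀ h → BN h ≋ z· (const (t·q^ h) *ˢ B (suc h) +ˢ BN (suc h))
    BN-step h = P.trans (P.*-congˡ (P.trans (N-step (t·q^ h)) (z·≋Z* _)))
      (P.trans (solve 5 (λ b z τ N N′ → b :* (z :* ((τ :+ N′) :* (con 1 :+ N)))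
                  := z :* (τ :* (b :* (con 1 :+ N)) :+ b :* (con 1 :+ N) :* N′))
                  P.refl (B h) Z (const (t·q^ h)) (N (t·q^ h)) (N (t·q^ (suc h))))
      (P.sym (z·≋Z* _)))

    B-suc : ∀ h → B (suc h) ≋ B h +ˢ BN h
    B-suc h = P.trans (P.distribˡ (B h) (const 1#) (N (t·q^ h))) (P.+-congʳ (P.*-identityʳ (B h)))

  mutual
    paths≈B : ∀ h r → paths h r ≈ B (suc h) r
    paths≈B zero    zero    = C.sym (C.trans (*-identityˡ _) (+-identityʳ 1#))
    paths≈B zero    (suc r) = C.trans (climbs≈BN zero (suc r))
      (C.trans (C.sym (+-identityˡ _)) (C.sym (B-suc 0 (suc r))))
    paths≈B (suc h) r       = C.trans (+-cong (paths≈B h r) (climbs≈BN (suc h) r)) (C.sym (B-suc (suc h) r))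

    climbs≈BN : ∀ h r → climbs h r ≈ BN h r
    climbs≈BN h zero    = C.sym (BN-step h 0)
    climbs≈BN h (suc r) = C.trans
      (+-cong (C.trans (*-congˡ (paths≈B h r)) (C.sym (const-*ˢ (t·q^ h) (B (suc h)) r))) (climbs≈BN (suc h) r))
      (C.sym (BN-step h (suc r)))

  paths-from-0 : ∀ n → paths 0 n ≈ (const 1# +ˢ N t) n
  paths-from-0 n = C.trans (paths≈B 0 n) (*ˢ-identityˡ (const 1# +ˢ N t) n)

-- Permutations as lists

unique∧set⇒↭ : ∀ {a} {A : Set a} {xs ys : List A} → Unique xs → Unique ys →
                (∀ {x} → x ∈ xs → x ∈ ys) → (∀ {x} → x ∈ ys → x ∈ xs) → xs ↭ ys
unique∧set⇒↭ xs! ys! to from = ∼bag⇒↭ (unique∧set⇒bag xs! ys! (mk⇔ to from))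

infixr 5 _∷_
data AllTriples (P : ℕ → ℕ → ℕ → Set) : List ℕ → Set where
  []  : AllTriples P []
  _∷_ : ∀ {x xs} → AllPairs (P x) xs → AllTriples P xs → AllTriples P (x ∷ xs)

module _ {n : ℕ} where
  -- One-line notation with letters 1, …, n.
  oneLine : ∀ {k} → Vec (Fin n) k → List ℕ
  oneLine π = toList (Vec.map (suc ∘ toℕ) π)

module _ {A : Set} where

  lookup⇒all : ∀ {k} {P : A → Set} (v : Vec A k) → (∀ i → P (lookup v i)) → All P (toList v)
  lookup⇒all []      p = []
  lookup⇒all (x ∷ v) p = p zero ∷ lookup⇒all v (p ∘ suc)

  all⇒lookup : ∀ {k} {P : A → Set} (v : Vec A k) → All P (toList v) → ∀ i → P (lookup v i)
  all⇒lookup (x ∷ v) (px ∷ _)  zero    = px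
  all⇒lookup (x ∷ v) (_  ∷ pv) (suc i) = all⇒lookup v pv i

  lookup⇒allPairs : ∀ {k} {R : A → A → Set} (v : Vec A k) →
                    (∀ i j → i Fin.< j → R (lookup v i) (lookup v j)) → AllPairs R (toList v)
  lookup⇒allPairs []      p = []
  lookup⇒allPairs (x ∷ v) p =
    lookup⇒all v (λ j → p zero (suc j) (s≤s z≤n)) ∷ lookup⇒allPairs v (λ i j i<j → p (suc i) (suc j) (s≤s i<j))

  allPairs⇒lookup : ∀ {k} {R : A → A → Set} (v : Vec A k) → AllPairs R (toList v) →
                    ∀ i j → i Fin.< j → R (lookup v i) (lookup v j)
  allPairs⇒lookup (x ∷ v) (px ∷ pv) zero    (suc j) i<j       = all⇒lookup v px j
  allPairs⇒lookup (x ∷ v) (px ∷ pv) (suc i) (suc j) (s≤s i<j) = allPairs⇒lookup v pv i j i<j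

lookup⇒allTriples : ∀ {k} {P : ℕ → ℕ → ℕ → Set} (v : Vec ℕ k) →
  (∀ i j l → i Fin.< j → j Fin.< l → P (lookup v i) (lookup v j) (lookup v l)) → AllTriples P (toList v)
lookup⇒allTriples []      p = []
lookup⇒allTriples (x ∷ v) p =
  lookup⇒allPairs v (λ j l j<l → p zero (suc j) (suc l) (s≤s z≤n) (s≤s j<l)) ∷
  lookup⇒allTriples v (λ i j l i<j j<l → p (suc i) (suc j) (suc l) (s≤s i<j) (s≤s j<l))

allTriples⇒lookup : ∀ {k} {P : ℕ → ℕ → ℕ → Set} (v : Vec ℕ k) → AllTriples P (toList v) →
  ∀ i j l → i Fin.< j → j Fin.< l → P (lookup v i) (lookup v j) (lookup v l)
allTriples⇒lookup (x ∷ v) (px ∷ pv) zero    (suc j) (suc l) _         (s≤s j<l) = allPairs⇒lookup v px j l j<l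
allTriples⇒lookup (x ∷ v) (px ∷ pv) (suc i) (suc j) (suc l) (s≤s i<j) (s≤s j<l) = allTriples⇒lookup v pv i j l i<j j<l

Order : Set₁
Order = ℕ → ℕ → ℕ → Set

-- Each pattern is given by the two comparisons between letters of neighbouring value; the third
-- follows by transitivity.
Order231 Order213 Order321 : Order
Order231 x y z = z < x × x < y
Order213 x y z = y < x × x < z
Order321 x y z = z < y × y < x

Not : Order → Order
Not F x y z = ¬ F x y z

Describes : Order → Pattern → Set
Describes F τ = ∀ x y z → OrderIsomorphic τ (x ∷ y ∷ z ∷ []) ⇔ F x y z

private
  -- When the letters of u are distinct, trichotomy turns preservation of the order into reflection,
  -- so only one direction has to be checked for a concrete pattern.
  orderIsomorphic⁺ : ∀ {k} (u v : Vec ℕ k) → (∀ a b → lookup u a ≡ lookup u b → a ≡ b) →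
    (∀ a b → lookup u a < lookup u b → lookup v a < lookup v b) → OrderIsomorphic u v
  orderIsomorphic⁺ u v u-inj mono a b = mono a b , reflect
    where
    reflect : lookup v a < lookup v b → lookup u a < lookup u b
    reflect va<vb with ℕ.<-cmp (lookup u a) (lookup u b)
    ... | tri< ua<ub _ _ = ua<ub
    ... | tri≈ _ ua≡ub _ with refl ← u-inj a b ua≡ub = contradiction va<vb (<-irrefl refl)
    ... | tri> _ _ ub<ua = contradiction va<vb (<-asym (mono b a ub<ua))

describes231 : Describes Order231 p231
describes231 x y z = mk⇔ (λ iso → proj₁ (iso (suc (suc zero)) zero) (s≤s (s≤s z≤n)) , proj₁ (iso zero (suc zero)) (s≤s (s≤s (s≤s z≤n)))) λ (l₁ , l₂) → orderIsomorphic⁺ p231 (x ∷ y ∷ z ∷ []) distinct (mono (l₁ , l₂))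
  where
  distinct : ∀ a b → lookup p231 a ≡ lookup p231 b → a ≡ b
  distinct zero zero _ = refl
  distinct zero (suc zero) ()
  distinct zero (suc (suc zero)) ()
  distinct (suc zero) zero ()
  distinct (suc zero) (suc zero) _ = refl
  distinct (suc zero) (suc (suc zero)) ()
  distinct (suc (suc zero)) zero ()
  distinct (suc (suc zero)) (suc zero) ()
  distinct (suc (suc zero)) (suc (suc zero)) _ = refl
  mono : Order231 x y z → ∀ a b → lookup p231 a < lookup p231 b →
         lookup (x ∷ y ∷ z ∷ []) a < lookup (x ∷ y ∷ z ∷ []) b
  mono _ zero zero (s≤s (s≤s ()))
  mono (l₁ , l₂) zero (suc zero) _ = l₂
  mono _ zero (suc (suc zero)) (s≤s ())
  mono _ (suc zero) zero (s≤s (s≤s ()))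
  mono _ (suc zero) (suc zero) (s≤s (s≤s (s≤s ())))
  mono _ (suc zero) (suc (suc zero)) (s≤s ())
  mono (l₁ , l₂) (suc (suc zero)) zero _ = l₁
  mono (l₁ , l₂) (suc (suc zero)) (suc zero) _ = <-trans l₁ l₂
  mono _ (suc (suc zero)) (suc (suc zero)) (s≤s ())

describes213 : Describes Order213 p213
describes213 x y z = mk⇔ (λ iso → proj₁ (iso (suc zero) zero) (s≤s (s≤s z≤n)) , proj₁ (iso zero (suc (suc zero))) (s≤s (s≤s (s≤s z≤n)))) λ (l₁ , l₂) → orderIsomorphic⁺ p213 (x ∷ y ∷ z ∷ []) distinct (mono (l₁ , l₂))
  where
  distinct : ∀ a b → lookup p213 a ≡ lookup p213 b → a ≡ b
  distinct zero zero _ = refl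
  distinct zero (suc zero) ()
  distinct zero (suc (suc zero)) ()
  distinct (suc zero) zero ()
  distinct (suc zero) (suc zero) _ = refl
  distinct (suc zero) (suc (suc zero)) ()
  distinct (suc (suc zero)) zero ()
  distinct (suc (suc zero)) (suc zero) ()
  distinct (suc (suc zero)) (suc (suc zero)) _ = refl
  mono : Order213 x y z → ∀ a b → lookup p213 a < lookup p213 b →
         lookup (x ∷ y ∷ z ∷ []) a < lookup (x ∷ y ∷ z ∷ []) b
  mono _ zero zero (s≤s (s≤s ()))
  mono _ zero (suc zero) (s≤s ())
  mono (l₁ , l₂) zero (suc (suc zero)) _ = l₂
  mono (l₁ , l₂) (suc zero) zero _ = l₁
  mono _ (suc zero) (suc zero) (s≤s ())
  mono (l₁ , l₂) (suc zero) (suc (suc zero)) _ = <-trans l₁ l₂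
  mono _ (suc (suc zero)) zero (s≤s (s≤s ()))
  mono _ (suc (suc zero)) (suc zero) (s≤s ())
  mono _ (suc (suc zero)) (suc (suc zero)) (s≤s (s≤s (s≤s ())))

describes321 : Describes Order321 p321
describes321 x y z = mk⇔ (λ iso → proj₁ (iso (suc (suc zero)) (suc zero)) (s≤s (s≤s z≤n)) , proj₁ (iso (suc zero) zero) (s≤s (s≤s (s≤s z≤n)))) λ (l₁ , l₂) → orderIsomorphic⁺ p321 (x ∷ y ∷ z ∷ []) distinct (mono (l₁ , l₂))
  where
  distinct : ∀ a b → lookup p321 a ≡ lookup p321 b → a ≡ b
  distinct zero zero _ = refl
  distinct zero (suc zero) ()
  distinct zero (suc (suc zero)) ()
  distinct (suc zero) zero ()
  distinct (suc zero) (suc zero) _ = refl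
  distinct (suc zero) (suc (suc zero)) ()
  distinct (suc (suc zero)) zero ()
  distinct (suc (suc zero)) (suc zero) ()
  distinct (suc (suc zero)) (suc (suc zero)) _ = refl
  mono : Order321 x y z → ∀ a b → lookup p321 a < lookup p321 b →
         lookup (x ∷ y ∷ z ∷ []) a < lookup (x ∷ y ∷ z ∷ []) b
  mono _ zero zero (s≤s (s≤s (s≤s ())))
  mono _ zero (suc zero) (s≤s (s≤s ()))
  mono _ zero (suc (suc zero)) (s≤s ())
  mono (l₁ , l₂) (suc zero) zero _ = l₂
  mono _ (suc zero) (suc zero) (s≤s (s≤s ()))
  mono _ (suc zero) (suc (suc zero)) (s≤s ())
  mono (l₁ , l₂) (suc (suc zero)) zero _ = <-trans l₁ l₂
  mono (l₁ , l₂) (suc (suc zero)) (suc zero) _ = l₁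
  mono _ (suc (suc zero)) (suc (suc zero)) (s≤s ())

-- The permutations of the interval o, ..., o + n - 1. The offset allows the blocks of a word to
-- keep their letters without standardization.
Arrangement : ℕ → ℕ → List ℕ → Set
Arrangement o n xs = Unique xs × (∀ {x} → x ∈ xs → o ≤ x × x < o + n) × (∀ {x} → o ≤ x → x < o + n → x ∈ xs)

arrangement-length : ∀ {o n xs} → Arrangement o n xs → length xs ≡ n
arrangement-length {o} {n} (xs! , bounds , all∈) = trans
  (↭-length (unique∧set⇒↭ xs! (Unique.applyUpTo⁺₁ (o +_) n λ i<j _ eq → ℕ.<⇒≢ i<j (ℕ.+-cancelˡ-≡ o _ _ eq))
    (λ x∈ → let o≤x , x<o+n = bounds x∈ in
       subst (_∈ applyUpTo (o +_) n) (ℕ.m+[n∸m]≡n o≤x)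
         (∈-applyUpTo⁺ (o +_) (ℕ.+-cancelˡ-< o _ _ (subst (_< o + n) (sym (ℕ.m+[n∸m]≡n o≤x)) x<o+n))))
    (λ x∈ → let i , i<n , eq = ∈-applyUpTo⁻ (o +_) x∈ in
       subst (_∈ _) (sym eq) (all∈ (ℕ.m≤m+n o i) (ℕ.+-monoʳ-< o i<n)))))
  (List.length-applyUpTo (o +_) n)

∈-words : ∀ {m k} (π : Vec (Fin m) k) → π ∈ words m k
∈-words []      = here refl
∈-words (x ∷ π) = ∈-cartesianProductWith⁺ _∷_ (∈-allFin x) (∈-words π)

words-unique : ∀ m k → Unique (words m k)
words-unique m zero    = [] ∷ []
words-unique m (suc k) = Unique.cartesianProductWith⁺ _∷_ Vec.∷-injective (Unique.allFin⁺ m) (words-unique m k)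

𝔖-unique : ∀ n τ → Unique (𝔖 n τ)
𝔖-unique n τ = Unique.filter⁺ (avoids? τ) (Unique.filter⁺ unique? (words-unique n n))

∈-𝔖⁺ : ∀ n τ {π : Word n} → Vec.Unique π → Avoids τ π → π ∈ 𝔖 n τ
∈-𝔖⁺ n τ {π} π! av =
  ∈-filter⁺ (avoids? τ) {xs = permutations n} (∈-filter⁺ unique? {xs = words n n} (∈-words π) π!) av

∈-𝔖⁻ : ∀ n τ {π : Word n} → π ∈ 𝔖 n τ → Vec.Unique π × Avoids τ π
∈-𝔖⁻ n τ π∈ with π∈′ , av ← ∈-filter⁻ (avoids? τ) {xs = permutations n} π∈ =
  proj₂ (∈-filter⁻ unique? {xs = words n n} π∈′) , av

module _ {m : ℕ} where

  private
    value-injective : ∀ {i j : Fin m} → suc (toℕ i) ≡ suc (toℕ j) → i ≡ j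
    value-injective = Fin.toℕ-injective ∘ suc-injective

  oneLine-injective : ∀ {k} {π σ : Vec (Fin m) k} → oneLine π ≡ oneLine σ → π ≡ σ
  oneLine-injective {π = []}    {[]}    eq = refl
  oneLine-injective {π = x ∷ π} {y ∷ σ} eq =
    let x≡y , π≡σ = List.∷-injective eq in cong₂ _∷_ (value-injective x≡y) (oneLine-injective π≡σ)

  oneLine-unique⁺ : ∀ {k} {π : Vec (Fin m) k} → Vec.Unique π → Unique (oneLine π)
  oneLine-unique⁺ {π = π} π! = lookup⇒allPairs (Vec.map (suc ∘ toℕ) π) λ i j i<j eq →
    Fin.<⇒≢ i<j (VecUnique.lookup-injective π! i j (value-injective
      (trans (sym (Vec.lookup-map i _ π)) (trans eq (Vec.lookup-map j _ π)))))

  oneLine-unique⁻ : ∀ {k} (π : Vec (Fin m) k) → Unique (oneLine π) → Vec.Unique π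
  oneLine-unique⁻ []      _        = VecAllPairs.[]
  oneLine-unique⁻ (x ∷ π) (x∉ ∷ π!) = fresh π x∉ VecAllPairs.∷ oneLine-unique⁻ π π!
    where
    fresh : ∀ {k} (σ : Vec (Fin m) k) → All (suc (toℕ x) ≢_) (oneLine σ) → VecAll.All (x ≢_) σ
    fresh []      []         = VecAll.[]
    fresh (y ∷ σ) (x≢y ∷ x≢) = (x≢y ∘ cong (suc ∘ toℕ)) VecAll.∷ fresh σ x≢

  ∈-oneLine⁺ : ∀ {k} (π : Vec (Fin m) k) i → suc (toℕ (lookup π i)) ∈ oneLine π
  ∈-oneLine⁺ (x ∷ π) zero    = here refl
  ∈-oneLine⁺ (x ∷ π) (suc i) = there (∈-oneLine⁺ π i)

  ∈-oneLine⁻ : ∀ {k} (π : Vec (Fin m) k) {x} → x ∈ oneLine π → 1 ≤ x × x < suc m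
  ∈-oneLine⁻ (y ∷ π) (here refl) = s≤s z≤n , s≤s (Fin.toℕ<n y)
  ∈-oneLine⁻ (y ∷ π) (there x∈)  = ∈-oneLine⁻ π x∈

  oneLine-surjective : ∀ {k} xs → length xs ≡ k → (∀ {x} → x ∈ xs → 1 ≤ x × x < suc m) →
                       ∃ λ (π : Vec (Fin m) k) → oneLine π ≡ xs
  oneLine-surjective []       refl bounds = [] , refl
  oneLine-surjective (zero ∷ xs) refl bounds with () ← proj₁ (bounds (here refl))
  oneLine-surjective (suc x ∷ xs) refl bounds =
    let x<m     = ℕ.≤-pred (proj₂ (bounds (here refl)))
        π , eq  = oneLine-surjective xs refl (bounds ∘ there)
    in fromℕ< x<m ∷ π , cong₂ _∷_ (cong suc (Fin.toℕ-fromℕ< x<m)) eq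

-- Removing a missed value from the codomain would leave an injection into a set with one element
-- fewer.
injective⇒surjective : ∀ {n} (f : Fin n → Fin n) → (∀ i j → f i ≡ f j → i ≡ j) → ∀ y → ∃ λ i → f i ≡ y
injective⇒surjective {suc n} f f-inj y with Fin.any? (λ i → f i Fin.≟ y)
... | yes hit = hit
... | no miss =
  let avoid = λ i y≡fi → miss (i , sym y≡fi)
      i , j , i<j , eq = Fin.pigeonhole ≤-refl (λ i → Fin.punchOut (avoid i))
  in contradiction (f-inj i j (Fin.punchOut-injective (avoid i) (avoid j) eq)) (Fin.<⇒≢ i<j)

oneLine-arrangement : ∀ {n} {π : Word n} → Vec.Unique π → Arrangement 1 n (oneLine π)
oneLine-arrangement {n} {π} π! = oneLine-unique⁺ π! , ∈-oneLine⁻ π , onto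
  where
  onto : ∀ {x} → 1 ≤ x → x < suc n → x ∈ oneLine π
  onto {suc x} _ (s≤s x<n) =
    let i , eq = injective⇒surjective (lookup π) (VecUnique.lookup-injective π!) (fromℕ< x<n)
    in subst (_∈ oneLine π) (cong suc (trans (cong toℕ eq) (Fin.toℕ-fromℕ< x<n))) (∈-oneLine⁺ π i)

module _ (F : Order) (τ : Pattern) (describes : Describes F τ)
         (F-suc : ∀ {x y z} → F x y z ⇔ F (suc x) (suc y) (suc z)) where

  private
    -- Letters start from 0 in `subword` and from 1 in `oneLine`, hence the invariance of `F` under
    -- a common shift.
    iso⇔ : ∀ {a b c x y z} → x ≡ suc a → y ≡ suc b → z ≡ suc c →
           OrderIsomorphic τ (a ∷ b ∷ c ∷ []) ⇔ F x y z
    iso⇔ refl refl refl = mk⇔ (Equivalence.to F-suc ∘ Equivalence.to (describes _ _ _))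
                              (Equivalence.from (describes _ _ _) ∘ Equivalence.from F-suc)

    subword⇔ : ∀ {n} (π : Word n) i j k → OrderIsomorphic τ (subword π i j k) ⇔
      F (lookup (Vec.map (suc ∘ toℕ) π) i) (lookup (Vec.map (suc ∘ toℕ) π) j) (lookup (Vec.map (suc ∘ toℕ) π) k)
    subword⇔ π i j k = iso⇔ (Vec.lookup-map i _ π) (Vec.lookup-map j _ π) (Vec.lookup-map k _ π)

  avoids⇒allTriples : ∀ {n} (π : Word n) → Avoids τ π → AllTriples (Not F) (oneLine π)
  avoids⇒allTriples π av = lookup⇒allTriples _ λ i j k i<j j<k Fijk →
    av (i , j , k , i<j , j<k , Equivalence.from (subword⇔ π i j k) Fijk)

  allTriples⇒avoids : ∀ {n} (π : Word n) → AllTriples (Not F) (oneLine π) → Avoids τ π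
  allTriples⇒avoids π av (i , j , k , i<j , j<k , iso) =
    allTriples⇒lookup _ av i j k i<j j<k (Equivalence.to (subword⇔ π i j k) iso)

  module _ {c ℓ} (R : CommutativeRing c ℓ) where
    private module C = CommutativeRing R
    open C using (Carrier; _≈_)
    open Sums R
    open SumProperties R

    -- A sum does not see the order of its terms, so the filtered enumeration of all words may be
    -- exchanged for any repetition-free list with the same members. It serves for the words of
    -- trees and for `scans`.
    ∑-𝔖 : ∀ n {f : Word n → Carrier} {g : List ℕ → Carrier} (ys : List (List ℕ)) → Unique ys →
          (∀ {xs} → xs ∈ ys → Arrangement 1 n xs × AllTriples (Not F) xs) →
          (∀ {xs} → Arrangement 1 n xs → AllTriples (Not F) xs → xs ∈ ys) →
          (∀ π → π ∈ 𝔖 n τ → f π ≈ g (oneLine π)) → ∑ (𝔖 n τ) f ≈ ∑ ys g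
    ∑-𝔖 n {f} {g} ys ys! sound complete f≈g =
      C.trans (∑-cong (𝔖 n τ) f≈g) (C.trans (C.sym (∑-map oneLine (𝔖 n τ) g)) (∑-↭ g
        (unique∧set⇒↭ (Unique.map⁺ oneLine-injective (𝔖-unique n τ)) ys! to from)))
      where
      to : ∀ {xs} → xs ∈ map oneLine (𝔖 n τ) → xs ∈ ys
      to xs∈ with π , π∈ , refl ← ∈-map⁻ oneLine xs∈ with π! , av ← ∈-𝔖⁻ n τ π∈ =
        complete (oneLine-arrangement π!) (avoids⇒allTriples π av)
      from : ∀ {xs} → xs ∈ ys → xs ∈ map oneLine (𝔖 n τ)
      from {xs} xs∈ with arr@(xs! , bounds , _) , av ← sound xs∈
        with π , refl ← oneLine-surjective {n} {n} xs (arrangement-length arr) bounds =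
        ∈-map⁺ oneLine (∈-𝔖⁺ n τ (oneLine-unique⁻ π xs!) (allTriples⇒avoids π av))

-- Words avoiding 231 or 213

module _ {a} {A : Set a} where

  ++-split : ∀ (xs ys : List A) {us vs} → length xs ≡ length ys → xs ++ us ≡ ys ++ vs → xs ≡ ys × us ≡ vs
  ++-split []       []       _  eq = refl , eq
  ++-split (x ∷ xs) (y ∷ ys) ln eq =
    let x≡y , eq′ = List.∷-injective eq
        xs≡ys , us≡vs = ++-split xs ys (suc-injective ln) eq′
    in cong₂ _∷_ x≡y xs≡ys , us≡vs

  allPairs-∈ : ∀ {R : A → A → Set} xs → (∀ {x y} → x ∈ xs → y ∈ xs → R x y) → AllPairs R xs
  allPairs-∈ []       p = []
  allPairs-∈ (x ∷ xs) p = All.tabulate (p (here refl) ∘ there) ∷ allPairs-∈ xs (λ x∈ y∈ → p (there x∈) (there y∈))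

  allPairs-++⁻ : ∀ {R : A → A → Set} xs {ys} → AllPairs R (xs ++ ys) → AllPairs R xs × AllPairs R ys
  allPairs-++⁻ []       ps       = [] , ps
  allPairs-++⁻ (x ∷ xs) (p ∷ ps) =
    let pxs , pys = allPairs-++⁻ xs ps in All.++⁻ˡ xs p ∷ pxs , pys

-- A triple crossing the cut has its first letter in `xs` and its last in `ys`, wherever the middle
-- one lies; so the condition on crossing triples quantifies freely over the middle letter.
allTriples-++⁺ : ∀ {P} {xs ys} → AllTriples P xs → AllTriples P ys →
                 (∀ {x z} → x ∈ xs → z ∈ ys → ∀ y → P x y z) → AllTriples P (xs ++ ys)
allTriples-++⁺ []       qs cross = qs
allTriples-++⁺ {ys = ys} (_∷_ {x} {xs} p ps) qs cross =
  AllPairs.++⁺ p (allPairs-∈ ys λ _ z∈ → cross (here refl) z∈ _)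
    (All.tabulate λ _ → All.tabulate λ z∈ → cross (here refl) z∈ _)
  ∷ allTriples-++⁺ ps qs (cross ∘ there)

allTriples-++⁻ : ∀ {P} xs {ys} → AllTriples P (xs ++ ys) → AllTriples P xs × AllTriples P ys
allTriples-++⁻ []       ps       = [] , ps
allTriples-++⁻ (x ∷ xs) (p ∷ ps) =
  let pxs , pys = allTriples-++⁻ xs ps in proj₁ (allPairs-++⁻ xs p) ∷ pxs , pys

-- A permutation avoiding 231 (resp. 213) with first letter k is k followed by its smaller and
-- its larger letters, in this (resp. the opposite) order.
data Shape : Set where
  s231 s213 : Shape

arrange : Shape → List ℕ → List ℕ → List ℕ
arrange s231 xs ys = xs ++ ys
arrange s213 xs ys = ys ++ xs

ShapeOrder : Shape → Order
ShapeOrder s231 = Order231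
ShapeOrder s213 = Order213

word : Shape → ℕ → Tree → List ℕ
word s o leaf       = []
word s o (node a b) = o + size a ∷ arrange s (word s o a) (word s (suc (o + size a)) b)

module _ {xs ys : List ℕ} where

  ∈-arrange⁺ˡ : ∀ s {x} → x ∈ xs → x ∈ arrange s xs ys
  ∈-arrange⁺ˡ s231 = ∈-++⁺ˡ
  ∈-arrange⁺ˡ s213 = ∈-++⁺ʳ ys

  ∈-arrange⁺ʳ : ∀ s {x} → x ∈ ys → x ∈ arrange s xs ys
  ∈-arrange⁺ʳ s231 = ∈-++⁺ʳ xs
  ∈-arrange⁺ʳ s213 = ∈-++⁺ˡ

  ∈-arrange⁻ : ∀ s {x} → x ∈ arrange s xs ys → x ∈ xs ⊎ x ∈ ys
  ∈-arrange⁻ s231 x∈ = ∈-++⁻ xs x∈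
  ∈-arrange⁻ s213 x∈ = [ inj₂ , inj₁ ]′ (∈-++⁻ ys x∈)

length-arrange : ∀ s xs ys → length (arrange s xs ys) ≡ length xs + length ys
length-arrange s231 xs ys = List.length-++ xs
length-arrange s213 xs ys = trans (List.length-++ ys) (ℕ.+-comm (length ys) (length xs))

private
  shift : ∀ o i j → suc (o + i) + j ≡ o + suc (i + j)
  shift o i j = trans (cong suc (ℕ.+-assoc o i j)) (sym (ℕ.+-suc o (i + j)))

module _ (s : Shape) where

  word-bounds : ∀ o t {x} → x ∈ word s o t → o ≤ x × x < o + size t
  word-bounds o (node a b) (here refl) =
    ℕ.m≤m+n o (size a) , ℕ.+-monoʳ-< o (s≤s (ℕ.m≤m+n (size a) (size b)))
  word-bounds o (node a b) {x} (there x∈) with ∈-arrange⁻ s x∈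
  ... | inj₁ x∈a = let o≤x , x<k = word-bounds o a x∈a in
    o≤x , ≤-trans x<k (ℕ.+-monoʳ-≤ o (m≤n⇒m≤1+n (ℕ.m≤m+n (size a) (size b))))
  ... | inj₂ x∈b = let k<x , x<n = word-bounds _ b x∈b in
    ≤-trans (ℕ.m≤m+n o (size a)) (ℕ.<⇒≤ k<x) , subst (x <_) (shift o (size a) (size b)) x<n

  word-onto : ∀ o t {x} → o ≤ x → x < o + size t → x ∈ word s o t
  word-onto o leaf {x} o≤x x<o = contradiction (≤-trans (subst (x <_) (ℕ.+-identityʳ o) x<o) o≤x) (<-irrefl refl)
  word-onto o (node a b) {x} o≤x x<n with ℕ.<-cmp x (o + size a)
  ... | tri< x<k _ _ = there (∈-arrange⁺ˡ s (word-onto o a o≤x x<k))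
  ... | tri≈ _ refl _ = here refl
  ... | tri> _ _ k<x = there (∈-arrange⁺ʳ s (word-onto _ b k<x (subst (x <_) (sym (shift o (size a) (size b))) x<n)))

  length-word : ∀ o t → length (word s o t) ≡ size t
  length-word o leaf       = refl
  length-word o (node a b) = cong suc (trans (length-arrange s (word s o a) _)
    (cong₂ _+_ (length-word o a) (length-word _ b)))

arrange-unique : ∀ s {xs ys} → Unique xs → Unique ys → (∀ {x y} → x ∈ xs → y ∈ ys → x < y) → Unique (arrange s xs ys)
arrange-unique s231 xs! ys! xs<ys = Unique.++⁺ xs! ys! λ (x∈ , y∈) → <-irrefl refl (xs<ys x∈ y∈)
arrange-unique s213 xs! ys! xs<ys = Unique.++⁺ ys! xs! λ (y∈ , x∈) → <-irrefl refl (xs<ys x∈ y∈)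

arrange-pairs : ∀ s {k xs ys} → (∀ {x} → x ∈ xs → x < k) → (∀ {y} → y ∈ ys → k < y) →
                AllPairs (Not (ShapeOrder s) k) (arrange s xs ys)
arrange-pairs s231 {k} {xs} {ys} xs<k k<ys = AllPairs.++⁺
  (allPairs-∈ xs λ x∈ _ (_ , k<x) → <-asym k<x (xs<k x∈))
  (allPairs-∈ ys λ _ y∈ (y<k , _) → <-asym y<k (k<ys y∈))
  (All.tabulate λ x∈ → All.tabulate λ _ (_ , k<x) → <-asym k<x (xs<k x∈))
arrange-pairs s213 {k} {xs} {ys} xs<k k<ys = AllPairs.++⁺
  (allPairs-∈ ys λ y∈ _ (y<k , _) → <-asym y<k (k<ys y∈))
  (allPairs-∈ xs λ _ x∈ (_ , k<x) → <-asym k<x (xs<k x∈))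
  (All.tabulate λ y∈ → All.tabulate λ _ (y<k , _) → <-asym y<k (k<ys y∈))

arrange-triples⁺ : ∀ s {xs ys} → AllTriples (Not (ShapeOrder s)) xs → AllTriples (Not (ShapeOrder s)) ys →
                   (∀ {x y} → x ∈ xs → y ∈ ys → x < y) → AllTriples (Not (ShapeOrder s)) (arrange s xs ys)
arrange-triples⁺ s231 pxs pys xs<ys = allTriples-++⁺ pxs pys λ x∈ z∈ _ (z<x , _) → <-asym z<x (xs<ys x∈ z∈)
arrange-triples⁺ s213 pxs pys xs<ys = allTriples-++⁺ pys pxs λ y∈ z∈ _ (_ , y<z) → <-asym y<z (xs<ys z∈ y∈)

arrange-triples⁻ : ∀ s {P} xs ys → AllTriples P (arrange s xs ys) → AllTriples P xs × AllTriples P ys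
arrange-triples⁻ s231 xs ys p = allTriples-++⁻ xs p
arrange-triples⁻ s213 xs ys p = let pys , pxs = allTriples-++⁻ ys p in pxs , pys

arrange-unique⁻ : ∀ s xs ys → Unique (arrange s xs ys) → Unique xs × Unique ys
arrange-unique⁻ s231 xs ys p = allPairs-++⁻ xs p
arrange-unique⁻ s213 xs ys p = let pys , pxs = allPairs-++⁻ ys p in pxs , pys

-- Once a letter of the second block has appeared, a later letter from the first block would
-- complete the forbidden pattern begun by k. Hence the first change of side is the only one.
unarrange : ∀ s {k} zs → AllPairs (Not (ShapeOrder s) k) zs → All (k ≢_) zs →
            ∃ λ xs → ∃ λ ys → arrange s xs ys ≡ zs × All (_< k) xs × All (k <_) ys
unarrange s231 []       _ _ = [] , [] , refl , [] , []
unarrange s213 []       _ _ = [] , [] , refl , [] , []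
unarrange s {k} (z ∷ zs) (p ∷ ps) (k≢z ∷ k∉) with ℕ.<-cmp z k
... | tri≈ _ z≡k _ = contradiction (sym z≡k) k≢z
unarrange s231 (z ∷ zs) (p ∷ ps) (k≢z ∷ k∉) | tri< z<k _ _ =
  let xs , ys , eq , xs<k , k<ys = unarrange s231 zs ps k∉
  in z ∷ xs , ys , cong (z ∷_) eq , z<k ∷ xs<k , k<ys
unarrange s231 (z ∷ zs) (p ∷ ps) (k≢z ∷ k∉) | tri> _ _ k<z =
  [] , z ∷ zs , refl , [] ,
  k<z ∷ All.zipWith (λ (¬F , k≢y) → ℕ.≤∧≢⇒< (ℕ.≮⇒≥ λ y<k → ¬F (y<k , k<z)) k≢y) (p , k∉)
unarrange s213 (z ∷ zs) (p ∷ ps) (k≢z ∷ k∉) | tri> _ _ k<z =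
  let xs , ys , eq , xs<k , k<ys = unarrange s213 zs ps k∉
  in xs , z ∷ ys , cong (z ∷_) eq , xs<k , k<z ∷ k<ys
unarrange s213 (z ∷ zs) (p ∷ ps) (k≢z ∷ k∉) | tri< z<k _ _ =
  z ∷ zs , [] , refl ,
  z<k ∷ All.zipWith (λ (¬F , k≢y) → ℕ.≤∧≢⇒< (ℕ.≮⇒≥ λ k<y → ¬F (z<k , k<y)) (k≢y ∘ sym)) (p , k∉) , []

arrange-injective : ∀ s xs xs′ {ys ys′} → length xs ≡ length xs′ → length ys ≡ length ys′ →
                    arrange s xs ys ≡ arrange s xs′ ys′ → xs ≡ xs′ × ys ≡ ys′
arrange-injective s231 xs xs′ ln _ eq = ++-split xs xs′ ln eq
arrange-injective s213 xs xs′ {ys} {ys′} _ ln eq = let p , q = ++-split ys ys′ ln eq in q , p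

module _ (s : Shape) where

  private
    sides : ∀ o a b {x y} → x ∈ word s o a → y ∈ word s (suc (o + size a)) b → x < y
    sides o a b x∈ y∈ = <-trans (proj₂ (word-bounds s o a x∈)) (proj₁ (word-bounds s _ b y∈))

  word-unique : ∀ o t → Unique (word s o t)
  word-unique o leaf       = []
  word-unique o (node a b) =
    All.tabulate (λ x∈ → [ (λ x∈ → ℕ.>⇒≢ (proj₂ (word-bounds s o a x∈)))
                         , (λ x∈ → ℕ.<⇒≢ (proj₁ (word-bounds s _ b x∈))) ]′ (∈-arrange⁻ s x∈))
    ∷ arrange-unique s (word-unique o a) (word-unique _ b) (sides o a b)

  word-avoids : ∀ o t → AllTriples (Not (ShapeOrder s)) (word s o t)
  word-avoids o leaf       = []
  word-avoids o (node a b) =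
    arrange-pairs s (proj₂ ∘ word-bounds s o a) (proj₁ ∘ word-bounds s _ b)
    ∷ arrange-triples⁺ s (word-avoids o a) (word-avoids _ b) (sides o a b)

  word-arrangement : ∀ o t → Arrangement o (size t) (word s o t)
  word-arrangement o t = word-unique o t , word-bounds s o t , word-onto s o t

  -- The first letter gives the size of the left subtree and the length then that of the right one,
  -- so the cut between the blocks is at the same place in both words.
  word-injective : ∀ o {t t′} → word s o t ≡ word s o t′ → t ≡ t′
  word-injective o {leaf}     {leaf}       _  = refl
  word-injective o {node a b} {node a′ b′} eq = cong₂ node
    (word-injective o (proj₁ parts))
    (word-injective (suc (o + size a)) (trans (proj₂ parts) (cong (λ i → word s (suc (o + i)) b′) (sym sa))))
    where
    sa : size a ≡ size a′
    sa = ℕ.+-cancelˡ-≡ o _ _ (List.∷-injectiveˡ eq)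
    sb : size b ≡ size b′
    sb = ℕ.+-cancelˡ-≡ (size a) _ _ (trans (suc-injective
      (trans (sym (length-word s o (node a b))) (trans (cong length eq) (length-word s o (node a′ b′)))))
      (cong (_+ size b′) (sym sa)))
    parts : word s o a ≡ word s o a′ × word s (suc (o + size a)) b ≡ word s (suc (o + size a′)) b′
    parts = arrange-injective s (word s o a) (word s o a′)
      (trans (length-word s o a) (trans sa (sym (length-word s o a′))))
      (trans (length-word s _ b) (trans sb (sym (length-word s _ b′)))) (List.∷-injectiveʳ eq)

  private
    -- The blocks found by `unarrange` are not structural parts of the word, so f bounds the depth
    -- of the recursion.
    treeOf : ∀ f {o n xs} → n ≤ f → Arrangement o n xs → AllTriples (Not (ShapeOrder s)) xs →
             ∃ λ t → size t ≡ n × word s o t ≡ xs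
    treeOf f {n = zero} {xs = []} _ _ _ = leaf , refl , refl
    treeOf f {o} {suc n} {[]} _ (_ , _ , all∈) _ with () ← all∈ ≤-refl (ℕ.m<m+n o (s≤s z≤n))
    treeOf f {o} {n} {k ∷ zs} n≤f (k∉ ∷ zs! , bounds , all∈) (p ∷ ps)
      -- The first letter is o + i and n = i + 1 + j: there are i smaller and j larger letters.
      with i , refl ← ℕ.m≤n⇒∃[o]m+o≡n (proj₁ (bounds (here refl)))
      with j , refl ← ℕ.m≤n⇒∃[o]m+o≡n (ℕ.+-cancelˡ-< o i n (proj₂ (bounds (here refl))))
      with xs , ys , refl , xs<k , k<ys ← unarrange s zs p k∉
      with f | n≤f
    ... | suc f | s≤s i+j≤f =
      let xs! , ys! = arrange-unique⁻ s xs ys zs!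
          pxs , pys = arrange-triples⁻ s xs ys ps
          a , sa , wa = treeOf f (≤-trans (ℕ.m≤m+n i j) i+j≤f) (xs! , boundsˡ , ontoˡ) pxs
          b , sb , wb = treeOf f (≤-trans (ℕ.m≤n+m j i) i+j≤f) (ys! , boundsʳ , ontoʳ) pys
      in node a b , cong suc (cong₂ _+_ sa sb) ,
         cong₂ _∷_ (cong (o +_) sa) (cong₂ (arrange s) wa
           (trans (cong (λ m → word s (suc (o + m)) b) sa) wb))
      where
      boundsˡ : ∀ {x} → x ∈ xs → o ≤ x × x < o + i
      boundsˡ x∈ = proj₁ (bounds (there (∈-arrange⁺ˡ s x∈))) , All.lookup xs<k x∈
      boundsʳ : ∀ {y} → y ∈ ys → suc (o + i) ≤ y × y < suc (o + i) + j
      boundsʳ {y} y∈ = All.lookup k<ys y∈ ,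
        subst (y <_) (sym (shift o i j)) (proj₂ (bounds (there (∈-arrange⁺ʳ s y∈))))
      ontoˡ : ∀ {x} → o ≤ x → x < o + i → x ∈ xs
      ontoˡ o≤x x<k with all∈ o≤x (≤-trans x<k (ℕ.+-monoʳ-≤ o (m≤n⇒m≤1+n (ℕ.m≤m+n i j))))
      ... | here refl = contradiction x<k (<-irrefl refl)
      ... | there x∈ with ∈-arrange⁻ s x∈
      ...   | inj₁ x∈xs = x∈xs
      ...   | inj₂ x∈ys = contradiction x<k (<-asym (All.lookup k<ys x∈ys))
      ontoʳ : ∀ {y} → suc (o + i) ≤ y → y < suc (o + i) + j → y ∈ ys
      ontoʳ {y} k<y y<n with all∈ (≤-trans (ℕ.m≤m+n o i) (ℕ.<⇒≤ k<y)) (subst (y <_) (shift o i j) y<n)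
      ... | here refl = contradiction k<y (<-irrefl refl)
      ... | there y∈ with ∈-arrange⁻ s y∈
      ...   | inj₁ y∈xs = contradiction k<y (<-asym (All.lookup xs<k y∈xs))
      ...   | inj₂ y∈ys = y∈ys

  words-of-trees-unique : ∀ n → Unique (map (word s 1) (trees n))
  words-of-trees-unique n = Unique.map⁺ (word-injective 1) (treesUpTo-unique n n)

  words-of-trees-sound : ∀ {n xs} → xs ∈ map (word s 1) (trees n) →
                         Arrangement 1 n xs × AllTriples (Not (ShapeOrder s)) xs
  words-of-trees-sound {n} xs∈ with t , t∈ , refl ← ∈-map⁻ (word s 1) xs∈
                               with refl ← ∈-treesUpTo⁻ n n t∈ = word-arrangement 1 t , word-avoids 1 t

  words-of-trees-complete : ∀ {n xs} → Arrangement 1 n xs → AllTriples (Not (ShapeOrder s)) xs →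
                            xs ∈ map (word s 1) (trees n)
  words-of-trees-complete arr av with t , refl , refl ← treeOf _ ≤-refl arr av = ∈-map⁺ (word s 1) (∈-trees⁺ t)

-- Statistics of words

indicator : ∀ {P : Set} → Dec P → ℕ
indicator (yes _) = 1
indicator (no  _) = 0

indicator-cong : ∀ {P Q : Set} (p? : Dec P) (q? : Dec Q) → (P → Q) → (Q → P) → indicator p? ≡ indicator q?
indicator-cong (yes p) (yes q) _   _    = refl
indicator-cong (yes p) (no ¬q) to  _    = contradiction (to p) ¬q
indicator-cong (no ¬p) (yes q) _   from = contradiction (from q) ¬p
indicator-cong (no ¬p) (no ¬q) _   _    = refl

indicator-no : ∀ {P : Set} (p? : Dec P) → ¬ P → indicator p? ≡ 0
indicator-no (yes p) ¬p = contradiction p ¬p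
indicator-no (no _)  _  = refl

indicator-yes : ∀ {P : Set} (p? : Dec P) → P → indicator p? ≡ 1
indicator-yes (yes _) _ = refl
indicator-yes (no ¬p) p = contradiction p ¬p

tally : (ℕ → ℕ) → ℕ → ℕ
tally f zero    = 0
tally f (suc n) = f 0 + tally (f ∘ suc) n

tally-cong : ∀ {f g} n → (∀ i → f i ≡ g i) → tally f n ≡ tally g n
tally-cong zero    p = refl
tally-cong (suc n) p = cong₂ _+_ (p 0) (tally-cong n (p ∘ suc))

tally₂ : (ℕ → ℕ → ℕ) → ℕ → ℕ
tally₂ f n = tally (λ i → tally (f i) n) n

tally₂-cong : ∀ {f g} n → (∀ i j → f i j ≡ g i j) → tally₂ f n ≡ tally₂ g n
tally₂-cong n p = tally-cong n λ i → tally-cong n (p i)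

-- In the pairs counted here the second position comes strictly after the first, so the column 0
-- vanishes and what remains separates the first letter from the rest of the word.
tally₂-suc : ∀ f n → (∀ i → f i 0 ≡ 0) →
             tally₂ f (suc n) ≡ tally (f 0 ∘ suc) n + tally₂ (λ i j → f (suc i) (suc j)) n
tally₂-suc f n f0 = cong₂ _+_ (cong (_+ tally (f 0 ∘ suc) n) (f0 0))
  (tally-cong n λ i → cong (_+ tally (f (suc i) ∘ suc) n) (f0 (suc i)))

module _ {A : Set} where

  # : {P : A → Set} → Decidable P → List A → ℕ
  # P? xs = length (filter P? xs)

  module _ {P : A → Set} (P? : Decidable P) where

    #-∷ : ∀ x xs → # P? (x ∷ xs) ≡ indicator (P? x) + # P? xs
    #-∷ x xs with P? x
    ... | yes _ = refl
    ... | no  _ = refl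

    #-++ : ∀ xs ys → # P? (xs ++ ys) ≡ # P? xs + # P? ys
    #-++ xs ys = trans (cong length (List.filter-++ P? xs ys)) (List.length-++ (filter P? xs))

    #-none : ∀ {xs} → All (¬_ ∘ P) xs → # P? xs ≡ 0
    #-none ¬ps = cong length (List.filter-none P? ¬ps)

    #-all : ∀ {xs} → All P xs → # P? xs ≡ length xs
    #-all ps = cong length (List.filter-all P? ps)

    #-applyUpTo : ∀ (f : ℕ → A) n → # P? (applyUpTo f n) ≡ tally (indicator ∘ P? ∘ f) n
    #-applyUpTo f zero    = refl
    #-applyUpTo f (suc n) = trans (#-∷ (f 0) _) (cong (_ +_) (#-applyUpTo (f ∘ suc) n))

  #-map : ∀ {B : Set} {P : A → Set} (P? : Decidable P) (f : B → A) xs →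
          # P? (map f xs) ≡ length (filter (P? ∘ f) xs)
  #-map P? f []       = refl
  #-map P? f (x ∷ xs) with P? (f x)
  ... | yes _ = cong suc (#-map P? f xs)
  ... | no  _ = #-map P? f xs

  #-cong : ∀ {P Q : A → Set} (P? : Decidable P) (Q? : Decidable Q) {xs} →
           All (λ x → (P x → Q x) × (Q x → P x)) xs → # P? xs ≡ # Q? xs
  #-cong P? Q? []                           = refl
  #-cong P? Q? {x ∷ xs} ((to , from) ∷ ps) = trans (#-∷ P? x xs) (trans
    (cong₂ _+_ (indicator-cong (P? x) (Q? x) to from) (#-cong P? Q? ps)) (sym (#-∷ Q? x xs)))

[1⋯]≡applyUpTo : ∀ n → [1⋯ n ] ≡ applyUpTo suc n
[1⋯]≡applyUpTo n = List.map-applyUpTo id suc n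

count≡tally : ∀ n {P : ℕ → Set} (P? : Decidable P) → count n P? ≡ tally (λ i → indicator (P? (suc i))) n
count≡tally n P? = trans (cong (# P?) ([1⋯]≡applyUpTo n)) (#-applyUpTo P? suc n)

count₂≡tally₂ : ∀ n {P : ℕ → ℕ → Set} (P? : ∀ i j → Dec (P i j)) →
                count₂ n P? ≡ tally₂ (λ i j → indicator (P? (suc i) (suc j))) n
count₂≡tally₂ n P? rewrite [1⋯]≡applyUpTo n = rows suc n
  where
  rows : ∀ f m → # (uncurry P?) (cartesianProduct (applyUpTo f m) (applyUpTo suc n)) ≡
                 tally (λ i → tally (λ j → indicator (P? (f i) (suc j))) n) m
  rows f zero    = refl
  rows f (suc m) = trans (#-++ (uncurry P?) (map (f 0 ,_) (applyUpTo suc n)) _)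
    (cong₂ _+_ (trans (#-map (uncurry P?) (f 0 ,_) (applyUpTo suc n)) (#-applyUpTo (P? (f 0)) suc n))
               (rows (f ∘ suc) m))

-- The default 0 past the end matches the convention π(n + 1) = 0.
nth : List ℕ → ℕ → ℕ
nth []       _       = 0
nth (x ∷ xs) zero    = x
nth (x ∷ xs) (suc i) = nth xs i

at≡nth : ∀ {n} (π : Word n) i → π at suc i ≡ nth (oneLine π) i
at≡nth {n} π i with i <? n
... | yes i<n = inside π i<n
  where
  inside : ∀ {m k i} (v : Vec (Fin m) k) (i<k : i < k) → suc (toℕ (lookup v (fromℕ< i<k))) ≡ nth (oneLine v) i
  inside {i = zero}  (x ∷ v) _         = refl
  inside {i = suc i} (x ∷ v) (s≤s i<k) = inside v i<k
... | no i≮n = outside π i≮n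
  where
  outside : ∀ {m k i} (v : Vec (Fin m) k) → ¬ i < k → 0 ≡ nth (oneLine v) i
  outside             []      _   = refl
  outside {i = zero}  (x ∷ v) i≮k = contradiction (s≤s z≤n) i≮k
  outside {i = suc i} (x ∷ v) i≮k = outside v (i≮k ∘ s≤s)

length-oneLine : ∀ {m k} (v : Vec (Fin m) k) → length (oneLine v) ≡ k
length-oneLine []      = refl
length-oneLine (x ∷ v) = cong suc (length-oneLine v)

tally-nth : ∀ {P : ℕ → Set} (P? : Decidable P) xs →
            tally (λ j → indicator (P? (nth xs j))) (length xs) ≡ # P? xs
tally-nth P? []       = refl
tally-nth P? (x ∷ xs) = trans (cong (_ +_) (tally-nth P? xs)) (sym (#-∷ P? x xs))

weakExcedances : ℕ → List ℕ → ℕ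
weakExcedances i []       = 0
weakExcedances i (x ∷ xs) = indicator (i ≤? x) + weakExcedances (suc i) xs

inversions : List ℕ → ℕ
inversions []       = 0
inversions (x ∷ xs) = # (_<? x) xs + inversions xs

listDescents : List ℕ → ℕ
listDescents []           = 0
listDescents (x ∷ [])     = 0
listDescents (x ∷ y ∷ xs) = indicator (y <? x) + listDescents (y ∷ xs)

tally-weakExcedances : ∀ i xs → tally (λ j → indicator (i + j ≤? nth xs j)) (length xs) ≡ weakExcedances i xs
tally-weakExcedances i []       = refl
tally-weakExcedances i (x ∷ xs) = cong₂ _+_
  (indicator-cong (i + 0 ≤? x) (i ≤? x) (subst (_≤ x) (ℕ.+-identityʳ i)) (subst (_≤ x) (sym (ℕ.+-identityʳ i))))
  (trans (tally-cong (length xs) λ j → indicator-cong (i + suc j ≤? nth xs j) (suc i + j ≤? nth xs j)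
           (subst (_≤ nth xs j) (ℕ.+-suc i j)) (subst (_≤ nth xs j) (sym (ℕ.+-suc i j))))
         (tally-weakExcedances (suc i) xs))

inversion? : ∀ xs i j → Dec (i < j × nth xs j < nth xs i)
inversion? xs i j = (i <? j) ×-dec (nth xs j <? nth xs i)

tally-inversions : ∀ xs → tally₂ (λ i j → indicator (inversion? xs i j)) (length xs) ≡ inversions xs
tally-inversions []       = refl
tally-inversions (x ∷ xs) = trans
  (tally₂-suc (λ i j → indicator (inversion? (x ∷ xs) i j)) (length xs)
    λ i → indicator-no (inversion? (x ∷ xs) i 0) λ ())
  (cong₂ _+_
    (trans (tally-cong (length xs) λ j →
             indicator-cong (inversion? (x ∷ xs) 0 (suc j)) (nth xs j <? x) proj₂ (s≤s z≤n ,_))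
           (tally-nth (_<? x) xs))
    (trans (tally₂-cong (length xs) λ i j →
             indicator-cong (inversion? (x ∷ xs) (suc i) (suc j)) (inversion? xs i j) (map₁ ℕ.≤-pred) (map₁ s≤s))
           (tally-inversions xs)))

tally-descents : ∀ xs →
  tally (λ i → indicator ((suc i <? length xs) ×-dec (nth xs (suc i) <? nth xs i))) (length xs) ≡ listDescents xs
tally-descents []           = refl
tally-descents (x ∷ [])     = refl
tally-descents (x ∷ y ∷ xs) = cong₂ _+_
  (indicator-cong ((1 <? suc (suc (length xs))) ×-dec (y <? x)) (y <? x) proj₂ (s≤s (s≤s z≤n) ,_))
  (trans (tally-cong (suc (length xs)) λ i → indicator-cong
           ((suc (suc i) <? suc (suc (length xs))) ×-dec (nth (y ∷ xs) (suc i) <? nth (y ∷ xs) i))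
           ((suc i <? suc (length xs)) ×-dec (nth (y ∷ xs) (suc i) <? nth (y ∷ xs) i)) (map₁ ℕ.≤-pred) (map₁ s≤s))
         (tally-descents (y ∷ xs)))

-- For _≺_ = _<_ this counts occurrences of 31-2, for _≺_ = _>_ occurrences of 13-2.
module Vincular (_≺_ : ℕ → ℕ → Set) (_≺?_ : Decidable₂ _≺_) where

  Between : ℕ → ℕ → ℕ → Set
  Between y x z = y ≺ z × z ≺ x

  between? : ∀ y x → Decidable (Between y x)
  between? y x z = (y ≺? z) ×-dec (z ≺? x)

  -- The argument x is the letter just before the list, so that a block can be evaluated in its
  -- context.
  vincular : ℕ → List ℕ → ℕ
  vincular x []       = 0
  vincular x (y ∷ ys) = # (between? y x) ys + vincular y ys

  vincularWord : List ℕ → ℕ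
  vincularWord []       = 0
  vincularWord (x ∷ xs) = vincular x xs

  occurrence? : ∀ xs i j → Dec (suc i < j × Between (nth xs (suc i)) (nth xs i) (nth xs j))
  occurrence? xs i j = (suc i <? j) ×-dec between? (nth xs (suc i)) (nth xs i) (nth xs j)

  tally-vincular : ∀ xs → tally₂ (λ i j → indicator (occurrence? xs i j)) (length xs) ≡ vincularWord xs
  tally-vincular []       = refl
  tally-vincular (x ∷ []) = trans (ℕ.+-identityʳ _) (trans (ℕ.+-identityʳ _)
    (indicator-no (occurrence? (x ∷ []) 0 0) λ ()))
  tally-vincular (x ∷ y ∷ xs) = trans
    (tally₂-suc (λ i j → indicator (occurrence? (x ∷ y ∷ xs) i j)) (suc (length xs)) λ i → indicator-no (occurrence? (x ∷ y ∷ xs) i 0) λ ())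
    (cong₂ _+_
      (trans (cong (_+ tally (λ j → indicator (occurrence? (x ∷ y ∷ xs) 0 (suc (suc j)))) (length xs))
                   (indicator-no (occurrence? (x ∷ y ∷ xs) 0 1) λ { (s≤s () , _) }))
      (trans (tally-cong (length xs) λ j → indicator-cong (occurrence? (x ∷ y ∷ xs) 0 (suc (suc j)))
               (between? y x (nth xs j)) proj₂ (s≤s (s≤s z≤n) ,_))
             (tally-nth (between? y x) xs)))
      (trans (tally₂-cong (suc (length xs)) λ i j → indicator-cong (occurrence? (x ∷ y ∷ xs) (suc i) (suc j))
               (occurrence? (y ∷ xs) i j) (map₁ ℕ.≤-pred) (map₁ s≤s))
             (tally-vincular (y ∷ xs))))

  module _ (≺-trans : Transitive _≺_) (≺-asym : Asymmetric _≺_) where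

    -- The letters of `vs` are too large to lie below the larger letter of any adjacent pair before
    -- them, and the pair entering `vs` encloses nothing. Hence the true predecessor of `vs` may be
    -- replaced by any k below `vs`.
    vincular-++-≺ : ∀ k x us vs → (∀ {v} → v ∈ vs → k ≺ v) → (∀ {v} → v ∈ vs → x ≺ v) →
      (∀ {u v} → u ∈ us → v ∈ vs → u ≺ v) → vincular x (us ++ vs) ≡ vincular x us + vincular k vs
    vincular-++-≺ k x [] [] k≺ x≺ us≺ = refl
    vincular-++-≺ k x [] (v ∷ vs) k≺ x≺ us≺ = cong (_+ vincular v vs) (trans
      (#-none (between? v x) (All.tabulate λ z∈ (_ , z≺x) → ≺-asym z≺x (x≺ (there z∈))))
      (sym (#-none (between? v k) (All.tabulate λ z∈ (_ , z≺k) → ≺-asym z≺k (k≺ (there z∈))))))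
    vincular-++-≺ k x (u ∷ us) vs k≺ x≺ us≺ = trans (cong₂ _+_
        (trans (#-++ (between? u x) us vs) (trans
          (cong (# (between? u x) us +_) (#-none (between? u x) (All.tabulate λ z∈ (_ , z≺x) → ≺-asym z≺x (x≺ z∈))))
          (ℕ.+-identityʳ _)))
        (vincular-++-≺ k u us vs k≺ (us≺ (here refl)) (us≺ ∘ there)))
      (sym (ℕ.+-assoc (# (between? u x) us) _ _))

    -- The pair entering `vs` may enclose letters, but they are just those of `vs` above its first
    -- letter, whichever letter above all of `vs` precedes it; so k may stand for the true
    -- predecessor.
    vincular-++-≻ : ∀ k x us vs → (∀ {v} → v ∈ vs → v ≺ k) → (∀ {v} → v ∈ vs → v ≺ x) →
      (∀ {u v} → u ∈ us → v ∈ vs → v ≺ u) → vincular x (us ++ vs) ≡ vincular x us + vincular k vs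
    vincular-++-≻ k x [] [] ≺k ≺x ≺us = refl
    vincular-++-≻ k x [] (v ∷ vs) ≺k ≺x ≺us = cong (_+ vincular v vs)
      (#-cong (between? v x) (between? v k) (All.tabulate λ z∈ →
        (λ (v≺z , _) → v≺z , ≺k (there z∈)) , (λ (v≺z , _) → v≺z , ≺x (there z∈))))
    vincular-++-≻ k x (u ∷ us) vs ≺k ≺x ≺us = trans (cong₂ _+_
        (trans (#-++ (between? u x) us vs) (trans
          (cong (# (between? u x) us +_)
            (#-none (between? u x) (All.tabulate λ z∈ (u≺z , _) → ≺-asym u≺z (≺us (here refl) z∈))))
          (ℕ.+-identityʳ _)))
        (vincular-++-≻ k u us vs ≺k (≺us (here refl)) (≺us ∘ there)))
      (sym (ℕ.+-assoc (# (between? u x) us) _ _))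

    -- The order of the two blocks is left open, which treats both shapes together. For the reversed
    -- order on letters the blocks exchange their roles, and the same word encodes the mirrored
    -- tree.
    data Encodes : Tree → List ℕ → Set where
      leaf : Encodes leaf []
      node : ∀ {a b k xs ys} zs → zs ≡ xs ++ ys ⊎ zs ≡ ys ++ xs → Encodes a xs → Encodes b ys →
             (∀ {x} → x ∈ xs → x ≺ k) → (∀ {y} → y ∈ ys → k ≺ y) → Encodes (node a b) (k ∷ zs)

    Encodes-length : ∀ {t xs} → Encodes t xs → length xs ≡ size t
    Encodes-length leaf = refl
    Encodes-length (node {xs = xs} {ys} _ (inj₁ refl) ea eb _ _) =
      cong suc (trans (List.length-++ xs) (cong₂ _+_ (Encodes-length ea) (Encodes-length eb)))
    Encodes-length (node {xs = xs} {ys} _ (inj₂ refl) ea eb _ _) =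
      cong suc (trans (List.length-++ ys) (trans (ℕ.+-comm (length ys) (length xs))
        (cong₂ _+_ (Encodes-length ea) (Encodes-length eb))))

    mutual
      vincular-node : ∀ {t k xs} → Encodes t (k ∷ xs) → vincular k xs ≡ low t
      vincular-node {k = k} (node {xs = xs} {ys} _ (inj₁ refl) ea eb xs≺k k≺ys) = trans
        (vincular-++-≺ k k xs ys k≺ys k≺ys λ x∈ y∈ → ≺-trans (xs≺k x∈) (k≺ys y∈))
        (cong₂ _+_ (vincular-top ea xs≺k) (vincular-low eb k≺ys))
      vincular-node {k = k} (node {a} {b} {xs = xs} {ys} _ (inj₂ refl) ea eb xs≺k k≺ys) = trans
        (vincular-++-≻ k k ys xs xs≺k xs≺k λ y∈ x∈ → ≺-trans (xs≺k x∈) (k≺ys y∈))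
        (trans (cong₂ _+_ (vincular-low eb k≺ys) (vincular-top ea xs≺k)) (ℕ.+-comm (low b) (top a)))

      vincular-low : ∀ {t x xs} → Encodes t xs → (∀ {y} → y ∈ xs → x ≺ y) → vincular x xs ≡ low t
      vincular-low leaf                           x≺ = refl
      vincular-low {x = x} e@(node {k = k} zs _ _ _ _ _) x≺ = trans
        (cong (_+ vincular k zs) (#-none (between? k x) (All.tabulate λ z∈ (_ , z≺x) → ≺-asym z≺x (x≺ (there z∈)))))
        (vincular-node e)
  
      vincular-top : ∀ {t x xs} → Encodes t xs → (∀ {y} → y ∈ xs → y ≺ x) → vincular x xs ≡ top t
      vincular-top leaf                           ≺x = refl
      vincular-top {node a b} {x} e@(node {k = k} {xs} {ys} zs split ea eb xs≺k k≺ys) ≺x =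
        cong₂ _+_ (between-k split) (vincular-node e)
        where
        #xs : # (between? k x) xs ≡ 0
        #xs = #-none (between? k x) (All.tabulate λ z∈ (k≺z , _) → ≺-asym k≺z (xs≺k z∈))
        #ys : (∀ {y} → y ∈ ys → y ≺ x) → # (between? k x) ys ≡ size b
        #ys ys≺x = trans (#-all (between? k x) (All.tabulate λ z∈ → k≺ys z∈ , ys≺x z∈)) (Encodes-length eb)
        between-k : zs ≡ xs ++ ys ⊎ zs ≡ ys ++ xs → # (between? k x) zs ≡ size b
        between-k (inj₁ refl) = trans (#-++ (between? k x) xs ys)
          (cong₂ _+_ #xs (#ys (≺x ∘ there ∘ ∈-++⁺ʳ xs)))
        between-k (inj₂ refl) = trans (#-++ (between? k x) ys xs)
          (trans (cong₂ _+_ (#ys (≺x ∘ there ∘ ∈-++⁺ˡ)) #xs) (ℕ.+-identityʳ _))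

    vincularWord-low : ∀ {t xs} → Encodes t xs → vincularWord xs ≡ low t
    vincularWord-low leaf               = refl
    vincularWord-low e@(node _ _ _ _ _ _) = vincular-node e

module V< = Vincular _<_ _<?_
module V> = Vincular _>_ _>?_

module _ {n : ℕ} (π : Word n) where

  private
    xs = oneLine π

    atLength : ∀ {A : Set} (f : ℕ → A) {y} → f (length xs) ≡ y → f n ≡ y
    atLength f = subst (λ m → f m ≡ _) (length-oneLine π)

  at-next : ∀ i → π at (suc i + 1) ≡ nth xs (suc i)
  at-next i = trans (cong (λ j → π at suc j) (ℕ.+-comm i 1)) (at≡nth π (suc i))

  private
    to< : ∀ {a b c d} → a ≡ c → b ≡ d → a < b → c < d
    to< = subst₂ _<_
    from< : ∀ {a b c d} → a ≡ c → b ≡ d → c < d → a < b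
    from< p q = subst₂ _<_ (sym p) (sym q)

  wex≡ : wex π ≡ weakExcedances 1 xs
  wex≡ = trans (count≡tally n λ i → i ≤? π at i) (trans
    (tally-cong n λ i → indicator-cong (suc i ≤? π at suc i) (1 + i ≤? nth xs i)
      (subst (suc i ≤_) (at≡nth π i)) (subst (suc i ≤_) (sym (at≡nth π i))))
    (atLength (tally λ i → indicator (1 + i ≤? nth xs i)) (tally-weakExcedances 1 xs)))

  inv≡ : inv π ≡ inversions xs
  inv≡ = trans (count₂≡tally₂ n λ i j → (i <? j) ×-dec (π at j <? π at i)) (trans
    (tally₂-cong n λ i j → indicator-cong ((suc i <? suc j) ×-dec (π at suc j <? π at suc i)) (inversion? xs i j)
      (λ (i<j , πj<πi) → ℕ.≤-pred i<j , to< (at≡nth π j) (at≡nth π i) πj<πi)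
      (λ (i<j , πj<πi) → s≤s i<j , from< (at≡nth π j) (at≡nth π i) πj<πi))
    (atLength (tally₂ λ i j → indicator (inversion? xs i j)) (tally-inversions xs)))

  des≡ : des π ≡ listDescents xs
  des≡ = trans (count≡tally n λ i → (i <? n) ×-dec (π at (i + 1) <? π at i)) (trans
    (tally-cong n λ i → indicator-cong ((suc i <? n) ×-dec (π at (suc i + 1) <? π at suc i))
                                       ((suc i <? n) ×-dec (nth xs (suc i) <? nth xs i))
      (λ (i<n , π<π) → i<n , to< (at-next i) (at≡nth π i) π<π)
      (λ (i<n , π<π) → i<n , from< (at-next i) (at≡nth π i) π<π))
    (atLength (λ m → tally (λ i → indicator ((suc i <? m) ×-dec (nth xs (suc i) <? nth xs i))) m) (tally-descents xs)))

  private
    pred< : ∀ {i j} → suc i + 1 < suc j → suc i < j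
    pred< {i} {j} (s≤s i+1<j) = subst (_< j) (ℕ.+-comm i 1) i+1<j
    suc< : ∀ {i j} → suc i < j → suc i + 1 < suc j
    suc< {i} {j} i+1<j = s≤s (subst (_< j) (ℕ.+-comm 1 i) i+1<j)

  31-2≡ : 31-2 π ≡ V<.vincularWord xs
  31-2≡ = trans
    (count₂≡tally₂ n λ i j → (i + 1 <? j) ×-dec (π at (i + 1) <? π at j) ×-dec (π at j <? π at i)) (trans
    (tally₂-cong n λ i j → indicator-cong
      ((suc i + 1 <? suc j) ×-dec (π at (suc i + 1) <? π at suc j) ×-dec (π at suc j <? π at suc i))
      (V<.occurrence? xs i j)
      (λ (i+1<j , p , r) → pred< i+1<j , to< (at-next i) (at≡nth π j) p , to< (at≡nth π j) (at≡nth π i) r)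
      (λ (i+1<j , p , r) → suc< i+1<j , from< (at-next i) (at≡nth π j) p , from< (at≡nth π j) (at≡nth π i) r))
    (atLength (tally₂ λ i j → indicator (V<.occurrence? xs i j)) (V<.tally-vincular xs)))

  13-2≡ : 13-2 π ≡ V>.vincularWord xs
  13-2≡ = trans
    (count₂≡tally₂ n λ i j → (i + 1 <? j) ×-dec (π at i <? π at j) ×-dec (π at j <? π at (i + 1))) (trans
    (tally₂-cong n λ i j → indicator-cong
      ((suc i + 1 <? suc j) ×-dec (π at suc i <? π at suc j) ×-dec (π at suc j <? π at (suc i + 1)))
      (V>.occurrence? xs i j)
      (λ (i+1<j , p , r) → pred< i+1<j , to< (at≡nth π j) (at-next i) r , to< (at≡nth π i) (at≡nth π j) p)
      (λ (i+1<j , r , p) → suc< i+1<j , from< (at≡nth π i) (at≡nth π j) p , from< (at≡nth π j) (at-next i) r))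
    (atLength (tally₂ λ i j → indicator (V>.occurrence? xs i j)) (V>.tally-vincular xs)))

module _ (s : Shape) where

  word-encodes : ∀ o t → V<.Encodes <-trans <-asym t (word s o t)
  word-encodes o leaf       = V<.leaf
  word-encodes o (node a b) = V<.node _ (split s) (word-encodes o a) (word-encodes _ b)
    (proj₂ ∘ word-bounds s o a) (proj₁ ∘ word-bounds s _ b)
    where
    split : ∀ s {xs ys} → arrange s xs ys ≡ xs ++ ys ⊎ arrange s xs ys ≡ ys ++ xs
    split s231 = inj₁ refl
    split s213 = inj₂ refl

  word-encodes-mirror : ∀ o t → V>.Encodes (flip <-trans) <-asym (mirror t) (word s o t)
  word-encodes-mirror o leaf       = V>.leaf
  word-encodes-mirror o (node a b) = V>.node _ (split s) (word-encodes-mirror _ b) (word-encodes-mirror o a)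
    (proj₁ ∘ word-bounds s _ b) (proj₂ ∘ word-bounds s o a)
    where
    split : ∀ s {xs ys} → arrange s xs ys ≡ ys ++ xs ⊎ arrange s xs ys ≡ xs ++ ys
    split s231 = inj₂ refl
    split s213 = inj₁ refl

listDescents-++-asc : ∀ xs ys → (∀ {x y} → x ∈ xs → y ∈ ys → x < y) →
                      listDescents (xs ++ ys) ≡ listDescents xs + listDescents ys
listDescents-++-asc []           ys       asc = refl
listDescents-++-asc (x ∷ [])     []       asc = refl
listDescents-++-asc (x ∷ [])     (y ∷ ys) asc =
  cong (_+ listDescents (y ∷ ys)) (indicator-no (y <? x) (<-asym (asc (here refl) (here refl))))
listDescents-++-asc (x ∷ z ∷ xs) ys       asc =
  trans (cong (indicator (z <? x) +_) (listDescents-++-asc (z ∷ xs) ys (asc ∘ there)))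
        (sym (ℕ.+-assoc (indicator (z <? x)) _ _))

listDescents-++-desc : ∀ x xs y ys → (∀ {u v} → u ∈ x ∷ xs → v ∈ y ∷ ys → v < u) →
  listDescents (x ∷ xs ++ y ∷ ys) ≡ suc (listDescents (x ∷ xs) + listDescents (y ∷ ys))
listDescents-++-desc x []       y ys desc =
  cong (_+ listDescents (y ∷ ys)) (indicator-yes (y <? x) (desc (here refl) (here refl)))
listDescents-++-desc x (z ∷ xs) y ys desc =
  trans (cong (indicator (z <? x) +_) (listDescents-++-desc z xs y ys (desc ∘ there)))
  (trans (ℕ.+-suc (indicator (z <? x)) _) (cong suc (sym (ℕ.+-assoc (indicator (z <? x)) _ _))))

listDescents-word : ∀ s o t → listDescents (word s o t) ≡ descents t
listDescents-word s o leaf = refl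
listDescents-word s231 o (node a b) = begin
  listDescents ((k ∷ xs) ++ ys)             ≡⟨ listDescents-++-asc (k ∷ xs) ys asc ⟩
  listDescents (k ∷ xs) + listDescents ys   ≡⟨ cong₂ _+_ (first a) (listDescents-word s231 _ b) ⟩
  nonEmpty a + descents a + descents b      ≡⟨ ℕ.+-assoc (nonEmpty a) _ _ ⟩
  nonEmpty a + (descents a + descents b)    ∎
  where
  open ≡-Reasoning
  k  = o + size a
  xs = word s231 o a
  ys = word s231 (suc k) b
  asc : ∀ {x y} → x ∈ k ∷ xs → y ∈ ys → x < y
  asc (here refl) y∈ = proj₁ (word-bounds s231 _ b y∈)
  asc (there x∈)  y∈ = <-trans (proj₂ (word-bounds s231 o a x∈)) (proj₁ (word-bounds s231 _ b y∈))
  first : ∀ a → listDescents (o + size a ∷ word s231 o a) ≡ nonEmpty a + descents a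
  first leaf         = refl
  first (node a₁ a₂) = cong₂ _+_ (indicator-yes (_ <? _) (proj₂ (word-bounds s231 o (node a₁ a₂) (here refl))))
                                 (listDescents-word s231 o (node a₁ a₂))
listDescents-word s213 o (node a b) = begin
  listDescents (k ∷ ys ++ word s213 o a)     ≡⟨ last a refl ⟩
  nonEmpty a + (descents a + listDescents (k ∷ ys))  ≡⟨ cong (λ d → nonEmpty a + (descents a + d)) tail-descents ⟩
  nonEmpty a + (descents a + descents b)     ∎
  where
  open ≡-Reasoning
  k  = o + size a
  ys = word s213 (suc k) b
  k<ys : ∀ {y} → y ∈ ys → k < y
  k<ys = proj₁ ∘ word-bounds s213 _ b
  tail-descents : listDescents (k ∷ ys) ≡ descents b
  tail-descents = trans (listDescents-++-asc (k ∷ []) ys λ { (here refl) → k<ys }) (listDescents-word s213 _ b)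
  last : ∀ a′ → a′ ≡ a → listDescents (k ∷ ys ++ word s213 o a′) ≡ nonEmpty a′ + (descents a′ + listDescents (k ∷ ys))
  last leaf refl = cong (λ zs → listDescents (k ∷ zs)) (List.++-identityʳ ys)
  last a′@(node a₁ a₂) refl = trans (listDescents-++-desc k ys _ _ desc)
    (cong suc (trans (ℕ.+-comm (listDescents (k ∷ ys)) _)
                     (cong (_+ listDescents (k ∷ ys)) (listDescents-word s213 o a′))))
    where
    desc : ∀ {u v} → u ∈ k ∷ ys → v ∈ word s213 o a′ → v < u
    desc (here refl) v∈ = proj₂ (word-bounds s213 o a′ v∈)
    desc (there u∈)  v∈ = <-trans (proj₂ (word-bounds s213 o a′ v∈)) (k<ys u∈)

-- Reversal-complementation and admissible inversions

#-bijection : ∀ {A : Set} {P Q : A → Set} (P? : Decidable P) (Q? : Decidable Q) xs → Unique xs → (f g : A → A) →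
  (∀ {x} → x ∈ xs → P x → f x ∈ xs × Q (f x) × g (f x) ≡ x) →
  (∀ {x} → x ∈ xs → Q x → g x ∈ xs × P (g x) × f (g x) ≡ x) → # P? xs ≡ # Q? xs
#-bijection {A} P? Q? xs xs! f g to from = trans (sym (List.length-map f (filter P? xs)))
  (↭-length (unique∧set⇒↭ (injective-on (filter P? xs) retract (Unique.filter⁺ P? xs!)) (Unique.filter⁺ Q? xs!) ⊆ ⊇))
  where
  retract : ∀ {x} → x ∈ filter P? xs → g (f x) ≡ x
  retract x∈ = let x∈xs , px = ∈-filter⁻ P? {xs = xs} x∈ in proj₂ (proj₂ (to x∈xs px))
  injective-on : ∀ ys → (∀ {y} → y ∈ ys → g (f y) ≡ y) → Unique ys → Unique (map f ys)
  injective-on ys gf ys! = AllPairs.map⁺ (distinct ys gf ys!)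
    where
    distinct : ∀ ys → (∀ {y} → y ∈ ys → g (f y) ≡ y) → Unique ys → AllPairs (λ x y → f x ≢ f y) ys
    distinct []       gf []         = []
    distinct (y ∷ ys) gf (y∉ ∷ ys!) =
      All.tabulate (λ z∈ fy≡fz → All.lookup y∉ z∈ (trans (sym (gf (here refl))) (trans (cong g fy≡fz) (gf (there z∈)))))
      ∷ distinct ys (gf ∘ there) ys!
  ⊆ : ∀ {y} → y ∈ map f (filter P? xs) → y ∈ filter Q? xs
  ⊆ y∈ with x , x∈ , refl ← ∈-map⁻ f y∈ with x∈xs , px ← ∈-filter⁻ P? {xs = xs} x∈ =
    let fx∈ , qfx , _ = to x∈xs px in ∈-filter⁺ Q? fx∈ qfx
  ⊇ : ∀ {y} → y ∈ filter Q? xs → y ∈ map f (filter P? xs)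
  ⊇ y∈ with y∈xs , qy ← ∈-filter⁻ Q? {xs = xs} y∈ =
    let gy∈ , pgy , fgy≡y = from y∈xs qy
    in subst (_∈ map f (filter P? xs)) fgy≡y (∈-map⁺ f (∈-filter⁺ P? gy∈ pgy))

-- The definitions of the statistics use `i + 1`. Abstracting that position as k allows it to be
-- rewritten to `suc i` inside the decision procedure.
count-suc : ∀ n {P : ℕ → ℕ → Set} (P? : ∀ k i → Dec (P k i)) →
            count n (λ i → P? (i + 1) i) ≡ count n (λ i → P? (suc i) i)
count-suc n P? = trans (count≡tally n (λ i → P? (i + 1) i)) (trans
  (tally-cong n λ i → cong (λ k → indicator (P? k (suc i))) (ℕ.+-comm (suc i) 1))
  (sym (count≡tally n (λ i → P? (suc i) i))))

count₂-suc : ∀ n {P : ℕ → ℕ → ℕ → Set} (P? : ∀ k i j → Dec (P k i j)) →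
             count₂ n (λ i j → P? (i + 1) i j) ≡ count₂ n (λ i j → P? (suc i) i j)
count₂-suc n P? = trans (count₂≡tally₂ n (λ i j → P? (i + 1) i j)) (trans
  (tally₂-cong n λ i j → cong (λ k → indicator (P? k (suc i) (suc j))) (ℕ.+-comm (suc i) 1))
  (sym (count₂≡tally₂ n (λ i j → P? (suc i) i j))))

infix 4 _∈[1⋯_]
_∈[1⋯_] : ℕ → ℕ → Set
i ∈[1⋯ n ] = 1 ≤ i × i ≤ n

∈[1⋯]⁺ : ∀ {i n} → i ∈[1⋯ n ] → i ∈ [1⋯ n ]
∈[1⋯]⁺ {suc i} {n} (_ , i<n) rewrite [1⋯]≡applyUpTo n = ∈-applyUpTo⁺ suc i<n

∈[1⋯]⁻ : ∀ {i n} → i ∈ [1⋯ n ] → i ∈[1⋯ n ]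
∈[1⋯]⁻ {i} {n} i∈ rewrite [1⋯]≡applyUpTo n with j , j<n , refl ← ∈-applyUpTo⁻ suc i∈ = s≤s z≤n , j<n

[1⋯]-unique : ∀ n → Unique [1⋯ n ]
[1⋯]-unique n = Unique.map⁺ suc-injective (Unique.upTo⁺ n)

-- The inverse laws are asked for only at counted positions, since the maps in use involve truncated
-- subtraction.
count-bijection : ∀ n {P Q : ℕ → Set} (P? : Decidable P) (Q? : Decidable Q) (f g : ℕ → ℕ) →
  (∀ i → i ∈[1⋯ n ] → P i → f i ∈[1⋯ n ] × Q (f i) × g (f i) ≡ i) →
  (∀ i → i ∈[1⋯ n ] → Q i → g i ∈[1⋯ n ] × P (g i) × f (g i) ≡ i) → count n P? ≡ count n Q?
count-bijection n P? Q? f g to from = #-bijection P? Q? [1⋯ n ] ([1⋯]-unique n) f g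
  (λ i∈ pi → map₁ ∈[1⋯]⁺ (to _ (∈[1⋯]⁻ i∈) pi)) (λ i∈ qi → map₁ ∈[1⋯]⁺ (from _ (∈[1⋯]⁻ i∈) qi))

count₂-bijection : ∀ n {P Q : ℕ → ℕ → Set} (P? : ∀ i j → Dec (P i j)) (Q? : ∀ i j → Dec (Q i j))
  (f g : ℕ × ℕ → ℕ × ℕ) →
  (∀ i j → i ∈[1⋯ n ] → j ∈[1⋯ n ] → P i j →
    (proj₁ (f (i , j)) ∈[1⋯ n ] × proj₂ (f (i , j)) ∈[1⋯ n ]) × uncurry Q (f (i , j)) × g (f (i , j)) ≡ (i , j)) →
  (∀ i j → i ∈[1⋯ n ] → j ∈[1⋯ n ] → Q i j →
    (proj₁ (g (i , j)) ∈[1⋯ n ] × proj₂ (g (i , j)) ∈[1⋯ n ]) × uncurry P (g (i , j)) × f (g (i , j)) ≡ (i , j)) →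
  count₂ n P? ≡ count₂ n Q?
count₂-bijection n P? Q? f g to from = #-bijection (uncurry P?) (uncurry Q?)
  (cartesianProduct [1⋯ n ] [1⋯ n ]) (Unique.cartesianProduct⁺ ([1⋯]-unique n) ([1⋯]-unique n)) f g
  (λ ij∈ p → let i∈ , j∈ = ∈-cartesianProduct⁻ [1⋯ n ] [1⋯ n ] ij∈ in
     map₁ (λ (i∈ , j∈) → ∈-cartesianProduct⁺ (∈[1⋯]⁺ i∈) (∈[1⋯]⁺ j∈)) (to _ _ (∈[1⋯]⁻ i∈) (∈[1⋯]⁻ j∈) p))
  (λ ij∈ q → let i∈ , j∈ = ∈-cartesianProduct⁻ [1⋯ n ] [1⋯ n ] ij∈ in
     map₁ (λ (i∈ , j∈) → ∈-cartesianProduct⁺ (∈[1⋯]⁺ i∈) (∈[1⋯]⁺ j∈)) (from _ _ (∈[1⋯]⁻ i∈) (∈[1⋯]⁻ j∈) q))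

module _ {n : ℕ} (π : Word n) where

  at≡lookup : ∀ {i} (i<n : i < n) → π at suc i ≡ suc (toℕ (lookup π (fromℕ< i<n)))
  at≡lookup {i} i<n with i <? n
  ... | yes i<n′ = cong (λ p → suc (toℕ (lookup π (fromℕ< p)))) (ℕ.<-irrelevant i<n′ i<n)
  ... | no  i≮n  = contradiction i<n i≮n

  at-end : π at suc n ≡ 0
  at-end with n <? n
  ... | yes n<n = contradiction n<n (<-irrefl refl)
  ... | no  _   = refl

  at≤n : ∀ {i} → 1 ≤ i → i ≤ n → π at i ≤ n
  at≤n {suc i} _ i<n = subst (_≤ n) (sym (at≡lookup i<n)) (Fin.toℕ<n _)

  at-injective : Vec.Unique π → ∀ {i j} → 1 ≤ i → i < j → j ≤ n → π at i ≢ π at j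
  at-injective π! {suc i} {suc j} _ (s≤s i<j) j<n eq =
    ℕ.<⇒≢ i<j (trans (sym (Fin.toℕ-fromℕ< i<n)) (trans (cong toℕ (VecUnique.lookup-injective π! _ _
      (Fin.toℕ-injective (suc-injective (trans (sym (at≡lookup i<n)) (trans eq (at≡lookup j<n)))))))
      (Fin.toℕ-fromℕ< j<n)))
    where i<n = <-trans i<j j<n

  at-avoids-231 : Avoids p231 π → ∀ {i j k} → 1 ≤ i → i < j → j < k → k ≤ n →
                  ¬ (π at k < π at i × π at i < π at j)
  at-avoids-231 av {suc i} {suc j} {suc k} _ (s≤s i<j) (s≤s j<k) k<n
    rewrite at≡lookup (<-trans i<j (<-trans j<k k<n)) | at≡lookup (<-trans j<k k<n) | at≡lookup k<n =
    λ (πk<πi , πi<πj) → av (_ , _ , _ ,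
      subst₂ _<_ (sym (Fin.toℕ-fromℕ< _)) (sym (Fin.toℕ-fromℕ< _)) i<j ,
      subst₂ _<_ (sym (Fin.toℕ-fromℕ< _)) (sym (Fin.toℕ-fromℕ< _)) j<k ,
      Equivalence.from (describes231 _ _ _) (ℕ.≤-pred πk<πi , ℕ.≤-pred πi<πj))

-- In a 231-avoiding permutation the inversion (i , j) is star admissible iff i - 1 is an ascent,
-- and then π(i - 1) < π(j).
adi*≡13-2 : ∀ {n} (π : Word n) → Vec.Unique π → Avoids p231 π → adi* π ≡ 13-2 π
adi*≡13-2 {n} π π! av = trans (count₂-bijection n
  (λ i j → (i <? j) ×-dec (π at j <? π at i) ×-dec
    ((π at (i ∸ 1) <? π at i) ⊎-dec anyUpTo? (λ l → (i <? l) ×-dec (π at i <? π at l)) j))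
  (λ i j → (suc i <? j) ×-dec (π at i <? π at j) ×-dec (π at j <? π at suc i))
  (map₁ (_∸ 1)) (map₁ suc) to from)
  (sym (count₂-suc n λ k i j → (k <? j) ×-dec (π at i <? π at j) ×-dec (π at j <? π at k)))
  where
  Adi* 13-2At : ℕ → ℕ → Set
  Adi* i j = i < j × π at j < π at i × (π at (i ∸ 1) < π at i ⊎ ∃ λ l → l < j × i < l × π at i < π at l)
  13-2At i j = suc i < j × π at i < π at j × π at j < π at suc i
  to : ∀ i j → i ∈[1⋯ n ] → j ∈[1⋯ n ] → Adi* i j →
       (i ∸ 1 ∈[1⋯ n ] × j ∈[1⋯ n ]) × 13-2At (i ∸ 1) j × (suc (i ∸ 1) , j) ≡ (i , j)
  -- The letters at i, l, j would form the pattern 231.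
  to i j (1≤i , i≤n) (_ , j≤n) (i<j , πj<πi , inj₂ (l , l<j , i<l , πi<πl)) =
    contradiction (πj<πi , πi<πl) (at-avoids-231 π av 1≤i i<l l<j j≤n)
  -- By the convention π(0) = n + 1, position 0 is never an ascent, so i - 1 is a genuine position
  -- in what follows.
  to (suc zero) j (1≤i , i≤n) _ (_ , _ , inj₁ π0<π1) =
    contradiction (≤-trans π0<π1 (at≤n π 1≤i i≤n)) (ℕ.<⇒≱ (m≤n⇒m≤1+n ≤-refl))
  to (suc i@(suc _)) j (_ , i<n) j∈@(_ , j≤n) (i<j , πj<πi , inj₁ asc) =
    ((s≤s z≤n , ℕ.<⇒≤ i<n) , j∈) , (i<j , πi<πj , πj<πi) , refl
    where
    πi<πj : π at i < π at j
    πi<πj with ℕ.<-cmp (π at i) (π at j)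
    ... | tri< lt _ _ = lt
    ... | tri≈ _ eq _ = contradiction eq (at-injective π π! (s≤s z≤n) (<-trans ≤-refl i<j) j≤n)
    -- Otherwise the ascent at i, i + 1 followed by the smaller letter at j would be a 231.
    ... | tri> _ _ gt = contradiction (gt , asc) (at-avoids-231 π av (s≤s z≤n) ≤-refl i<j j≤n)
  from : ∀ i j → i ∈[1⋯ n ] → j ∈[1⋯ n ] → 13-2At i j →
         (suc i ∈[1⋯ n ] × j ∈[1⋯ n ]) × Adi* (suc i) j × (i , j) ≡ (i , j)
  from i j _ j∈@(_ , j≤n) (i+1<j , πi<πj , πj<π) =
    ((s≤s z≤n , ≤-trans (ℕ.<⇒≤ i+1<j) j≤n) , j∈) , (i+1<j , πj<π , inj₁ (<-trans πi<πj πj<π)) , refl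

reverseComplement : ∀ {n} → Word n → Word n
reverseComplement π = tabulate (λ i → opposite (lookup π (opposite i)))

-- The map sending x to N - x reverses the order; it is expressed by sums to keep truncated
-- subtraction away.
reflect-< : ∀ {N a a′ b b′} → a + a′ ≡ N → b + b′ ≡ N → a < b → b′ < a′
reflect-< {N} {a} {a′} {b} {b′} a+a′ b+b′ a<b = ℕ.≰⇒> λ a′≤b′ →
  <-irrefl (trans a+a′ (sym b+b′)) (ℕ.+-mono-<-≤ a<b a′≤b′)

reflect-<⁻ : ∀ {N a a′ b b′} → a + a′ ≡ N → b + b′ ≡ N → b′ < a′ → a < b
reflect-<⁻ {a = a} {a′} {b} {b′} a+a′ b+b′ =
  reflect-< (trans (ℕ.+-comm b′ b) b+b′) (trans (ℕ.+-comm a′ a) a+a′)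

-- The positions a and a′ of 0, …, n + 1 are exchanged by reversal.
record Mirrored (n a a′ : ℕ) : Set where
  constructor mirrored
  field sum : a + a′ ≡ suc n

mirrored-sym : ∀ {n a a′} → Mirrored n a a′ → Mirrored n a′ a
mirrored-sym {a = a} {a′} (mirrored eq) = mirrored (trans (ℕ.+-comm a′ a) eq)

mirrored-< : ∀ {n a a′ b b′} → Mirrored n a a′ → Mirrored n b b′ → a < b → b′ < a′
mirrored-< (mirrored a+a′) (mirrored b+b′) = reflect-< a+a′ b+b′

opposite-sum : ∀ {n} (i : Fin n) → toℕ (opposite i) + suc (toℕ i) ≡ n
opposite-sum i = trans (cong (_+ suc (toℕ i)) (Fin.opposite-prop i)) (ℕ.m∸n+n≡m (Fin.toℕ<n i))

-- Each vector is the reverse-complement of the other. The constant is 4 for patterns, whose letters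
-- start from 1, and n - 1 for subwords, whose letters start from 0.
Complementary : ℕ → ∀ {k} → Vec ℕ k → Vec ℕ k → Set
Complementary N u v = ∀ c → lookup u c + lookup v (opposite c) ≡ N

orderIsomorphic-complement : ∀ {k N M} (u u′ v v′ : Vec ℕ k) → Complementary N u′ u → Complementary M v′ v →
                             OrderIsomorphic u v → OrderIsomorphic u′ v′
orderIsomorphic-complement u u′ v v′ cu cv iso a b =
  (λ lt → reflect-<⁻ (cv a) (cv b) (proj₁ (iso (opposite b) (opposite a)) (reflect-< (cu a) (cu b) lt))) ,
  (λ lt → reflect-<⁻ (cu a) (cu b) (proj₂ (iso (opposite b) (opposite a)) (reflect-< (cv a) (cv b) lt)))

module _ {n : ℕ} (π : Word n) where

  private ρ = reverseComplement π

  lookup-reverseComplement : ∀ i → lookup ρ i ≡ opposite (lookup π (opposite i))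
  lookup-reverseComplement i = Vec.lookup∘tabulate _ i

  reverseComplement-unique : Vec.Unique π → Vec.Unique ρ
  reverseComplement-unique π! = VecUnique.tabulate⁺ λ {i} {j} eq →
    opposite-injective (VecUnique.lookup-injective π! _ _ (opposite-injective eq))
    where
    opposite-injective : ∀ {i j : Fin n} → opposite i ≡ opposite j → i ≡ j
    opposite-injective {i} {j} eq =
      trans (sym (Fin.opposite-involutive i)) (trans (cong opposite eq) (Fin.opposite-involutive j))

  reverseComplement-contains : ∀ τ τ′ → Complementary 4 τ′ τ → Contains τ ρ → Contains τ′ π
  reverseComplement-contains τ τ′ comp (i , j , k , i<j , j<k , iso) =
    opposite k , opposite j , opposite i ,
    reflect-<⁻ (opposite-sum k) (opposite-sum j) (s≤s j<k) ,
    reflect-<⁻ (opposite-sum j) (opposite-sum i) (s≤s i<j) ,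
    orderIsomorphic-complement τ τ′ (subword ρ i j k) (subword π (opposite k) (opposite j) (opposite i)) comp letters iso
    where
    letter : ∀ i → suc (toℕ (lookup π (opposite i)) + toℕ (lookup ρ i)) ≡ n
    letter i rewrite lookup-reverseComplement i =
      trans (ℕ.+-comm (suc (toℕ (lookup π (opposite i)))) _) (opposite-sum (lookup π (opposite i)))
    letters : Complementary (n ∸ 1) (subword π (opposite k) (opposite j) (opposite i)) (subword ρ i j k)
    letters zero             = cong (_∸ 1) (letter k)
    letters (suc zero)       = cong (_∸ 1) (letter j)
    letters (suc (suc zero)) = cong (_∸ 1) (letter i)

  -- This also covers the boundary values π(0) = n + 1 and π(n + 1) = 0.
  at-reverseComplement : ∀ {a a′} → Mirrored n a a′ → ρ at a + π at a′ ≡ suc n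
  at-reverseComplement {zero}  {_}     (mirrored refl) = trans (cong (suc n +_) (at-end π)) (ℕ.+-identityʳ (suc n))
  at-reverseComplement {suc a} {zero}  (mirrored eq) with refl ← trans (sym (ℕ.+-identityʳ a)) (suc-injective eq) =
    cong (_+ suc n) (at-end ρ)
  at-reverseComplement {suc i} {suc j} (mirrored eq) = trans (cong₂ _+_ (at≡lookup ρ i<n) (at≡lookup π j<n))
    (cong suc (trans (cong (λ x → toℕ x + suc (toℕ (lookup π (fromℕ< j<n))))
                       (trans (lookup-reverseComplement (fromℕ< i<n)) (cong (opposite ∘ lookup π) swap)))
                     (opposite-sum (lookup π (fromℕ< j<n)))))
    where
    i+1+j≡n : i + suc j ≡ n
    i+1+j≡n = suc-injective eq
    i<n : i < n
    i<n = subst (i <_) i+1+j≡n (ℕ.m<m+n i (s≤s z≤n))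
    j<n : j < n
    j<n = subst (suc j ≤_) i+1+j≡n (ℕ.m≤n+m (suc j) i)
    swap : opposite (fromℕ< i<n) ≡ fromℕ< j<n
    swap = Fin.toℕ-injective (trans (ℕ.+-cancelʳ-≡ (suc i) _ _ (trans
      (trans (cong (λ x → toℕ (opposite (fromℕ< i<n)) + suc x) (sym (Fin.toℕ-fromℕ< i<n))) (opposite-sum (fromℕ< i<n)))
      (trans (sym i+1+j≡n) (trans (ℕ.+-suc i j) (trans (cong suc (ℕ.+-comm i j)) (sym (ℕ.+-suc j i)))))))
      (sym (Fin.toℕ-fromℕ< j<n)))

  at-<⁺ : ∀ {a a′ b b′} → Mirrored n a a′ → Mirrored n b b′ → ρ at a < ρ at b → π at b′ < π at a′
  at-<⁺ a⇄a′ b⇄b′ = reflect-< (at-reverseComplement a⇄a′) (at-reverseComplement b⇄b′)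

  at-<⁻ : ∀ {a a′ b b′} → Mirrored n a a′ → Mirrored n b b′ → π at b′ < π at a′ → ρ at a < ρ at b
  at-<⁻ a⇄a′ b⇄b′ = reflect-<⁻ (at-reverseComplement a⇄a′) (at-reverseComplement b⇄b′)

reverseComplement-involutive : ∀ {n} (π : Word n) → reverseComplement (reverseComplement π) ≡ π
reverseComplement-involutive π = trans (Vec.tabulate-cong λ i →
  trans (cong opposite (trans (lookup-reverseComplement π (opposite i))
                              (cong (opposite ∘ lookup π) (Fin.opposite-involutive i))))
        (Fin.opposite-involutive (lookup π i)))
  (Vec.tabulate∘lookup π)

module _ {n : ℕ} (σ : Word n) where

  private
    ρ = reverseComplement σ
    N = suc n

    Pos = _∈[1⋯ n ]

    flipᴺ : ∀ {i} → Pos i → Mirrored n i (N ∸ i)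
    flipᴺ (_ , i≤n) = mirrored (ℕ.m+[n∸m]≡n (m≤n⇒m≤1+n i≤n))

    flipᴺ-pos : ∀ {i} → Pos i → Pos (N ∸ i)
    flipᴺ-pos {suc i} (_ , i<n) = ℕ.m<n⇒0<n∸m i<n , ℕ.m∸n≤m n i

    flipᴺ-invol : ∀ {i} → Pos i → N ∸ (N ∸ i) ≡ i
    flipᴺ-invol (_ , i≤n) = ℕ.m∸[m∸n]≡n (m≤n⇒m≤1+n i≤n)

    -- The adjacent positions i, i + 1 are sent to n + 1 - i and n - i. An adjacent pair is indexed
    -- by its left end, so it moves by n - i, whereas a single position moves by n + 1 - i.
    flipⁿ : ∀ {i} → i < n → Mirrored n (suc i) (n ∸ i)
    flipⁿ i<n = mirrored (cong suc (ℕ.m+[n∸m]≡n (ℕ.<⇒≤ i<n)))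

    flipⁿ′ : ∀ {i} → i < n → Mirrored n i (suc (n ∸ i))
    flipⁿ′ {i} i<n = mirrored (trans (ℕ.+-suc i (n ∸ i)) (Mirrored.sum (flipⁿ i<n)))

    flipⁿ-pos : ∀ {i} → i < n → 1 ≤ n ∸ i
    flipⁿ-pos = ℕ.m<n⇒0<n∸m

    flipⁿ-< : ∀ {i} → 1 ≤ i → i < n → n ∸ i < n
    flipⁿ-< {i} 1≤i i<n = ℕ.∸-monoʳ-< 1≤i (ℕ.<⇒≤ i<n)

    flipⁿ-invol : ∀ {i} → i < n → n ∸ (n ∸ i) ≡ i
    flipⁿ-invol i<n = ℕ.m∸[m∸n]≡n (ℕ.<⇒≤ i<n)

  des-reverseComplement : des ρ ≡ des σ
  des-reverseComplement = trans (count-suc n λ k i → (i <? n) ×-dec (ρ at k <? ρ at i)) (trans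
    (count-bijection n
      (λ i → (i <? n) ×-dec (ρ at suc i <? ρ at i)) (λ i → (i <? n) ×-dec (σ at suc i <? σ at i)) (n ∸_) (n ∸_)
      (λ i (1≤i , _) (i<n , d) → (flipⁿ-pos i<n , ℕ.m∸n≤m n i) ,
        (flipⁿ-< 1≤i i<n , at-<⁺ σ (flipⁿ i<n) (flipⁿ′ i<n) d) , flipⁿ-invol i<n)
      (λ i (1≤i , _) (i<n , d) → (flipⁿ-pos i<n , ℕ.m∸n≤m n i) ,
        (flipⁿ-< 1≤i i<n , at-<⁻ σ (mirrored-sym (flipⁿ′ i<n)) (mirrored-sym (flipⁿ i<n)) d) , flipⁿ-invol i<n))
    (sym (count-suc n λ k i → (i <? n) ×-dec (σ at k <? σ at i))))

  private
    i+1<j⇒i<n : ∀ {i j} → Pos j → suc i < j → i < n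
    i+1<j⇒i<n (_ , j≤n) i+1<j = ≤-trans (ℕ.<⇒≤ i+1<j) j≤n

    turn : ℕ × ℕ → ℕ × ℕ
    turn (i , j) = n ∸ i , N ∸ j

    -- Reversal carries a single position on the left of an adjacent pair to one on its right. The
    -- conditions on letters are kept abstract so that 2-31 and 2-13 are treated alike.
    turn-bijection : ∀ {P Q : ℕ → ℕ → Set} (P? : ∀ i j → Dec (P i j)) (Q? : ∀ i j → Dec (Q i j)) →
      (∀ {i j} → i < n → Pos j → P i j → Q (n ∸ i) (N ∸ j)) →
      (∀ {i j} → i < n → Pos j → Q i j → P (n ∸ i) (N ∸ j)) →
      count₂ n (λ i j → (j <? i) ×-dec (i <? n) ×-dec P? i j) ≡ count₂ n (λ i j → (suc i <? j) ×-dec Q? i j)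
    turn-bijection P? Q? to from = count₂-bijection n
      (λ i j → (j <? i) ×-dec (i <? n) ×-dec P? i j) (λ i j → (suc i <? j) ×-dec Q? i j) turn turn
      (λ i j i∈ j∈ (j<i , i<n , p) →
        ((flipⁿ-pos i<n , ℕ.m∸n≤m n i) , flipᴺ-pos j∈) ,
        (mirrored-< (flipᴺ j∈) (flipⁿ′ i<n) j<i , to i<n j∈ p) ,
        cong₂ _,_ (flipⁿ-invol i<n) (flipᴺ-invol j∈))
      (λ i j (1≤i , _) j∈ (i+1<j , p) → let i<n = i+1<j⇒i<n j∈ i+1<j in
        ((flipⁿ-pos i<n , ℕ.m∸n≤m n i) , flipᴺ-pos j∈) ,
        (mirrored-< (flipⁿ i<n) (flipᴺ j∈) i+1<j , flipⁿ-< 1≤i i<n , from i<n j∈ p) ,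
        cong₂ _,_ (flipⁿ-invol i<n) (flipᴺ-invol j∈))

  2-31-reverseComplement : 2-31 ρ ≡ 31-2 σ
  2-31-reverseComplement = trans
    (count₂-suc n λ k i j → (j <? i) ×-dec (i <? n) ×-dec (ρ at k <? ρ at j) ×-dec (ρ at j <? ρ at i)) (trans
    (turn-bijection (λ i j → (ρ at suc i <? ρ at j) ×-dec (ρ at j <? ρ at i))
                    (λ i j → (σ at suc i <? σ at j) ×-dec (σ at j <? σ at i))
      (λ i<n j∈ (ρ<ρj , ρj<ρ) → at-<⁺ σ (flipᴺ j∈) (flipⁿ′ i<n) ρj<ρ , at-<⁺ σ (flipⁿ i<n) (flipᴺ j∈) ρ<ρj)
      (λ i<n j∈ (σ<σj , σj<σ) → at-<⁻ σ (mirrored-sym (flipⁿ′ i<n)) (mirrored-sym (flipᴺ j∈)) σj<σ ,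
                                at-<⁻ σ (mirrored-sym (flipᴺ j∈)) (mirrored-sym (flipⁿ i<n)) σ<σj))
    (sym (count₂-suc n λ k i j → (k <? j) ×-dec (σ at k <? σ at j) ×-dec (σ at j <? σ at i))))

  2-13-reverseComplement : 2-13 ρ ≡ 13-2 σ
  2-13-reverseComplement = trans
    (count₂-suc n λ k i j → (j <? i) ×-dec (i <? n) ×-dec (ρ at i <? ρ at j) ×-dec (ρ at j <? ρ at k)) (trans
    (turn-bijection (λ i j → (ρ at i <? ρ at j) ×-dec (ρ at j <? ρ at suc i))
                    (λ i j → (σ at i <? σ at j) ×-dec (σ at j <? σ at suc i))
      (λ i<n j∈ (ρ<ρj , ρj<ρ) → at-<⁺ σ (flipᴺ j∈) (flipⁿ i<n) ρj<ρ , at-<⁺ σ (flipⁿ′ i<n) (flipᴺ j∈) ρ<ρj)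
      (λ i<n j∈ (σ<σj , σj<σ) → at-<⁻ σ (mirrored-sym (flipⁿ i<n)) (mirrored-sym (flipᴺ j∈)) σj<σ ,
                                at-<⁻ σ (mirrored-sym (flipᴺ j∈)) (mirrored-sym (flipⁿ′ i<n)) σ<σj))
    (sym (count₂-suc n λ k i j → (k <? j) ×-dec (σ at i <? σ at j) ×-dec (σ at j <? σ at k))))

  private
    Adi Adi* : ℕ → ℕ → Set
    Adi  i j = i < j × ρ at j < ρ at i × (ρ at j < ρ at suc j ⊎ ∃ λ l → l < j × i < l × ρ at l < ρ at j)
    Adi* i j = i < j × σ at j < σ at i × (σ at (i ∸ 1) < σ at i ⊎ ∃ λ l → l < j × i < l × σ at i < σ at l)

    adi? : ∀ i j → Dec (Adi i j)
    adi? i j = (i <? j) ×-dec (ρ at j <? ρ at i) ×-dec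
      ((ρ at j <? ρ at suc j) ⊎-dec anyUpTo? (λ l → (i <? l) ×-dec (ρ at l <? ρ at j)) j)
    adi*? : ∀ i j → Dec (Adi* i j)
    adi*? i j = (i <? j) ×-dec (σ at j <? σ at i) ×-dec
      ((σ at (i ∸ 1) <? σ at i) ⊎-dec anyUpTo? (λ l → (i <? l) ×-dec (σ at i <? σ at l)) j)

    between-pos : ∀ {i j l} → Pos i → Pos j → i < l → l < j → Pos l
    between-pos (1≤i , _) (_ , j≤n) i<l l<j = ≤-trans 1≤i (ℕ.<⇒≤ i<l) , ≤-trans (ℕ.<⇒≤ l<j) j≤n

    swapTurn : ℕ × ℕ → ℕ × ℕ
    swapTurn (i , j) = N ∸ j , N ∸ i

    -- The case j = n matters: position n + 1 with letter 0, as in `adi`, mirrors position 0 with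
    -- letter n + 1, as in `adi*`.
    pred-flip : ∀ {j} → Pos j → Mirrored n (suc j) (N ∸ j ∸ 1)
    pred-flip {j} (_ , j≤n) = mirrored (trans
      (cong (suc j +_) (trans (ℕ.∸-+-assoc N j 1) (cong (N ∸_) (ℕ.+-comm j 1)))) (ℕ.m+[n∸m]≡n (s≤s j≤n)))

    flip-pred : ∀ {i} → Pos i → Mirrored n (suc (N ∸ i)) (i ∸ 1)
    flip-pred {suc i} (_ , i<n) = mirrored (cong suc (ℕ.m∸n+n≡m (ℕ.<⇒≤ i<n)))

  adi-reverseComplement : adi ρ ≡ adi* σ
  adi-reverseComplement = trans
    normalise
    (count₂-bijection n adi? adi*? swapTurn swapTurn to from)
    where
    normalise : adi ρ ≡ count₂ n adi?
    normalise = trans (count₂≡tally₂ n λ i j → decide (j + 1) i j) (trans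
      (tally₂-cong n λ i j → cong (λ k → indicator (decide k (suc i) (suc j))) (ℕ.+-comm (suc j) 1))
      (sym (count₂≡tally₂ n adi?)))
      where
      decide = λ k i j → (i <? j) ×-dec (ρ at j <? ρ at i) ×-dec
        ((ρ at j <? ρ at k) ⊎-dec anyUpTo? (λ l → (i <? l) ×-dec (ρ at l <? ρ at j)) j)
    to : ∀ i j → Pos i → Pos j → Adi i j → (Pos (N ∸ j) × Pos (N ∸ i)) × Adi* (N ∸ j) (N ∸ i) ×
         (N ∸ (N ∸ i) , N ∸ (N ∸ j)) ≡ (i , j)
    to i j i∈ j∈ (i<j , ρj<ρi , adm) = (flipᴺ-pos j∈ , flipᴺ-pos i∈) ,
      (mirrored-< (flipᴺ i∈) (flipᴺ j∈) i<j , at-<⁺ σ (flipᴺ j∈) (flipᴺ i∈) ρj<ρi ,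
       [ (λ asc → inj₁ (at-<⁺ σ (flipᴺ j∈) (pred-flip j∈) asc))
       , (λ (l , l<j , i<l , ρl<ρj) → let l∈ = between-pos i∈ j∈ i<l l<j in
           inj₂ (N ∸ l , mirrored-< (flipᴺ i∈) (flipᴺ l∈) i<l , mirrored-< (flipᴺ l∈) (flipᴺ j∈) l<j ,
                 at-<⁺ σ (flipᴺ l∈) (flipᴺ j∈) ρl<ρj)) ]′ adm) ,
      cong₂ _,_ (flipᴺ-invol i∈) (flipᴺ-invol j∈)
    from : ∀ i j → Pos i → Pos j → Adi* i j → (Pos (N ∸ j) × Pos (N ∸ i)) × Adi (N ∸ j) (N ∸ i) ×
           (N ∸ (N ∸ i) , N ∸ (N ∸ j)) ≡ (i , j)
    from i j i∈ j∈ (i<j , σj<σi , adm) = (flipᴺ-pos j∈ , flipᴺ-pos i∈) ,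
      (mirrored-< (flipᴺ i∈) (flipᴺ j∈) i<j , at-<⁻ σ (mirrored-sym (flipᴺ i∈)) (mirrored-sym (flipᴺ j∈)) σj<σi ,
       [ (λ asc → inj₁ (at-<⁻ σ (mirrored-sym (flipᴺ i∈)) (flip-pred i∈) asc))
       , (λ (l , l<j , i<l , σi<σl) → let l∈ = between-pos i∈ j∈ i<l l<j in
           inj₂ (N ∸ l , mirrored-< (flipᴺ i∈) (flipᴺ l∈) i<l , mirrored-< (flipᴺ l∈) (flipᴺ j∈) l<j ,
                 at-<⁻ σ (mirrored-sym (flipᴺ l∈)) (mirrored-sym (flipᴺ i∈)) σi<σl)) ]′ adm) ,
      cong₂ _,_ (flipᴺ-invol i∈) (flipᴺ-invol j∈)

-- Words avoiding 321

-- Reading a 321-avoiding permutation from left to right, U lists the skipped letters in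
-- increasing order and m, …, m + r - 1 are the letters above the current maximum: the next letter
-- is either the smallest skipped one or a new maximum.  `peaks` enumerates the latter case.
mutual
  scans : List ℕ → ℕ → ℕ → List (List ℕ)
  scans []      m zero    = [] ∷ []
  scans []      m (suc r) = peaks [] m (suc r)
  scans (u ∷ U) m r       = map (u ∷_) (scans U m r) ++ peaks (u ∷ U) m r

  peaks : List ℕ → ℕ → ℕ → List (List ℕ)
  peaks U m zero    = []
  peaks U m (suc r) = map (m ∷_) (scans U (suc m) r) ++ peaks (U ++ m ∷ []) (suc m) r

Sorted : List ℕ → ℕ → Set
Sorted U m = AllPairs _<_ U × All (_< m) U

sorted-skip : ∀ {U m} → Sorted U m → Sorted (U ++ m ∷ []) (suc m)
sorted-skip (U< , U<m) =
  AllPairs.++⁺ U< ([] ∷ []) (All.map (_∷ []) U<m) , All.++⁺ (All.map m≤n⇒m≤1+n U<m) (≤-refl ∷ [])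

sorted-suc : ∀ {U m} → Sorted U m → Sorted U (suc m)
sorted-suc (U< , U<m) = U< , All.map m≤n⇒m≤1+n U<m

sorted-tail : ∀ {u U m} → Sorted (u ∷ U) m → Sorted U m
sorted-tail (_ ∷ U< , _ ∷ U<m) = U< , U<m

Remaining : List ℕ → ℕ → ℕ → ℕ → Set
Remaining U m r x = x ∈ U ⊎ (m ≤ x × x < m + r)

-- `avoids` concerns the unread letters only. Patterns whose largest letter is already read are
-- excluded by `increasing`: an unread letter below m followed by a smaller one would complete a 321
-- with an earlier maximum.
record Scan (U : List ℕ) (m r : ℕ) (xs : List ℕ) : Set where
  constructor scan
  field
    unique     : Unique xs
    letters    : ∀ {x} → x ∈ xs → Remaining U m r x
    onto       : ∀ {x} → Remaining U m r x → x ∈ xs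
    increasing : AllPairs (λ y z → y < m → y < z) xs
    avoids     : AllTriples (Not Order321) xs

private
  head<remaining : ∀ {u U m r x} → Sorted (u ∷ U) m → Remaining U m r x → u < x
  head<remaining (u<U ∷ _ , _)   (inj₁ x∈)        = All.lookup u<U x∈
  head<remaining (_ , u<m ∷ _)   (inj₂ (m≤x , _)) = ≤-trans u<m m≤x

  remaining-suc : ∀ {U m r x} → Remaining U (suc m) r x → Remaining U m (suc r) x
  remaining-suc         (inj₁ x∈)          = inj₁ x∈
  remaining-suc {m = m} {r} {x} (inj₂ (m<x , x<n)) = inj₂ (ℕ.<⇒≤ m<x , subst (x <_) (sym (ℕ.+-suc m r)) x<n)

  remaining-unskip : ∀ {U m r x} → Remaining (U ++ m ∷ []) (suc m) r x → Remaining U m (suc r) x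
  remaining-unskip {U} {m} {r} (inj₁ x∈) with ∈-++⁻ U x∈
  ... | inj₁ x∈U         = inj₁ x∈U
  ... | inj₂ (here refl) = inj₂ (≤-refl , ℕ.m<m+n m (s≤s z≤n))
  remaining-unskip (inj₂ rest) = remaining-suc (inj₂ rest)

  remaining-skip : ∀ {U m r x} → Remaining U m (suc r) x → Remaining (U ++ m ∷ []) (suc m) r x
  remaining-skip (inj₁ x∈) = inj₁ (∈-++⁺ˡ x∈)
  remaining-skip {U} {m} {r} {x} (inj₂ (m≤x , x<n)) with ℕ.m≤n⇒m<n∨m≡n m≤x
  ... | inj₁ m<x  = inj₂ (m<x , subst (x <_) (ℕ.+-suc m r) x<n)
  ... | inj₂ refl = inj₁ (∈-++⁺ʳ U (here refl))

scan-old⁺ : ∀ {u U m r xs} → Sorted (u ∷ U) m → Scan U m r xs → Scan (u ∷ U) m r (u ∷ xs)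
scan-old⁺ {u} {U} {m} {r} {xs} sorted (scan xs! letters onto inc av) = scan
  (All.map ℕ.<⇒≢ u<xs ∷ xs!)
  (λ { (here refl) → inj₁ (here refl) ; (there x∈) → [ inj₁ ∘ there , inj₂ ]′ (letters x∈) })
  (λ { (inj₁ (here refl)) → here refl ; (inj₁ (there x∈)) → there (onto (inj₁ x∈)) ; (inj₂ b) → there (onto (inj₂ b)) })
  (All.map (λ u<x _ → u<x) u<xs ∷ inc)
  (allPairs-∈ xs (λ y∈ _ (_ , y<u) → <-asym y<u (All.lookup u<xs y∈)) ∷ av)
  where
  u<xs : All (u <_) xs
  u<xs = All.tabulate λ x∈ → head<remaining {r = r} sorted (letters x∈)

-- If x were another skipped letter, u would follow it, and `increasing` would give x < u although u
-- is the least of them.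
scan-old⁻ : ∀ {u U m r x xs} → Sorted (u ∷ U) m → x < m → Scan (u ∷ U) m r (x ∷ xs) → x ≡ u × Scan U m r xs
scan-old⁻ {u} {U} {m} {r} {x} {xs} sorted x<m (scan (x∉ ∷ xs!) letters onto (x<xs ∷ inc) (_ ∷ av)) =
  x≡u , scan xs! letters′ onto′ inc av
  where
  x≡u : x ≡ u
  x≡u with onto (inj₁ (here refl))
  ... | here u≡x = sym u≡x
  ... | there u∈ with letters (here refl)
  ...   | inj₁ (here x≡u) = x≡u
  ...   | inj₁ (there x∈) = contradiction (All.lookup x<xs u∈ x<m) (<-asym (head<remaining {r = r} sorted (inj₁ x∈)))
  ...   | inj₂ (m≤x , _)  = contradiction (≤-trans x<m m≤x) (<-irrefl refl)
  letters′ : ∀ {y} → y ∈ xs → Remaining U m r y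
  letters′ y∈ with letters (there y∈)
  ... | inj₁ (here refl) = contradiction x≡u (All.lookup x∉ y∈)
  ... | inj₁ (there y∈U) = inj₁ y∈U
  ... | inj₂ b           = inj₂ b
  onto′ : ∀ {y} → Remaining U m r y → y ∈ xs
  onto′ rem with onto ([ inj₁ ∘ there , inj₂ ]′ rem)
  ... | here refl = contradiction (head<remaining {r = r} sorted rem) (<-irrefl (sym x≡u))
  ... | there y∈  = y∈

scan-new⁺ : ∀ {U m r xs} → Sorted U m → Scan U (suc m) r xs → Scan U m (suc r) (m ∷ xs)
scan-new⁺ {U} {m} {r} {xs} (_ , U<m) (scan xs! letters onto inc av) = scan
  (All.tabulate (λ x∈ → [ (λ x∈U → ℕ.>⇒≢ (All.lookup U<m x∈U)) , (λ (m<x , _) → ℕ.<⇒≢ m<x) ]′ (letters x∈)) ∷ xs!)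
  (λ { (here refl) → inj₂ (≤-refl , ℕ.m<m+n m (s≤s z≤n)) ; (there x∈) → remaining-suc (letters x∈) })
  onto′
  (All.tabulate (λ _ m<m → contradiction m<m (<-irrefl refl)) ∷ AllPairs.map (λ inc y<m → inc (m≤n⇒m≤1+n y<m)) inc)
  -- A 321 begun by m would need a descending pair of letters below m, which `increasing` forbids.
  (AllPairs.map (λ inc (z<y , y<m) → <-asym z<y (inc (m≤n⇒m≤1+n y<m))) inc ∷ av)
  where
  onto′ : ∀ {x} → Remaining U m (suc r) x → x ∈ m ∷ xs
  onto′ (inj₁ x∈) = there (onto (inj₁ x∈))
  onto′ {x} (inj₂ (m≤x , x<n)) with ℕ.m≤n⇒m<n∨m≡n m≤x
  ... | inj₁ m<x  = there (onto (inj₂ (m<x , subst (x <_) (ℕ.+-suc m r) x<n)))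
  ... | inj₂ refl = here refl

scan-new⁻ : ∀ {U m r xs} → Sorted U m → Scan U m (suc r) (m ∷ xs) → Scan U (suc m) r xs
scan-new⁻ {U} {m} {r} {xs} (_ , U<m) (scan (m∉ ∷ xs!) letters onto (_ ∷ inc) (_ ∷ av)) = scan
  xs! letters′ onto′ (strengthen xs m∉ inc) av
  where
  letters′ : ∀ {x} → x ∈ xs → Remaining U (suc m) r x
  letters′ {x} x∈ with letters (there x∈)
  ... | inj₁ x∈U = inj₁ x∈U
  ... | inj₂ (m≤x , x<n) = inj₂ (ℕ.≤∧≢⇒< m≤x (All.lookup m∉ x∈) , subst (x <_) (ℕ.+-suc m r) x<n)
  onto′ : ∀ {x} → Remaining U (suc m) r x → x ∈ xs
  onto′ rem with onto (remaining-suc rem) | rem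
  ... | there x∈  | _                = x∈
  ... | here refl | inj₁ m∈          = contradiction (All.lookup U<m m∈) (<-irrefl refl)
  ... | here refl | inj₂ (m<m , _)   = contradiction m<m (<-irrefl refl)
  -- The letter m is read and does not recur, so the new bound m + 1 admits no further letters.
  strengthen : ∀ ys → All (m ≢_) ys → AllPairs (λ y z → y < m → y < z) ys → AllPairs (λ y z → y < suc m → y < z) ys
  strengthen []       _           _          = []
  strengthen (y ∷ ys) (m≢y ∷ m∉) (inc ∷ incs) =
    All.map (λ y<z y≤m → y<z (ℕ.≤∧≢⇒< (ℕ.≤-pred y≤m) (m≢y ∘ sym))) inc ∷ strengthen ys m∉ incs

scan-skip⁺ : ∀ {U m r xs} → Scan (U ++ m ∷ []) (suc m) r xs → Scan U m (suc r) xs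
scan-skip⁺ {U} {m} {r} (scan xs! letters onto inc av) = scan xs!
  (remaining-unskip {U} ∘ letters) (onto ∘ remaining-skip) (AllPairs.map (λ inc y<m → inc (m≤n⇒m≤1+n y<m)) inc) av

-- The letters after the new maximum x > m that lie below x increase, so m precedes all larger ones.
scan-skip⁻ : ∀ {U m r x xs} → m < x → Scan U m (suc r) (x ∷ xs) → Scan (U ++ m ∷ []) (suc m) r (x ∷ xs)
scan-skip⁻ {U} {m} {r} {x} {xs} m<x (scan (x∉ ∷ xs!) letters onto (_ ∷ inc) (px ∷ av)) = scan (x∉ ∷ xs!)
  (remaining-skip ∘ letters) (onto ∘ remaining-unskip {U})
  (All.tabulate (λ _ x≤m → contradiction m<x (ℕ.<⇒≱ x≤m)) ∷ strengthen xs xs! inc px) (px ∷ av)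
  where
  strengthen : ∀ ys → Unique ys → AllPairs (λ y z → y < m → y < z) ys → AllPairs (Not Order321 x) ys →
               AllPairs (λ y z → y < suc m → y < z) ys
  strengthen []       _          _            _        = []
  strengthen (y ∷ ys) (y∉ ∷ ys!) (inc ∷ incs) (p ∷ ps) =
    All.tabulate (λ {z} z∈ y≤m → ℕ.≤∧≢⇒<
      (ℕ.≮⇒≥ λ z<y → All.lookup p z∈ (z<y , ≤-trans y≤m m<x)) (All.lookup y∉ z∈))
    ∷ strengthen ys ys! incs ps

mutual
  scans-sound : ∀ U m r {xs} → Sorted U m → xs ∈ scans U m r → Scan U m r xs
  scans-sound [] m zero _ (here refl) = scan []
    (λ ()) (λ { (inj₂ (m≤x , x<m)) → contradiction (≤-trans x<m (subst (_≤ _) (sym (ℕ.+-identityʳ m)) m≤x)) (<-irrefl refl) }) [] []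
  scans-sound []      m (suc r) sorted xs∈ = proj₁ (peaks-sound [] m (suc r) sorted xs∈)
  scans-sound (u ∷ U) m r       sorted xs∈ with ∈-++⁻ (map (u ∷_) (scans U m r)) xs∈
  ... | inj₂ xs∈ʳ = proj₁ (peaks-sound (u ∷ U) m r sorted xs∈ʳ)
  ... | inj₁ xs∈ˡ with ys , ys∈ , refl ← ∈-map⁻ (u ∷_) xs∈ˡ =
    scan-old⁺ sorted (scans-sound U m r (sorted-tail sorted) ys∈)

  -- The lower bound on the first letter separates new maxima from skipped letters, and the choice
  -- of m from its omission; the enumeration is repetition-free for this reason.
  peaks-sound : ∀ U m r {xs} → Sorted U m → xs ∈ peaks U m r →
                Scan U m r xs × ∃ λ x → ∃ λ ys → xs ≡ x ∷ ys × m ≤ x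
  peaks-sound U m (suc r) sorted xs∈ with ∈-++⁻ (map (m ∷_) (scans U (suc m) r)) xs∈
  ... | inj₁ xs∈ˡ with ys , ys∈ , refl ← ∈-map⁻ (m ∷_) xs∈ˡ =
    scan-new⁺ sorted (scans-sound U (suc m) r (sorted-suc sorted) ys∈) , m , ys , refl , ≤-refl
  ... | inj₂ xs∈ʳ with sc , x , ys , eq , m<x ← peaks-sound (U ++ m ∷ []) (suc m) r (sorted-skip sorted) xs∈ʳ =
    scan-skip⁺ sc , x , ys , eq , ℕ.<⇒≤ m<x

mutual
  scans-complete : ∀ U m r {xs} → Sorted U m → Scan U m r xs → xs ∈ scans U m r
  scans-complete []      m zero    {[]}     sorted sc = here refl
  scans-complete []      m (suc r) {[]}     sorted sc with () ← Scan.onto sc (inj₂ (≤-refl , ℕ.m<m+n m (s≤s z≤n)))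
  scans-complete (u ∷ U) m r       {[]}     sorted sc with () ← Scan.onto sc (inj₁ (here refl))
  scans-complete []      m zero    {x ∷ xs} sorted sc with Scan.letters sc (here refl)
  ... | inj₂ (m≤x , x<m) = contradiction (≤-trans x<m (subst (_≤ x) (sym (ℕ.+-identityʳ m)) m≤x)) (<-irrefl refl)
  scans-complete []      m (suc r) {x ∷ xs} sorted sc with Scan.letters sc (here refl)
  ... | inj₂ (m≤x , _) = peaks-complete [] m (suc r) sorted m≤x sc
  scans-complete (u ∷ U) m r       {x ∷ xs} sorted sc with x <? m
  ... | no x≮m = ∈-++⁺ʳ (map (u ∷_) (scans U m r)) (peaks-complete (u ∷ U) m r sorted (ℕ.≮⇒≥ x≮m) sc)
  ... | yes x<m with refl , sc′ ← scan-old⁻ sorted x<m sc =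
    ∈-++⁺ˡ (∈-map⁺ (u ∷_) (scans-complete U m r (sorted-tail sorted) sc′))

  peaks-complete : ∀ U m r {x xs} → Sorted U m → m ≤ x → Scan U m r (x ∷ xs) → x ∷ xs ∈ peaks U m r
  peaks-complete U m zero {x} (_ , U<m) m≤x sc with Scan.letters sc (here refl)
  ... | inj₁ x∈U = contradiction (All.lookup U<m x∈U) (ℕ.≤⇒≯ m≤x)
  ... | inj₂ (_ , x<m) = contradiction (subst (x <_) (ℕ.+-identityʳ m) x<m) (ℕ.≤⇒≯ m≤x)
  peaks-complete U m (suc r) sorted m≤x sc with ℕ.m≤n⇒m<n∨m≡n m≤x
  ... | inj₂ refl = ∈-++⁺ˡ (∈-map⁺ (m ∷_) (scans-complete U (suc m) r (sorted-suc sorted) (scan-new⁻ sorted sc)))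
  ... | inj₁ m<x  = ∈-++⁺ʳ (map (m ∷_) (scans U (suc m) r))
    (peaks-complete (U ++ m ∷ []) (suc m) r (sorted-skip sorted) m<x (scan-skip⁻ m<x sc))

mutual
  scans-unique : ∀ U m r → Sorted U m → Unique (scans U m r)
  scans-unique []      m zero    _      = [] ∷ []
  scans-unique []      m (suc r) sorted = peaks-unique [] m (suc r) sorted
  scans-unique (u ∷ U) m r       sorted = Unique.++⁺
    (Unique.map⁺ List.∷-injectiveʳ (scans-unique U m r (sorted-tail sorted)))
    (peaks-unique (u ∷ U) m r sorted) λ (∈ˡ , ∈ʳ) → clash ∈ˡ ∈ʳ
    where
    clash : ∀ {xs} → xs ∈ map (u ∷_) (scans U m r) → ¬ xs ∈ peaks (u ∷ U) m r
    clash ∈ˡ ∈ʳ with ys , _ , refl ← ∈-map⁻ (u ∷_) ∈ˡ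
                with _ , x , _ , refl , m≤x ← peaks-sound (u ∷ U) m r sorted ∈ʳ =
      ℕ.≤⇒≯ m≤x (All.head (proj₂ sorted))

  peaks-unique : ∀ U m r → Sorted U m → Unique (peaks U m r)
  peaks-unique U m zero    _      = []
  peaks-unique U m (suc r) sorted = Unique.++⁺
    (Unique.map⁺ List.∷-injectiveʳ (scans-unique U (suc m) r (sorted-suc sorted)))
    (peaks-unique (U ++ m ∷ []) (suc m) r (sorted-skip sorted)) λ (∈ˡ , ∈ʳ) → clash ∈ˡ ∈ʳ
    where
    clash : ∀ {xs} → xs ∈ map (m ∷_) (scans U (suc m) r) → ¬ xs ∈ peaks (U ++ m ∷ []) (suc m) r
    clash ∈ˡ ∈ʳ with ys , _ , refl ← ∈-map⁻ (m ∷_) ∈ˡ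
                with _ , x , _ , refl , m<m ← peaks-sound (U ++ m ∷ []) (suc m) r (sorted-skip sorted) ∈ʳ =
      <-irrefl refl m<m

scan⁺ : ∀ {n xs} → Arrangement 1 n xs → AllTriples (Not Order321) xs → Scan [] 1 n xs
scan⁺ {xs = xs} (xs! , bounds , all∈) av = scan xs! (inj₂ ∘ bounds) (λ { (inj₂ (l , h)) → all∈ l h })
  (allPairs-∈ xs λ y∈ _ y<1 → contradiction (proj₁ (bounds y∈)) (ℕ.<⇒≱ y<1)) av

scan⁻ : ∀ {n xs} → Scan [] 1 n xs → Arrangement 1 n xs × AllTriples (Not Order321) xs
scan⁻ (scan xs! letters onto _ av) =
  (xs! , (λ x∈ → [ (λ ()) , id ]′ (letters x∈)) , (λ l h → onto (inj₂ (l , h)))) , av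

-- A skipped letter is read only after the maximum exceeding it, at a position beyond its value.
Late : List ℕ → ℕ → Set
Late []      m = ⊤
Late (u ∷ U) m = u + suc (length U) < m × Late U m

late-suc : ∀ U {m} → Late U m → Late U (suc m)
late-suc []      _         = tt
late-suc (u ∷ U) (u< , lt) = m≤n⇒m≤1+n u< , late-suc U lt

late-skip : ∀ U {m} → Late U (suc m) → Late (U ++ m ∷ []) (suc (suc m))
late-skip []      {m} _ = s≤s (subst (_≤ suc m) (ℕ.+-comm 1 m) ≤-refl) , tt
late-skip (u ∷ U) {m} (u< , lt) = s≤s (subst (_≤ suc m) (sym eq) u<) , late-skip U lt
  where
  eq : u + suc (length (U ++ m ∷ [])) ≡ suc (u + suc (length U))
  eq = trans (cong (λ l → u + suc l) (trans (List.length-++ U) (ℕ.+-comm (length U) 1))) (ℕ.+-suc u (suc (length U)))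

-- Weights of the words avoiding 321

module _ {c ℓ} (R : CommutativeRing c ℓ) (t q : CommutativeRing.Carrier R) where
  open CommutativeRing R hiding (refl; sym; trans; zero) renaming (_+_ to _⊕_)
  private module C = CommutativeRing R
  open Sums R
  open SumProperties R
  open PathSums R t q
  open import Algebra.Properties.Semiring.Exp semiring using (^-homo-*; ^-congʳ)
  open import Algebra.Solver.Ring.NaturalCoefficients.Default commutativeSemiring
    using (solve; _:+_; _:*_; _:=_; con)

  weight : ℕ → List ℕ → Carrier
  weight i xs = t ^ weakExcedances i xs * q ^ inversions xs

  private
    -- As the least unread letter, u begins no inversion, and u < i means that it is not a weak
    -- excedance.
    weight-old : ∀ {u U m r} i xs → Sorted (u ∷ U) m → u < i → Scan U m r xs → weight i (u ∷ xs) ≈ weight (suc i) xs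
    weight-old {u} {r = r} i xs sorted u<i sc = *-cong
      (^-congʳ t (cong (_+ weakExcedances (suc i) xs) (indicator-no (i ≤? u) (ℕ.<⇒≱ u<i))))
      (^-congʳ q (cong (_+ inversions xs) (#-none (_<? u)
        (All.tabulate λ x∈ x<u → <-asym x<u (head<remaining {r = r} sorted (Scan.letters sc x∈))))))

    smaller-letters : ∀ {U m r xs} → Sorted U m → Scan U (suc m) r xs → # (_<? m) xs ≡ length U
    smaller-letters {U} {m} {xs = xs} (U< , U<m) sc = ↭-length (unique∧set⇒↭
      (Unique.filter⁺ (_<? m) (Scan.unique sc)) (AllPairs.map ℕ.<⇒≢ U<)
      (λ x∈ → let x∈xs , x<m = ∈-filter⁻ (_<? m) {xs = xs} x∈ in
        [ id , (λ (m<x , _) → contradiction x<m (<-asym m<x)) ]′ (Scan.letters sc x∈xs))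
      (λ x∈ → ∈-filter⁺ (_<? m) (Scan.onto sc (inj₁ x∈)) (All.lookup U<m x∈)))

    -- The unread letters below m are exactly those of `U`, each making an inversion with m; and i ≤
    -- m makes m a weak excedance.
    weight-new : ∀ {U m r} i xs → Sorted U m → i ≤ m → Scan U (suc m) r xs →
                 weight i (m ∷ xs) ≈ t·q^ (length U) * weight (suc i) xs
    weight-new {U} {m} i xs sorted i≤m sc = C.trans
      (*-cong (^-congʳ t (cong (_+ weakExcedances (suc i) xs) (indicator-yes (i ≤? m) i≤m)))
        (C.trans (^-congʳ q (cong (_+ inversions xs) (smaller-letters sorted sc))) (^-homo-* q (length U) _)))
      (C.trans (solve 4 (λ t w l v → (t :* w) :* (l :* v) := (t :* l) :* (w :* v)) C.refl _ _ _ _)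
               (*-congʳ (C.sym (t·q^≈ (length U)))))

  mutual
    -- The invariant i + |U| = m says that of the m - 1 letters below m the first i - 1 positions
    -- hold all but those in `U`. It turns the first condition of `Late` into u < i.
    ∑-scans : ∀ U m r i → i + length U ≡ m → Sorted U m → Late U m → ∑ (scans U m r) (weight i) ≈ paths (length U) r
    ∑-scans []      m zero    i eq sorted lt = C.trans (+-identityʳ _) (*-identityˡ 1#)
    ∑-scans []      m (suc r) i eq sorted lt = ∑-peaks [] m (suc r) i eq sorted lt
    ∑-scans (u ∷ U) m r       i eq sorted lt = C.trans (∑-++ (map (u ∷_) (scans U m r)) _ (weight i)) (+-cong
      (C.trans (∑-map (u ∷_) (scans U m r) (weight i)) (C.trans
        (∑-cong (scans U m r) λ xs xs∈ → weight-old i xs sorted u<i (scans-sound U m r (sorted-tail sorted) xs∈))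
        (∑-scans U m r (suc i) (trans (sym (ℕ.+-suc i (length U))) eq) (sorted-tail sorted) (proj₂ lt))))
      (∑-peaks (u ∷ U) m r i eq sorted (late-suc (u ∷ U) lt)))
      where
      u<i : u < i
      u<i = ℕ.+-cancelʳ-< (suc (length U)) u i (subst (u + suc (length U) <_) (sym eq) (proj₁ lt))

    -- `Late` is taken at m + 1, where it will hold once the next maximum is read. A letter m just
    -- skipped satisfies it only from m + 2 on, which is what `late-skip` supplies.
    ∑-peaks : ∀ U m r i → i + length U ≡ m → Sorted U m → Late U (suc m) → ∑ (peaks U m r) (weight i) ≈ climbs (length U) r
    ∑-peaks U m zero    i eq sorted lt = C.refl
    ∑-peaks U m (suc r) i eq sorted lt = C.trans (∑-++ (map (m ∷_) (scans U (suc m) r)) _ (weight i)) (+-cong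
      (C.trans (∑-map (m ∷_) (scans U (suc m) r) (weight i)) (C.trans
        (∑-cong (scans U (suc m) r) λ xs xs∈ →
          weight-new i xs sorted (subst (i ≤_) eq (ℕ.m≤m+n i (length U)))
            (scans-sound U (suc m) r (sorted-suc sorted) xs∈))
        (C.trans (∑-*ˡ _ (scans U (suc m) r) (weight (suc i)))
          (*-congˡ (∑-scans U (suc m) r (suc i) (cong suc eq) (sorted-suc sorted) lt)))))
      (C.trans (∑-peaks (U ++ m ∷ []) (suc m) r i skip-eq (sorted-skip sorted) (late-skip U lt))
               (C.reflexive (cong (λ l → climbs l r) length-skip))))
      where
      length-skip : length (U ++ m ∷ []) ≡ suc (length U)
      length-skip = trans (List.length-++ U) (ℕ.+-comm (length U) 1)
      skip-eq : i + length (U ++ m ∷ []) ≡ suc m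
      skip-eq = trans (cong (i +_) length-skip) (trans (ℕ.+-suc i (length U)) (cong suc eq))

  W≈paths : ∀ n → W n t q ≈ paths 0 n
  W≈paths n = C.trans
    (∑-𝔖 Order321 p321 describes321 (mk⇔ (λ (p , r) → s≤s p , s≤s r) (λ (p , r) → ℕ.≤-pred p , ℕ.≤-pred r)) R n
      {g = weight 1} (scans [] 1 n) (scans-unique [] 1 n ([] , []))
      (scan⁻ ∘ scans-sound [] 1 n ([] , []))
      (λ arr av → scans-complete [] 1 n ([] , []) (scan⁺ arr av))
      λ π _ → *-cong (^-congʳ t (wex≡ π)) (^-congʳ q (inv≡ π)))
    (∑-scans [] 1 n 1 refl ([] , []) tt)

-- Equidistribution for the ten pairs

shapePattern : Shape → Pattern
shapePattern s231 = p231
shapePattern s213 = p213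

describesShape : ∀ s → Describes (ShapeOrder s) (shapePattern s)
describesShape s231 = describes231
describesShape s213 = describes213

shapeOrder-suc : ∀ s {x y z} → ShapeOrder s x y z ⇔ ShapeOrder s (suc x) (suc y) (suc z)
shapeOrder-suc s231 = mk⇔ (λ (p , r) → s≤s p , s≤s r) (λ (p , r) → ℕ.≤-pred p , ℕ.≤-pred r)
shapeOrder-suc s213 = mk⇔ (λ (p , r) → s≤s p , s≤s r) (λ (p , r) → ℕ.≤-pred p , ℕ.≤-pred r)

module _ {c ℓ} (R : CommutativeRing c ℓ) where
  open CommutativeRing R hiding (refl; sym; trans; zero) renaming (_+_ to _⊕_)
  private module C = CommutativeRing R
  open Sums R
  open SumProperties R
  open PowerSeries commutativeSemiring using (const; _+ˢ_)
  open import Algebra.Properties.Semiring.Exp semiring using (^-congʳ)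

  ∑-reverseComplement : ∀ n τ τ′ → Complementary 4 τ τ′ → Complementary 4 τ′ τ → ∀ (f : Word n → Carrier) →
                        ∑ (𝔖 n τ′) f ≈ ∑ (𝔖 n τ) (f ∘ reverseComplement)
  ∑-reverseComplement n τ τ′ comp comp′ f = C.trans
    (∑-↭ f (unique∧set⇒↭ (𝔖-unique n τ′)
      (Unique.map⁺ (λ {π} {σ} eq → trans (sym (reverseComplement-involutive π))
         (trans (cong reverseComplement eq) (reverseComplement-involutive σ))) (𝔖-unique n τ)) to from))
    (∑-map reverseComplement (𝔖 n τ) f)
    where
    to : ∀ {π} → π ∈ 𝔖 n τ′ → π ∈ map reverseComplement (𝔖 n τ)
    to {π} π∈ with π! , av ← ∈-𝔖⁻ n τ′ π∈ = subst (_∈ map reverseComplement (𝔖 n τ)) (reverseComplement-involutive π)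
      (∈-map⁺ reverseComplement
        (∈-𝔖⁺ n τ (reverseComplement-unique π π!) (av ∘ reverseComplement-contains π τ τ′ comp′)))
    from : ∀ {π} → π ∈ map reverseComplement (𝔖 n τ) → π ∈ 𝔖 n τ′
    from π∈ with σ , σ∈ , refl ← ∈-map⁻ reverseComplement π∈ with σ! , av ← ∈-𝔖⁻ n τ σ∈ =
      ∈-𝔖⁺ n τ′ (reverseComplement-unique σ σ!) (av ∘ reverseComplement-contains σ τ′ τ comp)

  module _ (t t⁻¹ q : Carrier) (tt⁻¹ : t * t⁻¹ ≈ 1#) (n : ℕ) where
    open TreeSeries R q using (N; weighted; descentWeight-monomial; ∑-trees-low; ∑-trees-low-mirror)
    open PathSums R t q using (paths-from-0)

    term : Statistic n → Word n → Carrier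
    term stat π = (q * t⁻¹) ^ des π * q ^ stat π

    Equidistributed : Pattern → Statistic n → Set ℓ
    Equidistributed τ stat = W n t q ≈ t ^ n * ∑ (𝔖 n τ) (term stat)

    W≈N : W n t q ≈ (const 1# +ˢ N t) n
    W≈N = C.trans (W≈paths R t q n) (paths-from-0 n)

    -- Both sides are compared with the coefficient of 1 + N: the left through walks, the right
    -- through trees of size n, where t^n is absorbed node by node.
    equidistributed-by-trees : ∀ s stat (listStat : List ℕ → ℕ) (treeStat : Tree → ℕ) →
      (∀ π → stat π ≡ listStat (oneLine π)) → (∀ x → listStat (word s 1 x) ≡ treeStat x) →
      ∑ (trees n) (weighted t treeStat) ≈ (const 1# +ˢ N t) n → Equidistributed (shapePattern s) stat
    equidistributed-by-trees s stat listStat treeStat stat≡ listStat≡ sum =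
      C.trans W≈N (C.sym (C.trans (*-congˡ to-trees) (C.trans (C.sym (∑-*ˡ (t ^ n) (trees n) _))
        (C.trans (∑-cong (trees n) monomial) sum))))
      where
      to-trees : ∑ (𝔖 n (shapePattern s)) (term stat) ≈ ∑ (trees n) (λ x → (q * t⁻¹) ^ descents x * q ^ treeStat x)
      to-trees = C.trans
        (∑-𝔖 (ShapeOrder s) (shapePattern s) (describesShape s) (shapeOrder-suc s) R n
          {g = λ xs → (q * t⁻¹) ^ listDescents xs * q ^ listStat xs} (map (word s 1) (trees n))
          (words-of-trees-unique s n) (words-of-trees-sound s) (words-of-trees-complete s)
          (λ π _ → *-cong (^-congʳ _ (des≡ π)) (^-congʳ q (stat≡ π))))
        (C.trans (∑-map (word s 1) (trees n) _) (∑-cong (trees n) λ x _ →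
          *-cong (^-congʳ _ (listDescents-word s 1 x)) (^-congʳ q (listStat≡ x))))
      monomial : ∀ x → x ∈ trees n → t ^ n * ((q * t⁻¹) ^ descents x * q ^ treeStat x) ≈ weighted t treeStat x
      monomial x x∈ with refl ← ∈-treesUpTo⁻ n n x∈ =
        C.trans (C.sym (*-assoc _ _ _)) (*-congʳ (descentWeight-monomial t t⁻¹ tt⁻¹ x))

    equidistributed-31-2 : ∀ s → Equidistributed (shapePattern s) 31-2
    equidistributed-31-2 s = equidistributed-by-trees s 31-2 V<.vincularWord low 31-2≡
      (λ x → V<.vincularWord-low <-trans <-asym (word-encodes s 1 x)) (∑-trees-low t n)

    equidistributed-13-2 : ∀ s → Equidistributed (shapePattern s) 13-2
    equidistributed-13-2 s = equidistributed-by-trees s 13-2 V>.vincularWord (low ∘ mirror) 13-2≡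
      (λ x → V>.vincularWord-low (flip <-trans) <-asym (word-encodes-mirror s 1 x)) (∑-trees-low-mirror t n)

    equidistributed-cong : ∀ τ stat stat′ → (∀ π → π ∈ 𝔖 n τ → stat π ≡ stat′ π) →
                           Equidistributed τ stat → Equidistributed τ stat′
    equidistributed-cong τ stat stat′ eq W≈ = C.trans W≈
      (*-congˡ (∑-cong (𝔖 n τ) λ π π∈ → *-congˡ (^-congʳ q (eq π π∈))))

    equidistributed-adi* : Equidistributed p231 adi*
    equidistributed-adi* = equidistributed-cong p231 13-2 adi*
      (λ π π∈ → let π! , av = ∈-𝔖⁻ n p231 π∈ in sym (adi*≡13-2 π π! av)) (equidistributed-13-2 s231)

    equidistributed-reverseComplement : ∀ τ τ′ stat stat′ → Complementary 4 τ τ′ → Complementary 4 τ′ τ →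
      (∀ π → stat′ (reverseComplement π) ≡ stat π) → Equidistributed τ stat → Equidistributed τ′ stat′
    equidistributed-reverseComplement τ τ′ stat stat′ comp comp′ eq W≈ = C.trans W≈ (*-congˡ (C.sym (C.trans
      (∑-reverseComplement n τ τ′ comp comp′ (term stat′))
      (∑-cong (𝔖 n τ) λ π _ → *-cong (^-congʳ _ (des-reverseComplement π)) (^-congʳ q (eq π))))))

p231-p312 : Complementary 4 p231 p312
p231-p312 = λ { zero → refl ; (suc zero) → refl ; (suc (suc zero)) → refl }

p312-p231 : Complementary 4 p312 p231
p312-p231 = λ { zero → refl ; (suc zero) → refl ; (suc (suc zero)) → refl }

p213-p132 : Complementary 4 p213 p132
p213-p132 = λ { zero → refl ; (suc zero) → refl ; (suc (suc zero)) → refl }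

p132-p213 : Complementary 4 p132 p213
p132-p213 = λ { zero → refl ; (suc zero) → refl ; (suc (suc zero)) → refl }

theorem4p2 : ∀ {c ℓ} (R : CommutativeRing c ℓ) →
    let open CommutativeRing R in
    let open Sums R in
    (t t⁻¹ q : Carrier) → t * t⁻¹ ≈ 1# →
    (n : ℕ) → n ≥ 1 →
    All (λ ((τ , stat) : Pattern × Statistic n) →
    W n t q ≈ t ^ n * ∑ (𝔖 n τ) (λ π → (q * t⁻¹) ^ des π * q ^ stat π))
    ( (p231 , 31-2) ∷ (p231 , 13-2) ∷ (p231 , adi*)
    ∷ (p312 , 2-31) ∷ (p312 , 2-13) ∷ (p312 , adi)
    ∷ (p213 , 31-2) ∷ (p213 , 13-2)
    ∷ (p132 , 2-31) ∷ (p132 , 2-13)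
    ∷ [])
theorem4p2 R t t⁻¹ q tt⁻¹ n _ =
    by-31-2 s231 ∷ by-13-2 s231 ∷ by-adi*
  ∷ reverse p231 p312 31-2 2-31 p231-p312 p312-p231 2-31-reverseComplement (by-31-2 s231)
  ∷ reverse p231 p312 13-2 2-13 p231-p312 p312-p231 2-13-reverseComplement (by-13-2 s231)
  ∷ reverse p231 p312 adi* adi p231-p312 p312-p231 adi-reverseComplement by-adi*
  ∷ by-31-2 s213 ∷ by-13-2 s213
  ∷ reverse p213 p132 31-2 2-31 p213-p132 p132-p213 2-31-reverseComplement (by-31-2 s213)
  ∷ reverse p213 p132 13-2 2-13 p213-p132 p132-p213 2-13-reverseComplement (by-13-2 s213)
  ∷ []
  where
  by-31-2 = equidistributed-31-2 R t t⁻¹ q tt⁻¹ n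
  by-13-2 = equidistributed-13-2 R t t⁻¹ q tt⁻¹ n
  by-adi* = equidistributed-adi* R t t⁻¹ q tt⁻¹ n
  reverse = equidistributed-reverseComplement R t t⁻¹ q tt⁻¹ n
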